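{- Let $p$ be an odd prime, let $F/\mathbb{Q}$ be a cyclic extension of degree $p$, let $K=\mathbb{Q}(\zeta_p)$ and $L=FK$, with $\Phi$ as defined in the context. There are infinitely many elements $x\in L^{*}$ such that both 1. $\Phi(\mathrm{N}_{L/K}(x))\notin (L^{*})^{p}$, and 2. $\Phi(\zeta_p\mathrm{N}_{L/K}(x))\notin (L^{*})^{p}$.
   Context: $\zeta_p$ is a fixed primitive $p$-th root of unity and all fields lie in a fixed algebraic closure of $\mathbb{Q}$. $(L^*)^p$ is the group of $p$-th powers of elements of $L^*$. Let $\bar\tau$ be a fixed generator of $\mathrm{Gal}(L/F)$ (cyclic of order $p-1$) and let $e$ be a primitive root modulo $p$. The homomorphism $\Phi:L^*\to L^*$ is $$\Phi(y)=\prod_{j=0}^{p-2}\bar\tau^{j}(y)^{e^{p-2-j}}=y^{e^{p-2}}\,\bar\tau(y)^{e^{p-3}}\cdots\bar\tau^{p-2}(y).$$ -}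

module Defs where

open import Algebra.Bundles using (CommutativeRing; RawRing)
open import Algebra.Morphism.Structures using (IsRingMonomorphism; IsRingIsomorphism)
import Algebra.Morphism.RingMonomorphism as RingMono
import Algebra.Properties.CommutativeMonoid.Sum as BigOp
import Algebra.Properties.Monoid.Mult as Mult
import Algebra.Properties.Semiring.Exp as Exp
open import Data.Fin.Base using (Fin; toℕ)
open import Data.List.Base using (List)
open import Data.List.Relation.Unary.All using (All)
open import Data.Nat.Base as ℕ using (ℕ; suc; _∸_; _<_; ∣_-_∣)
open import Data.Nat.Coprimality using (Coprime)
open import Data.Nat.Divisibility using (_∣_)
open import Data.Nat.GeneralisedArithmetic using (fold)
open import Data.Product.Base using (Σ; ∃; _×_; _,_; proj₁; proj₂)
open import Data.Sum.Base using (inj₂)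
open import Level using (Level; _⊔_) renaming (suc to lsuc)
open import Relation.Binary.Definitions using (Decidable)
open import Relation.Binary.PropositionalEquality.Core using (_≡_)
open import Relation.Nullary.Negation using (¬_)
open import Relation.Unary using (Pred; _∈_; _∪_; ∅)

PrimitiveRootMod : ℕ → ℕ → Set
PrimitiveRootMod p e =
  Coprime e p × (∀ a → Coprime a p → ∃ λ i → p ∣ ∣ e ℕ.^ i - a ∣)

-- Equality is decidable and every nonzero element is invertible, as for the
-- fields of classical algebra.  (The library's HeytingField is a weaker notion:
-- its equality need not be decidable.)
record IsField {c ℓ} (R : CommutativeRing c ℓ) : Set (c ⊔ ℓ) where
  open CommutativeRing R
  field
    _≟_     : Decidable _≈_
    1≉0     : ¬ 1# ≈ 0#
    inverse : ∀ x → ¬ x ≈ 0# → ∃ λ y → x * y ≈ 1#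

module Subfields {c ℓ} (R : CommutativeRing c ℓ) where
  open CommutativeRing R

  record Subfield (s : Level) : Set (c ⊔ ℓ ⊔ lsuc s) where
    field
      Member     : Pred Carrier s
      resp       : ∀ {x y} → x ≈ y → x ∈ Member → y ∈ Member
      0-closed   : 0# ∈ Member
      1-closed   : 1# ∈ Member
      +-closed   : ∀ {x y} → x ∈ Member → y ∈ Member → x + y ∈ Member
      *-closed   : ∀ {x y} → x ∈ Member → y ∈ Member → x * y ∈ Member
      neg-closed : ∀ {x} → x ∈ Member → - x ∈ Member
      inv-closed : ∀ {x y} → x ∈ Member → x * y ≈ 1# → y ∈ Member

  open Subfield public

  ⟨_⟩ : ∀ {s} → Subfield s → Set (c ⊔ s)
  ⟨ E ⟩ = Σ Carrier (Member E)

  module _ {s} (E : Subfield s) where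

    rawRing-of : RawRing (c ⊔ s) ℓ
    rawRing-of = record
      { Carrier = ⟨ E ⟩
      ; _≈_     = λ x y → proj₁ x ≈ proj₁ y
      ; _+_     = λ x y → proj₁ x + proj₁ y , +-closed E (proj₂ x) (proj₂ y)
      ; _*_     = λ x y → proj₁ x * proj₁ y , *-closed E (proj₂ x) (proj₂ y)
      ; -_      = λ x → - proj₁ x , neg-closed E (proj₂ x)
      ; 0#      = 0# , 0-closed E
      ; 1#      = 1# , 1-closed E
      }

    inclusion-isRingMonomorphism : IsRingMonomorphism rawRing-of rawRing proj₁
    inclusion-isRingMonomorphism = record
      { isRingHomomorphism = record
        { isSemiringHomomorphism = record
          { isNearSemiringHomomorphism = record
            { +-isMonoidHomomorphism = record
              { isMagmaHomomorphism = record
                { isRelHomomorphism = record { cong = λ eq → eq }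
                ; homo = λ _ _ → refl
                }
              ; ε-homo = refl
              }
            ; *-homo = λ _ _ → refl
            }
          ; 1#-homo = refl
          }
        ; -‿homo = λ _ → refl
        }
      ; injective = λ eq → eq
      }

    ring-of : CommutativeRing (c ⊔ s) ℓ
    ring-of = record
      { RawRing rawRing-of
      ; isCommutativeRing =
          RingMono.isCommutativeRing inclusion-isRingMonomorphism isCommutativeRing
      }

  data Generated {s} (S : Pred Carrier s) : Pred Carrier (c ⊔ ℓ ⊔ s) where
    gen      : ∀ {x} → x ∈ S → Generated S x
    gen-resp : ∀ {x y} → x ≈ y → Generated S x → Generated S y
    gen-0    : Generated S 0#
    gen-1    : Generated S 1#
    gen-+    : ∀ {x y} → Generated S x → Generated S y → Generated S (x + y)
    gen-*    : ∀ {x y} → Generated S x → Generated S y → Generated S (x * y)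
    gen-neg  : ∀ {x} → Generated S x → Generated S (- x)
    gen-inv  : ∀ {x y} → Generated S x → x * y ≈ 1# → Generated S y

  generated : ∀ {s} → Pred Carrier s → Subfield (c ⊔ ℓ ⊔ s)
  generated S = record
    { Member     = Generated S
    ; resp       = gen-resp
    ; 0-closed   = gen-0
    ; 1-closed   = gen-1
    ; +-closed   = gen-+
    ; *-closed   = gen-*
    ; neg-closed = gen-neg
    ; inv-closed = gen-inv
    }

  -- The prime field; it is ℚ once the characteristic is 0.
  primeField : Subfield (c ⊔ ℓ)
  primeField = generated ∅

-- An algebraic closure of ℚ.  Polynomials are monic and given by their lower
-- coefficients.
record AlgebraicClosureOfℚ c ℓ : Set (lsuc (c ⊔ ℓ)) where
  field
    commutativeRing : CommutativeRing c ℓ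
    isField         : IsField commutativeRing

  open CommutativeRing commutativeRing public
  open IsField isField public
  open Subfields commutativeRing public
  open Exp semiring public using (_^_)
  open Mult +-monoid public using () renaming (_×_ to _·_)
  open BigOp +-commutativeMonoid public using () renaming (sum to ∑)
  open BigOp *-commutativeMonoid public using () renaming (sum to ∏)

  ℚ-field : Subfield (c ⊔ ℓ)
  ℚ-field = primeField

  eval-monic : ∀ {n} → (Fin n → Carrier) → Carrier → Carrier
  eval-monic {n} a x = x ^ n + ∑ (λ i → a i * x ^ toℕ i)

  field
    characteristic-0    : ∀ n → ¬ suc n · 1# ≈ 0#
    algebraic           : ∀ x → ∃ λ n → Σ (Fin n → ⟨ ℚ-field ⟩) λ a →
                          eval-monic (λ i → proj₁ (a i)) x ≈ 0#
    algebraicallyClosed : ∀ n (a : Fin (suc n) → Carrier) →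
                          ∃ λ x → eval-monic a x ≈ 0#

module FieldTheory {c ℓ} (Ω : AlgebraicClosureOfℚ c ℓ) where
  open AlgebraicClosureOfℚ Ω

  PrimitiveRootOfUnity : ℕ → Carrier → Set ℓ
  PrimitiveRootOfUnity n ζ =
    ζ ^ n ≈ 1# × (∀ m → 0 < m → m < n → ¬ ζ ^ m ≈ 1#)

  ℚ⟨_⟩ : Carrier → Subfield (c ⊔ ℓ)
  ℚ⟨ ζ ⟩ = generated (ζ ≈_)

  compositum : ∀ {s t} → Subfield s → Subfield t → Subfield (c ⊔ ℓ ⊔ s ⊔ t)
  compositum E E′ = generated (Member E ∪ Member E′)

  ζ-in-compositum : ∀ {s} (E : Subfield s) (ζ : Carrier) → ⟨ compositum E ℚ⟨ ζ ⟩ ⟩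
  ζ-in-compositum E ζ = ζ , gen (inj₂ (gen refl))

  module _ {s t} (k : Subfield s) (E : Subfield t) where

    record HasDegree (n : ℕ) : Set (c ⊔ ℓ ⊔ s ⊔ t) where
      field
        includes    : ∀ {x} → x ∈ Member k → x ∈ Member E
        basis       : Fin n → ⟨ E ⟩
        spanning    : (x : ⟨ E ⟩) → Σ (Fin n → ⟨ k ⟩) λ a →
                      proj₁ x ≈ ∑ (λ i → proj₁ (a i) * proj₁ (basis i))
        independent : (a : Fin n → ⟨ k ⟩) →
                      ∑ (λ i → proj₁ (a i) * proj₁ (basis i)) ≈ 0# →
                      ∀ i → proj₁ (a i) ≈ 0#

    record Embedding : Set (c ⊔ ℓ ⊔ s ⊔ t) where
      field
        map                : ⟨ E ⟩ → Carrier
        isRingMonomorphism : IsRingMonomorphism (rawRing-of E) rawRing map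
        fixes              : ∀ x → proj₁ x ∈ Member k → map x ≈ proj₁ x

    record Automorphism : Set (c ⊔ ℓ ⊔ s ⊔ t) where
      field
        map               : ⟨ E ⟩ → ⟨ E ⟩
        isRingIsomorphism : IsRingIsomorphism (rawRing-of E) (rawRing-of E) map
        fixes             : ∀ x → proj₁ x ∈ Member k → proj₁ (map x) ≈ proj₁ x

      iterated : ℕ → ⟨ E ⟩ → ⟨ E ⟩
      iterated j x = fold x map j

    -- Aut(E/k) is cyclic of order n with generator σ:
    -- it consists of the n distinct powers σ⁰, …, σⁿ⁻¹.
    record CyclicGenerator (n : ℕ) (σ : Automorphism) : Set (c ⊔ ℓ ⊔ s ⊔ t) where
      open Automorphism
      field
        generates : (g : Automorphism) → ∃ λ (i : Fin n) →
                    ∀ x → proj₁ (map g x) ≈ proj₁ (iterated σ (toℕ i) x)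
        distinct  : (i j : Fin n) →
                    (∀ x → proj₁ (iterated σ (toℕ i) x) ≈ proj₁ (iterated σ (toℕ j) x)) →
                    i ≡ j

    -- E/k is Galois because |Aut(E/k)| = n = [E : k].
    record IsCyclicExtension (n : ℕ) : Set (c ⊔ ℓ ⊔ s ⊔ t) where
      field
        degree    : HasDegree n
        generator : Automorphism
        cyclic    : CyclicGenerator n generator

    -- IsNorm x z says that N_{E/k}(x) = z: the norm of a finite extension in
    -- characteristic 0 is the product of the images of x under the k-embeddings of
    -- E into the algebraic closure.  It is a relation because the list of embeddings
    -- has to be exhibited; z does not depend on the order of the list.
    record IsNorm (x : ⟨ E ⟩) (z : Carrier) : Set (c ⊔ ℓ ⊔ s ⊔ t) where
      open Embedding
      field
        size      : ℕ
        embedding : Fin size → Embedding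
        distinct  : ∀ i j → (∀ y → map (embedding i) y ≈ map (embedding j) y) → i ≡ j
        complete  : (g : Embedding) → ∃ λ i → ∀ y → map g y ≈ map (embedding i) y
        product   : z ≈ ∏ (λ i → map (embedding i) x)

  module _ {s} (E : Subfield s) where
    private module E = CommutativeRing (ring-of E)
    open Exp E.semiring using () renaming (_^_ to _^ᴱ_)
    open BigOp E.*-commutativeMonoid using () renaming (sum to ∏ᴱ)

    Nonzero : ⟨ E ⟩ → Set ℓ
    Nonzero x = ¬ x E.≈ E.0#

    -- y ∈ (E*)ᵖ
    IsPower : ℕ → ⟨ E ⟩ → Set (c ⊔ ℓ ⊔ s)
    IsPower p y = Σ ⟨ E ⟩ λ w → Nonzero w × w ^ᴱ p E.≈ y

    -- The resolvent ∏_{j=0}^{p-2} τʲ(y)^(e^(p-2-j)).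
    Φ : ∀ {t} {k : Subfield t} → ℕ → ℕ → Automorphism k E → ⟨ E ⟩ → ⟨ E ⟩
    Φ p e τ y = ∏ᴱ {p ∸ 1} λ j →
      Automorphism.iterated τ (toℕ j) y ^ᴱ (e ℕ.^ (p ∸ 2 ∸ toℕ j))

    -- No finite list exhausts the nonzero elements of E satisfying P.
    InfinitelyManyNonzero : ∀ {q} → Pred ⟨ E ⟩ q → Set (c ⊔ ℓ ⊔ s ⊔ q)
    InfinitelyManyNonzero P = (xs : List ⟨ E ⟩) →
      ∃ λ x → All (λ y → ¬ x E.≈ y) xs × Nonzero x × P x

{-# OPTIONS --safe #-}

-- One element x for which Φ(N x)ᵖ has no p²-th root in L suffices: Φ(ζ)ᵖ = 1, and for the
-- multiples s x by positive integers s one has Φ(N(s x)) = Φ(s)ᵖ Φ(N x).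
--
-- Take b ∈ F moved by Gal(F/ℚ) and θ = b ζ.  The p (p - 1) elements ρ = σⁱ(b) τʲ(ζ) are
-- distinct, so that θ generates L and is a root of h = ∏ (X - ρ) ∈ ℚ[X].  There are an integer
-- t and a prime q dividing h(t) at which h, the elements ρ and the inverses of the θ - ρ with
-- ρ ≠ θ, written as polynomials in θ, have no denominator.  Then θ ↦ t defines a place of L
-- with residue field 𝔽_q.  The product H of the t - ρ with ρ ≠ θ is invertible there, and since
-- (t - θ) H = h(t) every y which vanishes at the place satisfies H y ∈ q ℤ₍q₎[θ].  Hence the
-- place carries a discrete valuation with uniformizer q.  The element x = (t - θ)² + q has
-- valuation 1 and its other conjugates have valuation 0.  So Φ(N x)ᵖ has valuation
-- p e^(p-2), which p² does not divide.
module Submission where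

open import Defs
open import Algebra.Bundles using (CommutativeRing)
import Algebra.Morphism.Construct.Composition as Composition
import Algebra.Morphism.Construct.Identity as Identity
open import Algebra.Morphism.Structures using (IsRingMonomorphism; IsRingIsomorphism)
import Algebra.Properties.AbelianGroup as AbelianGroupProperties
import Algebra.Properties.CommutativeMonoid.Sum as BigOp
import Algebra.Properties.CommutativeSemiring.Exp as ExpProperties
import Algebra.Properties.Ring as RingProperties
import Algebra.Properties.Semiring.Exp as Exp
import Algebra.Properties.Semiring.Mult.TCOptimised as Mult′
import Algebra.Properties.Semiring.Sum as SemiringSum
import Algebra.Solver.Ring as RingSolver
open import Algebra.Solver.Ring.AlmostCommutativeRing
  using (fromCommutativeRing; _-Raw-AlmostCommutative⟶_)
open import Data.Fin.Base as Fin
  using (Fin; zero; suc; toℕ; fromℕ; fromℕ<; inject₁; punchIn; combine; remQuot; _↑ˡ_; _↑ʳ_)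
import Data.Fin.Properties as Finₚ
open import Data.Fin.Relation.Unary.Top using (view; ‵fromℕ; ‵inject₁)
open import Data.Integer.Base as ℤ using (ℤ; +_; -[1+_]; _⊖_; _◃_)
import Data.Integer.Divisibility.Signed as ℤ∣
import Data.Integer.Properties as ℤₚ
open import Data.Integer.Tactic.RingSolver using () renaming (solve-∀ to ℤ-solve-∀)
open import Data.List.Base using (List; []; _∷_; length; lookup)
open import Data.List.Relation.Unary.All using (All; []; _∷_)
open import Data.List.Relation.Unary.All.Properties using (¬Any⇒All¬)
open import Data.List.Relation.Unary.Any as Any using (Any)
open import Data.List.Relation.Unary.Any.Properties using (lookup-index)
open import Data.Maybe.Base using (Maybe; just; nothing)
open import Data.Nat.Base as ℕ using (ℕ; zero; suc; z≤n; s≤s; _∸_)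
open import Data.Nat.Coprimality using (Coprime; coprime-Bézout; prime⇒coprime)
open import Data.Nat.Divisibility
  using (_∣_; _∤_; _∣?_; divides; _∣0; ∣1⇒≡1; ∣⇒≤; ∣-refl; ∣-trans; m∣m*n; n∣m*n; ∣n⇒∣m*n;
    ∣m+n∣m⇒∣n; ∣m∸n∣n⇒∣m; *-cancelˡ-∣)
open import Data.Nat.GCD using (module Bézout)
open import Data.Nat.Induction using (<-rec)
open import Data.Nat.ListAction using (product)
open import Data.Nat.Primality
  using (Prime; prime[2]; euclidsLemma; ¬prime[0]; ¬prime[1])
open import Data.Nat.Primality.Factorisation using (factorise)
import Data.Nat.Properties as ℕₚ
open import Data.Product.Base using (Σ; ∃; ∃₂; _×_; _,_; proj₁; proj₂)
import Data.Sign.Base as Sign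
open import Data.Sum.Base using (_⊎_; inj₁; inj₂; [_,_]′)
open import Data.Unit.Polymorphic.Base using (⊤; tt)
open import Data.Vec.Functional using (insertAt)
import Data.Vec.Functional.Properties as Vecₚ
open import Function.Base using (_∘_)
open import Level using (_⊔_) renaming (suc to lsuc)
open import Relation.Binary.Definitions using (tri<; tri≈; tri>)
open import Relation.Binary.PropositionalEquality as ≡ using (_≡_)
import Relation.Binary.Reasoning.Setoid as SetoidReasoning
open import Relation.Nullary.Decidable.Core using (Dec; yes; no; ¬?; decidable-stable)
open import Relation.Nullary.Negation using (¬_; contradiction)
open import Relation.Unary using (Pred; _∈_; _⊆_; ∅)

-- Neither the ring of integers of L nor its ideals are constructed. The place is a relation between
-- polynomials in θ over ℤ₍q₎ and their values at t, and "y has valuation n" means S y = qⁿ U with S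
-- and U of unit residue; the factor S is there because an element of unit residue need not be
-- invertible in ℤ₍q₎[θ]. The norm obliges one to exhibit every embedding of L over K. These extend
-- the σⁱ by ζ ↦ ζ, which requires 1, ζ, ..., ζᵖ⁻² to be independent over F. The independence is
-- read off from τ: its p - 1 distinct powers fix F and so differ at ζ. Extending σⁱ and reducing at
-- the place are two instances of one construction, the graph of a homomorphism on A[θ], for the
-- zero ideal and for the ideal generated by q. The elements ρ are distinct because an unexpected
-- coincidence makes a quotient of conjugates of b a p-th root of unity other than 1 in F. Then ζ is
-- one of its powers and lies in F, although τ moves it.

-- The image of ℤ in a commutative ring, and identities with integer coefficients

module IntegerImage {c ℓ} (R : CommutativeRing c ℓ) where
  open CommutativeRing R
  open Mult′ semiring using (×-homo-+; ×1-homo-*; 1+×) renaming (_×_ to _×′_)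
  open AbelianGroupProperties +-abelianGroup using (⁻¹-∙-comm; ⁻¹-involutive; ε⁻¹≈ε)
  open RingProperties ring using (-‿distribˡ-*; -‿distribʳ-*)
  open SetoidReasoning setoid

  ⟪_⟫ : ℕ → Carrier
  ⟪ n ⟫ = n ×′ 1#

  ι : ℤ → Carrier
  ι (+ n)    = ⟪ n ⟫
  ι -[1+ n ] = - ⟪ suc n ⟫

  ι-⊖ : ∀ m n → ι (m ⊖ n) ≈ ⟪ m ⟫ - ⟪ n ⟫
  ι-⊖ zero    zero    = sym (-‿inverseʳ 0#)
  ι-⊖ zero    (suc n) = sym (+-identityˡ _)
  ι-⊖ (suc m) zero    = sym (trans (+-congˡ ε⁻¹≈ε) (+-identityʳ _))
  ι-⊖ (suc m) (suc n) = begin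
    ι (suc m ⊖ suc n)                   ≡⟨ ≡.cong ι (ℤₚ.[1+m]⊖[1+n]≡m⊖n m n) ⟩
    ι (m ⊖ n)                           ≈⟨ ι-⊖ m n ⟩
    ⟪ m ⟫ - ⟪ n ⟫                       ≈⟨ +-congʳ (+-identityʳ _) ⟨
    (⟪ m ⟫ + 0#) - ⟪ n ⟫                ≈⟨ +-congʳ (+-congˡ (-‿inverseʳ 1#)) ⟨
    (⟪ m ⟫ + (1# - 1#)) - ⟪ n ⟫         ≈⟨ +-congʳ (+-assoc _ _ _) ⟨
    ((⟪ m ⟫ + 1#) - 1#) - ⟪ n ⟫         ≈⟨ +-assoc _ _ _ ⟩
    (⟪ m ⟫ + 1#) + (- 1# - ⟪ n ⟫)       ≈⟨ +-cong (+-comm _ _) (⁻¹-∙-comm _ _) ⟩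
    (1# + ⟪ m ⟫) - (1# + ⟪ n ⟫)         ≈⟨ +-cong (1+× m 1#) (-‿cong (1+× n 1#)) ⟨
    ⟪ suc m ⟫ - ⟪ suc n ⟫               ∎

  ι-+ : ∀ i j → ι (i ℤ.+ j) ≈ ι i + ι j
  ι-+ (+ m)    (+ n)    = ×-homo-+ 1# m n
  ι-+ (+ m)    -[1+ n ] = ι-⊖ m (suc n)
  ι-+ -[1+ m ] (+ n)    = trans (ι-⊖ n (suc m)) (+-comm _ _)
  ι-+ -[1+ m ] -[1+ n ] = begin
    - ⟪ suc (suc (m ℕ.+ n)) ⟫      ≡⟨ ≡.cong (λ k → - ⟪ suc k ⟫) (≡.sym (ℕₚ.+-suc m n)) ⟩
    - ⟪ suc m ℕ.+ suc n ⟫          ≈⟨ -‿cong (×-homo-+ 1# (suc m) (suc n)) ⟩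
    - (⟪ suc m ⟫ + ⟪ suc n ⟫)      ≈⟨ ⁻¹-∙-comm _ _ ⟨
    - ⟪ suc m ⟫ - ⟪ suc n ⟫        ∎

  ι-+◃ : ∀ n → ι (Sign.+ ◃ n) ≈ ⟪ n ⟫
  ι-+◃ n = reflexive (≡.cong ι (ℤₚ.+◃n≡+n n))

  ι--◃ : ∀ n → ι (Sign.- ◃ n) ≈ - ⟪ n ⟫
  ι--◃ zero    = sym ε⁻¹≈ε
  ι--◃ (suc n) = refl

  ι-* : ∀ i j → ι (i ℤ.* j) ≈ ι i * ι j
  ι-* (+ m)    (+ n)    = trans (ι-+◃ (m ℕ.* n)) (×1-homo-* m n)
  ι-* (+ m)    -[1+ n ] = begin
    ι (Sign.- ◃ m ℕ.* suc n)       ≈⟨ ι--◃ (m ℕ.* suc n) ⟩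
    - ⟪ m ℕ.* suc n ⟫              ≈⟨ -‿cong (×1-homo-* m (suc n)) ⟩
    - (⟪ m ⟫ * ⟪ suc n ⟫)          ≈⟨ -‿distribʳ-* _ _ ⟩
    ⟪ m ⟫ * - ⟪ suc n ⟫            ∎
  ι-* -[1+ m ] (+ n)    = begin
    ι (Sign.- ◃ suc m ℕ.* n)       ≈⟨ ι--◃ (suc m ℕ.* n) ⟩
    - ⟪ suc m ℕ.* n ⟫              ≈⟨ -‿cong (×1-homo-* (suc m) n) ⟩
    - (⟪ suc m ⟫ * ⟪ n ⟫)          ≈⟨ -‿distribˡ-* _ _ ⟩
    - ⟪ suc m ⟫ * ⟪ n ⟫            ∎
  ι-* -[1+ m ] -[1+ n ] = begin
    ⟪ suc m ℕ.* suc n ⟫            ≈⟨ ×1-homo-* (suc m) (suc n) ⟩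
    ⟪ suc m ⟫ * ⟪ suc n ⟫          ≈⟨ ⁻¹-involutive _ ⟨
    - - (⟪ suc m ⟫ * ⟪ suc n ⟫)    ≈⟨ -‿cong (-‿distribʳ-* _ _) ⟩
    - (⟪ suc m ⟫ * - ⟪ suc n ⟫)    ≈⟨ -‿distribˡ-* _ _ ⟩
    - ⟪ suc m ⟫ * - ⟪ suc n ⟫      ∎

  ι-neg : ∀ i → ι (ℤ.- i) ≈ - ι i
  ι-neg (+ zero)  = sym ε⁻¹≈ε
  ι-neg (+ suc n) = refl
  ι-neg -[1+ n ]  = sym (⁻¹-involutive _)

  private
    ι-morphism : ℤ.+-*-rawRing -Raw-AlmostCommutative⟶ fromCommutativeRing R
    ι-morphism = record
      { ⟦_⟧ = ι ; +-homo = ι-+ ; *-homo = ι-* ; -‿homo = ι-neg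
      ; 0-homo = refl ; 1-homo = refl }

    ι-≟ : ∀ i j → Maybe (ι i ≈ ι j)
    ι-≟ i j with i ℤₚ.≟ j
    ... | yes i≡j = just (reflexive (≡.cong ι i≡j))
    ... | no  _   = nothing

  open RingSolver ℤ.+-*-rawRing (fromCommutativeRing R) ι-morphism ι-≟ public
    using (solve; _:=_; _:+_; _:*_; _:-_; :-_; con; _:^_)

-- Fields: cancellation, linear dependence, polynomials as tuples of coefficients

module FieldTools {c ℓ} (R : CommutativeRing c ℓ) (isField : IsField R) where
  open CommutativeRing R hiding (zero)
  open IsField isField
  open Subfields R
  open IntegerImage R
  open Exp semiring using (_^_)
  open BigOp +-commutativeMonoid using (sum-cong-≋; ∑-distrib-+; sum-remove; sum-replicate-zero)
    renaming (sum to ∑)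
  open BigOp *-commutativeMonoid using () renaming (sum to ∏)
  open SemiringSum semiring using (*-distribˡ-sum; *-distribʳ-sum)
  open SetoidReasoning setoid

  Distinct : ∀ {n} → (Fin n → Carrier) → Set ℓ
  Distinct ρ = ∀ i j → ρ i ≈ ρ j → i ≡ j

  x-y≈0⇒x≈y : ∀ {x y} → x - y ≈ 0# → x ≈ y
  x-y≈0⇒x≈y {x} {y} eq = begin
    x            ≈⟨ solve 2 (λ x y → x := (x :- y) :+ y) refl x y ⟩
    (x - y) + y  ≈⟨ +-congʳ eq ⟩
    0# + y       ≈⟨ +-identityˡ y ⟩
    y            ∎

  x≈y⇒x-y≈0 : ∀ {x y} → x ≈ y → x - y ≈ 0#
  x≈y⇒x-y≈0 {x} {y} eq = trans (+-congʳ eq) (-‿inverseʳ y)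

  x*y≈0⇒y≈0 : ∀ {x y} → ¬ x ≈ 0# → x * y ≈ 0# → y ≈ 0#
  x*y≈0⇒y≈0 {x} {y} x≉0 eq with inverse x x≉0
  ... | v , xv≈1 = begin
    y            ≈⟨ *-identityˡ y ⟨
    1# * y       ≈⟨ *-congʳ xv≈1 ⟨
    (x * v) * y  ≈⟨ solve 3 (λ x v y → (x :* v) :* y := v :* (x :* y)) refl x v y ⟩
    v * (x * y)  ≈⟨ *-congˡ eq ⟩
    v * 0#       ≈⟨ zeroʳ v ⟩
    0#           ∎

  x*y≉0 : ∀ {x y} → ¬ x ≈ 0# → ¬ y ≈ 0# → ¬ x * y ≈ 0#
  x*y≉0 x≉0 y≉0 eq = y≉0 (x*y≈0⇒y≈0 x≉0 eq)

  *-cancelˡ : ∀ {x y z} → ¬ x ≈ 0# → x * y ≈ x * z → y ≈ z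
  *-cancelˡ {x} {y} {z} x≉0 eq = x-y≈0⇒x≈y (x*y≈0⇒y≈0 x≉0 (begin
    x * (y - z)    ≈⟨ solve 3 (λ x y z → x :* (y :- z) := x :* y :- x :* z) refl x y z ⟩
    x * y - x * z  ≈⟨ x≈y⇒x-y≈0 eq ⟩
    0#             ∎))

  x^n≉0 : ∀ {x} n → ¬ x ≈ 0# → ¬ x ^ n ≈ 0#
  x^n≉0 zero    x≉0 = 1≉0
  x^n≉0 (suc n) x≉0 = x*y≉0 x≉0 (x^n≉0 n x≉0)

  ∏≈0⇒∃≈0 : ∀ {n} (f : Fin n → Carrier) → ∏ f ≈ 0# → ∃ λ i → f i ≈ 0#
  ∏≈0⇒∃≈0 {zero}  f eq = contradiction eq 1≉0
  ∏≈0⇒∃≈0 {suc n} f eq with f zero ≟ 0#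
  ... | yes f₀≈0 = zero , f₀≈0
  ... | no  f₀≉0 with ∏≈0⇒∃≈0 (f ∘ suc) (x*y≈0⇒y≈0 f₀≉0 eq)
  ...   | i , fᵢ≈0 = suc i , fᵢ≈0

  ∏≉0 : ∀ {n} (f : Fin n → Carrier) → (∀ i → ¬ f i ≈ 0#) → ¬ ∏ f ≈ 0#
  ∏≉0 f f≉0 eq with ∏≈0⇒∃≈0 f eq
  ... | i , fᵢ≈0 = f≉0 i fᵢ≈0

  ∑≈0 : ∀ {n} (f : Fin n → Carrier) → (∀ i → f i ≈ 0#) → ∑ f ≈ 0#
  ∑≈0 {n} f f≈0 = trans (sum-cong-≋ f≈0) (sum-replicate-zero n)

  -- Covers subfields of the ambient field and localizations of ℤ alike, so that homomorphisms and
  -- polynomial evaluation are treated once.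
  record Subring s : Set (c ⊔ ℓ ⊔ lsuc s) where
    field
      Elem       : Pred Carrier s
      resp′      : ∀ {x y} → x ≈ y → x ∈ Elem → y ∈ Elem
      0-closed′  : 0# ∈ Elem
      1-closed′  : 1# ∈ Elem
      +-closed′  : ∀ {x y} → x ∈ Elem → y ∈ Elem → x + y ∈ Elem
      *-closed′  : ∀ {x y} → x ∈ Elem → y ∈ Elem → x * y ∈ Elem
      neg-closed′ : ∀ {x} → x ∈ Elem → - x ∈ Elem

    ⟦⟧ : Set (c ⊔ s)
    ⟦⟧ = Σ Carrier Elem

    ^-closed : ∀ {x} n → x ∈ Elem → x ^ n ∈ Elem
    ^-closed zero    x∈ = 1-closed′
    ^-closed (suc n) x∈ = *-closed′ x∈ (^-closed n x∈)

    ∑-closed : ∀ {n} (f : Fin n → Carrier) → (∀ i → f i ∈ Elem) → ∑ f ∈ Elem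
    ∑-closed {zero}  f f∈ = 0-closed′
    ∑-closed {suc n} f f∈ = +-closed′ (f∈ zero) (∑-closed (f ∘ suc) (f∈ ∘ suc))

    ∏-closed : ∀ {n} (f : Fin n → Carrier) → (∀ i → f i ∈ Elem) → ∏ f ∈ Elem
    ∏-closed {zero}  f f∈ = 1-closed′
    ∏-closed {suc n} f f∈ = *-closed′ (f∈ zero) (∏-closed (f ∘ suc) (f∈ ∘ suc))

  subring : ∀ {s} → Subfield s → Subring s
  subring E = record
    { Elem = Member E ; resp′ = resp E ; 0-closed′ = 0-closed E ; 1-closed′ = 1-closed E
    ; +-closed′ = +-closed E ; *-closed′ = *-closed E ; neg-closed′ = neg-closed E }

  -- Linear algebra

  -- Gaussian elimination, one column at a time. A vanishing first column lets row `zero` be dropped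
  -- with coefficient 0; otherwise multiples of a pivot row are subtracted from the others and the
  -- relation among those is lifted back. All operations stay inside E.
  dependent : ∀ {s} (E : Subfield s) n (A : Fin (suc n) → Fin n → Carrier) →
    (∀ i j → A i j ∈ Member E) →
    ∃ λ (x : Fin (suc n) → Carrier) → (∀ i → x i ∈ Member E) ×
      (∃ λ i → ¬ x i ≈ 0#) × (∀ j → ∑ (λ i → x i * A i j) ≈ 0#)
  dependent E zero    A A∈ = (λ _ → 1#) , (λ _ → 1-closed E) , (zero , 1≉0) , λ ()
  dependent E (suc n) A A∈ with Finₚ.any? (λ i → ¬? (A i zero ≟ 0#))
  ... | no allZero
    with dependent E n (λ i j → A (suc i) (suc j)) (λ i j → A∈ (suc i) (suc j))
  ...   | x , x∈ , (i , xᵢ≉0) , x·A = y , y∈ , (suc i , xᵢ≉0) , y·A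
    where
    y : Fin (suc (suc n)) → Carrier
    y zero    = 0#
    y (suc i) = x i
    y∈ : ∀ i → y i ∈ Member E
    y∈ zero    = 0-closed E
    y∈ (suc i) = x∈ i
    A₀≈0 : ∀ i → A i zero ≈ 0#
    A₀≈0 i = decidable-stable (A i zero ≟ 0#) (λ ≉0 → allZero (i , ≉0))
    y·A : ∀ j → ∑ (λ i → y i * A i j) ≈ 0#
    y·A zero    = ∑≈0 (λ i → y i * A i zero) (λ i → trans (*-congˡ (A₀≈0 i)) (zeroʳ _))
    y·A (suc j) = trans (+-cong (zeroˡ _) (x·A j)) (+-identityˡ 0#)
  dependent E (suc n) A A∈ | yes (p , Aₚ≉0)
    with v , Av≈1 ← inverse (A p zero) Aₚ≉0
    with dependent E n
      (λ k j → A (punchIn p k) (suc j) - (A (punchIn p k) zero * v) * A p (suc j))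
      (λ k j → +-closed E (A∈ _ _) (neg-closed E
        (*-closed E (*-closed E (A∈ _ _) (inv-closed E (A∈ p zero) Av≈1)) (A∈ _ _))))
  ... | x , x∈ , (i , xᵢ≉0) , x·B = y , y∈ , (punchIn p i , yᵢ≉0) , y·A
    where
    v∈ : v ∈ Member E
    v∈ = inv-closed E (A∈ p zero) Av≈1
    -- Row k was reduced by a multiple of the pivot row. The sum of the `z k` is the coefficient of
    -- the pivot row which accounts for these subtractions.
    z : Fin (suc n) → Carrier
    z k = - (x k * (A (punchIn p k) zero * v))
    y : Fin (suc (suc n)) → Carrier
    y = insertAt x p (∑ z)
    y-p : y p ≡ ∑ z
    y-p = Vecₚ.insertAt-lookup x p _
    y-punchIn : ∀ k → y (punchIn p k) ≡ x k
    y-punchIn = Vecₚ.insertAt-punchIn x p _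
    ∑z∈ : ∑ z ∈ Member E
    ∑z∈ = Subring.∑-closed (subring E) z
      (λ k → neg-closed E (*-closed E (x∈ k) (*-closed E (A∈ _ _) v∈)))
    y∈ : ∀ i → y i ∈ Member E
    y∈ i with p Finₚ.≟ i
    ... | yes ≡.refl = ≡.subst (_∈ Member E) (≡.sym y-p) ∑z∈
    ... | no  p≢i = ≡.subst (λ k → y k ∈ Member E) (Finₚ.punchIn-punchOut p≢i)
                      (≡.subst (_∈ Member E) (≡.sym (y-punchIn _)) (x∈ _))
    yᵢ≉0 : ¬ y (punchIn p i) ≈ 0#
    yᵢ≉0 eq = xᵢ≉0 (trans (reflexive (≡.sym (y-punchIn i))) eq)
    eliminate : ∀ j → ∑ (λ i → y i * A i j) ≈ ∑ (λ k → z k * A p j + x k * A (punchIn p k) j)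
    eliminate j = begin
      ∑ (λ i → y i * A i j)
        ≈⟨ sum-remove {i = p} (λ i → y i * A i j) ⟩
      y p * A p j + ∑ (λ k → y (punchIn p k) * A (punchIn p k) j)
        ≈⟨ +-cong (*-congʳ (reflexive y-p))
             (sum-cong-≋ (λ k → *-congʳ {A (punchIn p k) j} (reflexive (y-punchIn k)))) ⟩
      ∑ z * A p j + ∑ (λ k → x k * A (punchIn p k) j)
        ≈⟨ +-congʳ (*-distribʳ-sum (A p j) z) ⟩
      ∑ (λ k → z k * A p j) + ∑ (λ k → x k * A (punchIn p k) j)
        ≈⟨ ∑-distrib-+ (λ k → z k * A p j) (λ k → x k * A (punchIn p k) j) ⟨
      ∑ (λ k → z k * A p j + x k * A (punchIn p k) j) ∎
    y·A : ∀ j → ∑ (λ i → y i * A i j) ≈ 0#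
    y·A zero = trans (eliminate zero) (∑≈0 _ (λ k → begin
      z k * A p zero + x k * A (punchIn p k) zero
        ≈⟨ solve 4 (λ x a v b → (:- (x :* (a :* v))) :* b :+ x :* a
                      := x :* a :* (con (+ 1) :- b :* v)) refl
                   (x k) (A (punchIn p k) zero) v (A p zero) ⟩
      x k * A (punchIn p k) zero * (1# - A p zero * v)
        ≈⟨ *-congˡ (x≈y⇒x-y≈0 (sym Av≈1)) ⟩
      x k * A (punchIn p k) zero * 0#
        ≈⟨ zeroʳ _ ⟩
      0# ∎))
    y·A (suc j) = begin
      ∑ (λ i → y i * A i (suc j))
        ≈⟨ eliminate (suc j) ⟩
      ∑ (λ k → z k * A p (suc j) + x k * A (punchIn p k) (suc j))
        ≈⟨ sum-cong-≋ (λ k → solve 5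
             (λ x a v b d → (:- (x :* (a :* v))) :* b :+ x :* d := x :* (d :- (a :* v) :* b))
             refl (x k) (A (punchIn p k) zero) v (A p (suc j)) (A (punchIn p k) (suc j))) ⟩
      ∑ (λ k → x k * (A (punchIn p k) (suc j) - (A (punchIn p k) zero * v) * A p (suc j)))
        ≈⟨ x·B j ⟩
      0# ∎

  -- Polynomials

  -- Horner's scheme, starting from the constant term. A tuple of length n stands for a polynomial
  -- of degree less than n.
  ev : ∀ {n} → (Fin n → Carrier) → Carrier → Carrier
  ev {zero}  a x = 0#
  ev {suc n} a x = a zero + x * ev (a ∘ suc) x

  ev-cong : ∀ {n} {a b : Fin n → Carrier} {x y} → (∀ i → a i ≈ b i) → x ≈ y → ev a x ≈ ev b y
  ev-cong {zero}  a≈b x≈y = refl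
  ev-cong {suc n} a≈b x≈y = +-cong (a≈b zero) (*-cong x≈y (ev-cong (a≈b ∘ suc) x≈y))

  ev-+ : ∀ {n} (a b : Fin n → Carrier) x → ev (λ i → a i + b i) x ≈ ev a x + ev b x
  ev-+ {zero}  a b x = sym (+-identityˡ 0#)
  ev-+ {suc n} a b x = begin
    (a zero + b zero) + x * ev (λ i → a (suc i) + b (suc i)) x
      ≈⟨ +-congˡ (*-congˡ (ev-+ (a ∘ suc) (b ∘ suc) x)) ⟩
    (a zero + b zero) + x * (ev (a ∘ suc) x + ev (b ∘ suc) x)
      ≈⟨ solve 5 (λ a b x u v → (a :+ b) :+ x :* (u :+ v) := (a :+ x :* u) :+ (b :+ x :* v))
           refl (a zero) (b zero) x (ev (a ∘ suc) x) (ev (b ∘ suc) x) ⟩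
    ev a x + ev b x ∎

  ev-*ˡ : ∀ {n} k (a : Fin n → Carrier) x → ev (λ i → k * a i) x ≈ k * ev a x
  ev-*ˡ {zero}  k a x = sym (zeroʳ k)
  ev-*ˡ {suc n} k a x = begin
    k * a zero + x * ev (λ i → k * a (suc i)) x
      ≈⟨ +-congˡ (*-congˡ (ev-*ˡ k (a ∘ suc) x)) ⟩
    k * a zero + x * (k * ev (a ∘ suc) x)
      ≈⟨ solve 4 (λ k a x u → k :* a :+ x :* (k :* u) := k :* (a :+ x :* u))
           refl k (a zero) x (ev (a ∘ suc) x) ⟩
    k * ev a x ∎

  ev≈∑ : ∀ {n} (a : Fin n → Carrier) x → ev a x ≈ ∑ (λ i → a i * x ^ toℕ i)
  ev≈∑ {zero}  a x = refl
  ev≈∑ {suc n} a x = +-cong (sym (*-identityʳ _)) (begin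
    x * ev (a ∘ suc) x                        ≈⟨ *-congˡ (ev≈∑ (a ∘ suc) x) ⟩
    x * ∑ (λ i → a (suc i) * x ^ toℕ i)       ≈⟨ *-distribˡ-sum x (λ i → a (suc i) * x ^ toℕ i) ⟩
    ∑ (λ i → x * (a (suc i) * x ^ toℕ i))
      ≈⟨ sum-cong-≋ (λ i → solve 3 (λ x a u → x :* (a :* u) := a :* (x :* u))
                             refl x (a (suc i)) (x ^ toℕ i)) ⟩
    ∑ (λ i → a (suc i) * x ^ suc (toℕ i))     ∎)

  ev-init-last : ∀ {n} (a : Fin (suc n) → Carrier) x →
                 ev a x ≈ ev (a ∘ inject₁) x + a (fromℕ n) * x ^ n
  ev-init-last {zero}  a x =
    solve 2 (λ a x → a :+ x :* con (+ 0) := con (+ 0) :+ a :* con (+ 1)) refl (a zero) x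
  ev-init-last {suc n} a x = begin
    a zero + x * ev (a ∘ suc) x
      ≈⟨ +-congˡ (*-congˡ (ev-init-last (a ∘ suc) x)) ⟩
    a zero + x * (ev (a ∘ suc ∘ inject₁) x + a (fromℕ (suc n)) * x ^ n)
      ≈⟨ solve 5 (λ a x u v w → a :+ x :* (u :+ v :* w) := (a :+ x :* u) :+ v :* (x :* w))
           refl (a zero) x (ev (a ∘ suc ∘ inject₁) x) (a (fromℕ (suc n))) (x ^ n) ⟩
    ev (a ∘ inject₁) x + a (fromℕ (suc n)) * x ^ suc n ∎

  ev≈0 : ∀ {n} (a : Fin n → Carrier) x → (∀ i → a i ≈ 0#) → ev a x ≈ 0#
  ev≈0 {zero}  a x a≈0 = refl
  ev≈0 {suc n} a x a≈0 =
    trans (+-cong (a≈0 zero) (trans (*-congˡ (ev≈0 (a ∘ suc) x (a≈0 ∘ suc))) (zeroʳ x)))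
          (+-identityʳ 0#)

  monic : ∀ {n} → (Fin n → Carrier) → Fin (suc n) → Carrier
  monic {zero}  a _       = 1#
  monic {suc n} a zero    = a zero
  monic {suc n} a (suc i) = monic (a ∘ suc) i

  monic-last : ∀ {n} (a : Fin n → Carrier) → monic a (fromℕ n) ≈ 1#
  monic-last {zero}  a = refl
  monic-last {suc n} a = monic-last (a ∘ suc)

  ev-monic : ∀ {n} (a : Fin n → Carrier) x → ev (monic a) x ≈ x ^ n + ev a x
  ev-monic {zero}  a x = solve 1 (λ x → con (+ 1) :+ x :* con (+ 0) := con (+ 1) :+ con (+ 0)) refl x
  ev-monic {suc n} a x = trans (+-congˡ (*-congˡ (ev-monic (a ∘ suc) x)))
    (solve 4 (λ a x p e → a :+ x :* (p :+ e) := x :* p :+ (a :+ x :* e))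
      refl (a zero) x (x ^ n) (ev (a ∘ suc) x))

  -- Synthetic division by X - k; the remainder is the value at k.
  quot : ∀ {n} → Carrier → (Fin (suc n) → Carrier) → Fin n → Carrier
  quot {suc n} k a zero    = ev (a ∘ suc) k
  quot {suc n} k a (suc i) = quot k (a ∘ suc) i

  ev-quot : ∀ {n} k (a : Fin (suc n) → Carrier) x →
            ev a x ≈ ev a k + (x - k) * ev (quot k a) x
  ev-quot {zero}  k a x =
    solve 3 (λ a k x → a :+ x :* con (+ 0) := (a :+ k :* con (+ 0)) :+ (x :- k) :* con (+ 0))
      refl (a zero) k x
  ev-quot {suc n} k a x = begin
    a zero + x * ev (a ∘ suc) x
      ≈⟨ +-congˡ (*-congˡ (ev-quot k (a ∘ suc) x)) ⟩
    a zero + x * (ev (a ∘ suc) k + (x - k) * ev (quot k (a ∘ suc)) x)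
      ≈⟨ solve 5 (λ a k x u v → a :+ x :* (u :+ (x :- k) :* v)
                    := (a :+ k :* u) :+ (x :- k) :* (u :+ x :* v))
           refl (a zero) k x (ev (a ∘ suc) k) (ev (quot k (a ∘ suc)) x) ⟩
    ev a k + (x - k) * ev (quot k a) x ∎

  quot-last : ∀ {n} k (a : Fin (suc (suc n)) → Carrier) →
              quot k a (fromℕ n) ≈ a (fromℕ (suc n))
  quot-last {zero}  k a = trans (+-congˡ (zeroʳ k)) (+-identityʳ _)
  quot-last {suc n} k a = quot-last k (a ∘ suc)

  -- Divide by X - ρ₀: at each other root the factor ρᵢ - ρ₀ is nonzero, so the quotient vanishes
  -- there, and its leading coefficient is the old one.
  factorisation : ∀ {n} (a : Fin (suc n) → Carrier) (ρ : Fin n → Carrier) → Distinct ρ →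
    (∀ i → ev a (ρ i) ≈ 0#) → ∀ x → ev a x ≈ a (fromℕ n) * ∏ (λ i → x - ρ i)
  factorisation {zero}  a ρ dist roots x =
    solve 2 (λ a x → a :+ x :* con (+ 0) := a :* con (+ 1)) refl (a zero) x
  factorisation {suc n} a ρ dist roots x = begin
    ev a x                                       ≈⟨ peel x ⟩
    (x - ρ zero) * ev b x                        ≈⟨ *-congˡ (factorisation b (ρ ∘ suc) dist′ roots′ x) ⟩
    (x - ρ zero) * (b (fromℕ n) * ∏ (λ i → x - ρ (suc i)))
      ≈⟨ *-congˡ (*-congʳ (quot-last (ρ zero) a)) ⟩
    (x - ρ zero) * (a (fromℕ (suc n)) * ∏ (λ i → x - ρ (suc i)))
      ≈⟨ solve 3 (λ u v w → u :* (v :* w) := v :* (u :* w)) refl _ _ _ ⟩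
    a (fromℕ (suc n)) * ∏ (λ i → x - ρ i) ∎
    where
    b = quot (ρ zero) a
    peel : ∀ x → ev a x ≈ (x - ρ zero) * ev b x
    peel x = trans (ev-quot (ρ zero) a x) (trans (+-congʳ (roots zero)) (+-identityˡ _))
    dist′ : Distinct (ρ ∘ suc)
    dist′ i j eq = Finₚ.suc-injective (dist (suc i) (suc j) eq)
    roots′ : ∀ i → ev b (ρ (suc i)) ≈ 0#
    roots′ i = x*y≈0⇒y≈0 (λ eq → contradiction (dist (suc i) zero (x-y≈0⇒x≈y eq)) λ ())
                 (trans (sym (peel (ρ (suc i)))) (roots (suc i)))

  -- All roots but the first factor the polynomial up to its leading coefficient. The value at the
  -- first root forces that coefficient to vanish, and the length drops by one.
  roots⇒≈0 : ∀ {n} (a : Fin n → Carrier) (ρ : Fin n → Carrier) → Distinct ρ →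
    (∀ i → ev a (ρ i) ≈ 0#) → ∀ i → a i ≈ 0#
  roots⇒≈0 {suc n} a ρ dist roots = all≈0
    where
    dist′ : Distinct (ρ ∘ suc)
    dist′ i j eq = Finₚ.suc-injective (dist (suc i) (suc j) eq)
    last≈0 : a (fromℕ n) ≈ 0#
    last≈0 = x*y≈0⇒y≈0
      (∏≉0 (λ i → ρ zero - ρ (suc i)) (λ i eq → contradiction (dist zero (suc i) (x-y≈0⇒x≈y eq)) λ ()))
      (trans (*-comm _ _) (trans (sym (factorisation a (ρ ∘ suc) dist′ (roots ∘ suc) (ρ zero))) (roots zero)))
    init-ev : ∀ x → ev (a ∘ inject₁) x ≈ ev a x
    init-ev x = sym (trans (ev-init-last a x)
      (trans (+-congˡ (trans (*-congʳ last≈0) (zeroˡ _))) (+-identityʳ _)))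
    all≈0 : ∀ i → a i ≈ 0#
    all≈0 i with view i
    ... | ‵fromℕ = last≈0
    ... | ‵inject₁ j = roots⇒≈0 (a ∘ inject₁) (ρ ∘ suc) dist′
                         (λ k → trans (init-ev _) (roots (suc k))) j

  module _ {s} (A : Subring s) where
    open Subring A

    ev-closed : ∀ {n} (a : Fin n → Carrier) {x} → (∀ i → a i ∈ Elem) → x ∈ Elem → ev a x ∈ Elem
    ev-closed {zero}  a a∈ x∈ = 0-closed′
    ev-closed {suc n} a a∈ x∈ =
      +-closed′ (a∈ zero) (*-closed′ x∈ (ev-closed (a ∘ suc) (a∈ ∘ suc) x∈))

    quot-closed : ∀ {n} {k} (a : Fin (suc n) → Carrier) → k ∈ Elem → (∀ i → a i ∈ Elem) →
                  ∀ i → quot k a i ∈ Elem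
    quot-closed {suc n} a k∈ a∈ zero    = ev-closed (a ∘ suc) (a∈ ∘ suc) k∈
    quot-closed {suc n} a k∈ a∈ (suc i) = quot-closed (a ∘ suc) k∈ (a∈ ∘ suc) i

    monic-closed : ∀ {n} (a : Fin n → Carrier) → (∀ i → a i ∈ Elem) → ∀ i → monic a i ∈ Elem
    monic-closed {zero}  a a∈ _       = 1-closed′
    monic-closed {suc n} a a∈ zero    = a∈ zero
    monic-closed {suc n} a a∈ (suc i) = monic-closed (a ∘ suc) (a∈ ∘ suc) i

-- Homomorphisms into the ambient field, ideals, and extension to A[θ]

module Homs {c ℓ} (R : CommutativeRing c ℓ) (isField : IsField R) where
  open CommutativeRing R hiding (zero)
  open IsField isField
  open Subfields R
  open IntegerImage R
  open FieldTools R isField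
  open Exp semiring using (_^_)
  open BigOp +-commutativeMonoid using () renaming (sum to ∑)
  open BigOp *-commutativeMonoid using () renaming (sum to ∏)
  open SetoidReasoning setoid

  record Hom {s} (A : Subring s) : Set (c ⊔ ℓ ⊔ s) where
    open Subring A
    field
      map    : ⟦⟧ → Carrier
      cong   : ∀ {x y} → proj₁ x ≈ proj₁ y → map x ≈ map y
      +-homo : ∀ x y → map (proj₁ x + proj₁ y , +-closed′ (proj₂ x) (proj₂ y)) ≈ map x + map y
      *-homo : ∀ x y → map (proj₁ x * proj₁ y , *-closed′ (proj₂ x) (proj₂ y)) ≈ map x * map y
      1-homo : map (1# , 1-closed′) ≈ 1#

    -- Stated through an equation of values, so that the membership proof carried by the argument is
    -- arbitrary; the variants below follow the same pattern.
    map-+ : ∀ {x y z} → proj₁ z ≈ proj₁ x + proj₁ y → map z ≈ map x + map y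
    map-+ {x} {y} eq = trans (cong eq) (+-homo x y)

    map-* : ∀ {x y z} → proj₁ z ≈ proj₁ x * proj₁ y → map z ≈ map x * map y
    map-* {x} {y} eq = trans (cong eq) (*-homo x y)

    map-1 : ∀ {x} → proj₁ x ≈ 1# → map x ≈ 1#
    map-1 eq = trans (cong eq) 1-homo

    map-0 : ∀ {x} → proj₁ x ≈ 0# → map x ≈ 0#
    map-0 {x} eq = begin
      map x                   ≈⟨ solve 1 (λ u → u := (u :+ u) :- u) refl (map x) ⟩
      (map x + map x) - map x ≈⟨ +-congʳ (map-+ {x} {x} {x} (begin
        proj₁ x               ≈⟨ eq ⟩
        0#                    ≈⟨ +-identityˡ 0# ⟨
        0# + 0#               ≈⟨ +-cong eq eq ⟨
        proj₁ x + proj₁ x     ∎)) ⟨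
      map x - map x           ≈⟨ -‿inverseʳ _ ⟩
      0#                      ∎

    map-neg : ∀ {x y} → proj₁ y ≈ - proj₁ x → map y ≈ - map x
    map-neg {x} {y} eq = begin
      map y                    ≈⟨ solve 2 (λ u v → v := (u :+ v) :- u) refl (map x) (map y) ⟩
      (map x + map y) - map x  ≈⟨ +-congʳ (+-homo x y) ⟨
      map (proj₁ x + proj₁ y , _) - map x
                               ≈⟨ +-congʳ (map-0 (trans (+-congˡ eq) (-‿inverseʳ _))) ⟩
      0# - map x               ≈⟨ +-identityˡ _ ⟩
      - map x                  ∎

    map-- : ∀ {x y z} → proj₁ z ≈ proj₁ x - proj₁ y → map z ≈ map x - map y
    map-- {x} {y} eq = trans (map-+ {x} {_ , neg-closed′ (proj₂ y)} eq) (+-congˡ (map-neg refl))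

    map-ev : ∀ {n} (a : Fin n → ⟦⟧) {x y} → proj₁ y ≈ ev (proj₁ ∘ a) (proj₁ x) →
             map y ≈ ev (map ∘ a) (map x)
    map-ev {zero}  a eq = map-0 eq
    map-ev {suc n} a {x} eq =
      trans (map-+ {a zero} {_ , *-closed′ (proj₂ x) (proj₂ rest)} eq)
            (+-congˡ (trans (map-* {x} {rest} refl) (*-congˡ (map-ev (a ∘ suc) {x} {rest} refl))))
      where
      rest : ⟦⟧
      rest = ev (proj₁ ∘ a ∘ suc) (proj₁ x) , ev-closed A (proj₁ ∘ a ∘ suc) (proj₂ ∘ a ∘ suc) (proj₂ x)

    map-^ : ∀ n {x y} → proj₁ y ≈ proj₁ x ^ n → map y ≈ map x ^ n
    map-^ zero        eq = map-1 eq
    map-^ (suc n) {x} eq =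
      trans (map-* {x} {_ , ^-closed n (proj₂ x)} eq) (*-congˡ (map-^ n {x} refl))

    map-∑ : ∀ {n} (f : Fin n → ⟦⟧) {y} → proj₁ y ≈ ∑ (proj₁ ∘ f) → map y ≈ ∑ (map ∘ f)
    map-∑ {zero}  f eq = map-0 eq
    map-∑ {suc n} f eq =
      trans (map-+ {f zero} {_ , ∑-closed (proj₁ ∘ f ∘ suc) (proj₂ ∘ f ∘ suc)} eq)
            (+-congˡ (map-∑ (f ∘ suc) refl))

    map-∏ : ∀ {n} (f : Fin n → ⟦⟧) {y} → proj₁ y ≈ ∏ (proj₁ ∘ f) → map y ≈ ∏ (map ∘ f)
    map-∏ {zero}  f eq = map-1 eq
    map-∏ {suc n} f eq =
      trans (map-* {f zero} {_ , ∏-closed (proj₁ ∘ f ∘ suc) (proj₂ ∘ f ∘ suc)} eq)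
            (*-congˡ (map-∏ (f ∘ suc) refl))

  module _ {s} (E : Subfield s) (g : Hom (subring E)) where
    open Hom g

    map-≉0 : ∀ {x} → ¬ proj₁ x ≈ 0# → ¬ map x ≈ 0#
    map-≉0 {x , x∈} x≉0 gx≈0 with inverse x x≉0
    ... | y , xy≈1 = 1≉0 (begin
      1#                                ≈⟨ map-1 {_ , *-closed E x∈ y∈} xy≈1 ⟨
      map (x * y , *-closed E x∈ y∈)    ≈⟨ *-homo (x , x∈) (y , y∈) ⟩
      map (x , x∈) * map (y , y∈)       ≈⟨ *-congʳ gx≈0 ⟩
      0# * map (y , y∈)                 ≈⟨ zeroˡ _ ⟩
      0#                                ∎)
      where y∈ = inv-closed E x∈ xy≈1

    map-injective : ∀ {x y} → map x ≈ map y → proj₁ x ≈ proj₁ y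
    map-injective {x} {y} eq with (proj₁ x - proj₁ y) ≟ 0#
    ... | yes x-y≈0 = x-y≈0⇒x≈y x-y≈0
    ... | no x-y≉0 = contradiction
      (trans (map-- {x} {y} {_ , +-closed E (proj₂ x) (neg-closed E (proj₂ y))} refl) (x≈y⇒x-y≈0 eq))
      (map-≉0 x-y≉0)

  record Ideal {s} (B : Subring s) i : Set (c ⊔ ℓ ⊔ s ⊔ lsuc i) where
    open Subring B
    field
      In      : Pred Carrier i
      In-resp : ∀ {x y} → x ≈ y → x ∈ In → y ∈ In
      In-0    : 0# ∈ In
      In-+    : ∀ {x y} → x ∈ In → y ∈ In → x + y ∈ In
      In-neg  : ∀ {x} → x ∈ In → - x ∈ In
      In-*    : ∀ {b x} → b ∈ Elem → x ∈ In → b * x ∈ In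

    infix 4 _∼_
    _∼_ : Carrier → Carrier → Set i
    x ∼ y = x - y ∈ In

    ≈⇒∼ : ∀ {x y} → x ≈ y → x ∼ y
    ≈⇒∼ eq = In-resp (sym (x≈y⇒x-y≈0 eq)) In-0

    ∼-trans : ∀ {x y z} → x ∼ y → y ∼ z → x ∼ z
    ∼-trans {x} {y} {z} p q =
      In-resp (solve 3 (λ x y z → (x :- y) :+ (y :- z) := x :- z) refl x y z) (In-+ p q)

    ∼-+ : ∀ {x y u v} → x ∼ y → u ∼ v → x + u ∼ y + v
    ∼-+ {x} {y} {u} {v} p q = In-resp
      (solve 4 (λ x y u v → (x :- y) :+ (u :- v) := (x :+ u) :- (y :+ v)) refl x y u v) (In-+ p q)

    ∼-*ˡ : ∀ {b x y} → b ∈ Elem → x ∼ y → b * x ∼ b * y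
    ∼-*ˡ {b} {x} {y} b∈ p = In-resp
      (solve 3 (λ b x y → b :* (x :- y) := b :* x :- b :* y) refl b x y) (In-* b∈ p)

    ∼-*ʳ : ∀ {b x y} → b ∈ Elem → x ∼ y → x * b ∼ y * b
    ∼-*ʳ {b} {x} {y} b∈ p = In-resp
      (solve 3 (λ b x y → b :* (x :- y) := x :* b :- y :* b) refl b x y) (In-* b∈ p)

  -- When θ is a root of the monic polynomial Xⁿ - c and t one of its image
  -- modulo the ideal I, the graph of the homomorphism A[θ] → B/I which extends φ
  -- and sends θ to t.
  module Extension {a b i} {A : Subring a} {B : Subring b} (I : Ideal B i)
    (φ : Hom A) (φ∈B : ∀ x → Hom.map φ x ∈ Subring.Elem B)
    (m : ℕ) (coeff : Fin (suc m) → Subring.⟦⟧ A) (θ t : Carrier)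
    (θ-root : θ ^ suc m ≈ ev (proj₁ ∘ coeff) θ)
    (t∈B : t ∈ Subring.Elem B)
    (t-root : Ideal._∼_ I (t ^ suc m) (ev (Hom.map φ ∘ coeff) t))
    where
    open Subring A
    open Subring B using () renaming (Elem to ElemB; *-closed′ to *-closedB; +-closed′ to +-closedB)
    open Hom φ
    open Ideal I

    infix 4 _▷_
    -- A relation, because y may have several polynomial expressions and z is meant only modulo I.
    -- The fixed length m + 1 is what lets independence of 1, θ, ..., θᵐ make it single valued
    -- modulo I.
    _▷_ : Carrier → Carrier → Set (c ⊔ ℓ ⊔ a ⊔ b ⊔ i)
    y ▷ z = Σ (Fin (suc m) → ⟦⟧) λ r →
      y ≈ ev (proj₁ ∘ r) θ × z ∼ ev (map ∘ r) t × z ∈ ElemB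

    ▷-resp : ∀ {y y′ z z′} → y ≈ y′ → z ≈ z′ → y ▷ z → y′ ▷ z′
    ▷-resp y≈ z≈ (r , p , q , z∈) =
      r , trans (sym y≈) p , ∼-trans (≈⇒∼ (sym z≈)) q , Subring.resp′ B z≈ z∈

    private
      0A : ⟦⟧
      0A = 0# , 0-closed′

      const : ⟦⟧ → Fin (suc m) → ⟦⟧
      const x zero    = x
      const x (suc i) = 0A

      plus : ⟦⟧ → ⟦⟧ → ⟦⟧
      plus x y = proj₁ x + proj₁ y , +-closed′ (proj₂ x) (proj₂ y)

      times : ⟦⟧ → ⟦⟧ → ⟦⟧
      times x y = proj₁ x * proj₁ y , *-closed′ (proj₂ x) (proj₂ y)

      shift : (Fin (suc m) → ⟦⟧) → Fin (suc m) → ⟦⟧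
      shift r zero    = 0A
      shift r (suc i) = r (inject₁ i)

      ev-shift : ∀ (r : Fin (suc m) → Carrier) x →
        x * ev r x ≈ (0# + x * ev (r ∘ inject₁) x) + r (fromℕ m) * x ^ suc m
      ev-shift r x = trans (*-congˡ (ev-init-last r x))
        (solve 4 (λ x u v w → x :* (u :+ v :* w) := (con (+ 0) :+ x :* u) :+ v :* (x :* w))
          refl x (ev (r ∘ inject₁) x) (r (fromℕ m)) (x ^ m))

    const-▷ : ∀ x → proj₁ x ▷ map x
    const-▷ x = const x , eval {proj₁ x} (λ _ → refl) , ≈⇒∼ (eval (λ _ → map-0 refl)) , φ∈B x
      where
      eval : ∀ {u v} {f : Fin m → Carrier} → (∀ i → f i ≈ 0#) → u ≈ u + v * ev f v
      eval {u} {v} {f} f≈0 =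
        sym (trans (+-congˡ (trans (*-congˡ (ev≈0 f v f≈0)) (zeroʳ v))) (+-identityʳ u))

    +-▷ : ∀ {y z y′ z′} → y ▷ z → y′ ▷ z′ → y + y′ ▷ z + z′
    +-▷ {y} {z} {y′} {z′} (r , p , q , z∈) (r′ , p′ , q′ , z′∈) =
      (λ i → plus (r i) (r′ i)) ,
      trans (+-cong p p′) (sym (ev-+ (proj₁ ∘ r) (proj₁ ∘ r′) θ)) ,
      ∼-trans (∼-+ q q′) (≈⇒∼ (trans (sym (ev-+ (map ∘ r) (map ∘ r′) t))
        (ev-cong (λ i → sym (+-homo (r i) (r′ i))) refl))) ,
      +-closedB z∈ z′∈

    scale-▷ : ∀ x {y z} → y ▷ z → proj₁ x * y ▷ map x * z
    scale-▷ x (r , p , q , z∈) =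
      (λ i → times x (r i)) ,
      trans (*-congˡ p) (sym (ev-*ˡ (proj₁ x) (proj₁ ∘ r) θ)) ,
      ∼-trans (∼-*ˡ (φ∈B x) q) (≈⇒∼ (trans (sym (ev-*ˡ (map x) (map ∘ r) t))
        (ev-cong (λ i → sym (*-homo x (r i))) refl))) ,
      *-closedB (φ∈B x) z∈

    -- Multiplication by θ pushes the top coefficient into degree m + 1. `θ-root` brings it back to
    -- degree at most m, and `t-root` makes the same reduction valid for t modulo I.
    θ*-▷ : ∀ {y z} → y ▷ z → θ * y ▷ t * z
    θ*-▷ {y} {z} (r , p , q , z∈) = ▷-resp′ (+-▷ shifted reduced)
      where
      top = r (fromℕ m)
      u = 0# + θ * ev (proj₁ ∘ r ∘ inject₁) θ
      v = 0# + t * ev (map ∘ r ∘ inject₁) t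
      ev∈B : ∀ {n} (f : Fin n → ⟦⟧) → ev (map ∘ f) t ∈ ElemB
      ev∈B f = ev-closed B (map ∘ f) (φ∈B ∘ f) t∈B
      shifted : u ▷ v
      shifted = shift r , refl , ≈⇒∼ (+-congʳ (sym (map-0 refl))) ,
        +-closedB (Subring.0-closed′ B) (*-closedB t∈B (ev∈B (r ∘ inject₁)))
      reduced : proj₁ top * ev (proj₁ ∘ coeff) θ ▷ map top * ev (map ∘ coeff) t
      reduced = scale-▷ top (coeff , refl , ≈⇒∼ refl , ev∈B coeff)
      t*z∼ : t * z ∼ v + map top * ev (map ∘ coeff) t
      t*z∼ = ∼-trans (∼-*ˡ t∈B q) (∼-trans (≈⇒∼ (ev-shift (map ∘ r) t))
               (∼-+ (≈⇒∼ refl) (∼-*ˡ (φ∈B top) t-root)))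
      ▷-resp′ : u + proj₁ top * ev (proj₁ ∘ coeff) θ ▷ v + map top * ev (map ∘ coeff) t →
                θ * y ▷ t * z
      ▷-resp′ (r′ , p′ , q′ , _) =
        r′ ,
        trans (trans (*-congˡ p) (trans (ev-shift (proj₁ ∘ r) θ) (+-congˡ (*-congˡ θ-root)))) p′ ,
        ∼-trans t*z∼ q′ ,
        *-closedB t∈B z∈

    -- Horner's scheme on r reduces the product to scalings by A and multiplications by θ.
    *-▷ : ∀ {y z y′ z′} → y ▷ z → y′ ▷ z′ → y * y′ ▷ z * z′
    *-▷ {y} {z} {y′} {z′} (r , p , q , z∈) d′@(_ , _ , _ , z′∈) =
      conclude (go r)
      where
      go : ∀ {n} (f : Fin n → ⟦⟧) → ev (proj₁ ∘ f) θ * y′ ▷ ev (map ∘ f) t * z′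
      go {zero}  f = ▷-resp (sym (zeroˡ y′)) (trans (map-0 refl) (sym (zeroˡ z′))) (const-▷ 0A)
      go {suc n} f = ▷-resp (assoc′ _ _ _ _) (assoc′ _ _ _ _)
        (+-▷ (scale-▷ (f zero) d′) (θ*-▷ (go (f ∘ suc))))
        where
        assoc′ : ∀ a y x e → a * y + x * (e * y) ≈ (a + x * e) * y
        assoc′ = solve 4 (λ a y x e → a :* y :+ x :* (e :* y) := (a :+ x :* e) :* y) refl
      conclude : ev (proj₁ ∘ r) θ * y′ ▷ ev (map ∘ r) t * z′ → y * y′ ▷ z * z′
      conclude (s , p″ , q″ , _) =
        s , trans (*-congʳ p) p″ , ∼-trans (∼-*ʳ z′∈ q) q″ , *-closedB z∈ z′∈

    1-▷ : 1# ▷ 1#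
    1-▷ = ▷-resp refl 1-homo (const-▷ (1# , 1-closed′))

    θ-▷ : θ ▷ t
    θ-▷ = ▷-resp (*-identityʳ θ) (*-identityʳ t) (θ*-▷ 1-▷)

    neg-▷ : ∀ {y z} → y ▷ z → - y ▷ - z
    neg-▷ {y} {z} d = ▷-resp (-1* y)
      (trans (*-congʳ (trans (map-neg {1# , 1-closed′} refl) (-‿cong 1-homo))) (-1* z))
      (scale-▷ (- 1# , neg-closed′ 1-closed′) d)
      where
      -1* : ∀ x → - 1# * x ≈ - x
      -1* = solve 1 (λ x → :- con (+ 1) :* x := :- x) refl

    ev-▷ : ∀ {n} (f : Fin n → ⟦⟧) → ev (proj₁ ∘ f) θ ▷ ev (map ∘ f) t
    ev-▷ {zero}  f = ▷-resp refl (map-0 refl) (const-▷ 0A)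
    ev-▷ {suc n} f = +-▷ (const-▷ (f zero)) (θ*-▷ (ev-▷ (f ∘ suc)))

    ^-▷ : ∀ {y z} n → y ▷ z → y ^ n ▷ z ^ n
    ^-▷ zero    d = 1-▷
    ^-▷ (suc n) d = *-▷ d (^-▷ n d)

    module Independent
      (independent : (r : Fin (suc m) → ⟦⟧) → ev (proj₁ ∘ r) θ ≈ 0# → ∀ i → proj₁ (r i) ≈ 0#)
      where

      -- By independence every coefficient of the expression is 0. Hence its value at t is 0, and z
      -- differs from that value by an element of I.
      ▷-0 : ∀ {y z} → y ▷ z → y ≈ 0# → z ∈ In
      ▷-0 {y} {z} (r , p , q , _) y≈0 =
        In-resp (trans (+-congˡ (-‿cong (ev≈0 (map ∘ r) t (λ i → map-0 (independent r (trans (sym p) y≈0) i)))))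
                       (solve 1 (λ z → z :- con (+ 0) := z) refl z)) q

      ▷-functional : ∀ {y z y′ z′} → y ▷ z → y′ ▷ z′ → y ≈ y′ → z ∼ z′
      ▷-functional d d′ y≈y′ = ▷-0 (+-▷ d (neg-▷ d′)) (x≈y⇒x-y≈0 y≈y′)

-- Denominators of rational numbers and the localization of ℤ at q

module Rationals {c ℓ} (Ω : AlgebraicClosureOfℚ c ℓ) where
  open AlgebraicClosureOfℚ Ω hiding (zero)
  open IntegerImage commutativeRing
  open FieldTools commutativeRing isField
  open Homs commutativeRing isField
  open SetoidReasoning setoid

  ⟪suc⟫≉0 : ∀ n → ¬ ⟪ suc n ⟫ ≈ 0#
  ⟪suc⟫≉0 n eq = characteristic-0 n (trans (Mult′.×ᵤ≈× semiring (suc n) 1#) eq)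

  ι≈0⇒≡0 : ∀ i → ι i ≈ 0# → i ≡ + 0
  ι≈0⇒≡0 (+ zero)  eq = ≡.refl
  ι≈0⇒≡0 (+ suc n) eq = contradiction eq (⟪suc⟫≉0 n)
  ι≈0⇒≡0 -[1+ n ]  eq = contradiction
    (trans (solve 1 (λ x → x := :- (:- x)) refl ⟪ suc n ⟫)
           (trans (-‿cong eq) (solve 0 (:- con (+ 0) := con (+ 0)) refl)))
    (⟪suc⟫≉0 n)

  ι-injective : ∀ i j → ι i ≈ ι j → i ≡ j
  ι-injective i j eq = ℤₚ.i-j≡0⇒i≡j i j (ι≈0⇒≡0 (i ℤ.- j) (begin
    ι (i ℤ.- j)       ≈⟨ ι-+ i (ℤ.- j) ⟩
    ι i + ι (ℤ.- j)   ≈⟨ +-congˡ (ι-neg j) ⟩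
    ι i - ι j         ≈⟨ x≈y⇒x-y≈0 eq ⟩
    0#                ∎))

  ⟪⟫-* : ∀ m n → ⟪ m ℕ.* n ⟫ ≈ ⟪ m ⟫ * ⟪ n ⟫
  ⟪⟫-* = Mult′.×1-homo-* semiring

  -- For d = 0 this holds of every x, which is why it occurs with `suc d` or together with q ∤ d.
  Clears : ℕ → Carrier → Set ℓ
  Clears d x = ∃ λ i → ⟪ d ⟫ * x ≈ ι i

  clears-resp : ∀ {d x y} → x ≈ y → Clears d x → Clears d y
  clears-resp x≈y (i , p) = i , trans (*-congˡ (sym x≈y)) p

  clears-ι : ∀ i → Clears 1 (ι i)
  clears-ι i = i , *-identityˡ _

  clears-+ : ∀ {d e x y} → Clears d x → Clears e y → Clears (d ℕ.* e) (x + y)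
  clears-+ {d} {e} {x} {y} (i , p) (j , q) = (+ e) ℤ.* i ℤ.+ (+ d) ℤ.* j , (begin
    ⟪ d ℕ.* e ⟫ * (x + y)
      ≈⟨ *-congʳ (⟪⟫-* d e) ⟩
    (⟪ d ⟫ * ⟪ e ⟫) * (x + y)
      ≈⟨ solve 4 (λ d e x y → (d :* e) :* (x :+ y) := e :* (d :* x) :+ d :* (e :* y))
           refl ⟪ d ⟫ ⟪ e ⟫ x y ⟩
    ⟪ e ⟫ * (⟪ d ⟫ * x) + ⟪ d ⟫ * (⟪ e ⟫ * y)
      ≈⟨ +-cong (*-congˡ p) (*-congˡ q) ⟩
    ι (+ e) * ι i + ι (+ d) * ι j
      ≈⟨ +-cong (ι-* (+ e) i) (ι-* (+ d) j) ⟨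
    ι ((+ e) ℤ.* i) + ι ((+ d) ℤ.* j)
      ≈⟨ ι-+ ((+ e) ℤ.* i) ((+ d) ℤ.* j) ⟨
    ι ((+ e) ℤ.* i ℤ.+ (+ d) ℤ.* j) ∎)

  clears-* : ∀ {d e x y} → Clears d x → Clears e y → Clears (d ℕ.* e) (x * y)
  clears-* {d} {e} {x} {y} (i , p) (j , q) = i ℤ.* j , (begin
    ⟪ d ℕ.* e ⟫ * (x * y)          ≈⟨ *-congʳ (⟪⟫-* d e) ⟩
    (⟪ d ⟫ * ⟪ e ⟫) * (x * y)
      ≈⟨ solve 4 (λ d e x y → (d :* e) :* (x :* y) := (d :* x) :* (e :* y))
           refl ⟪ d ⟫ ⟪ e ⟫ x y ⟩
    (⟪ d ⟫ * x) * (⟪ e ⟫ * y)      ≈⟨ *-cong p q ⟩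
    ι i * ι j                      ≈⟨ ι-* i j ⟨
    ι (i ℤ.* j)                    ∎)

  clears-neg : ∀ {d x} → Clears d x → Clears d (- x)
  clears-neg {d} {x} (i , p) = ℤ.- i , (begin
    ⟪ d ⟫ * - x     ≈⟨ solve 2 (λ d x → d :* (:- x) := :- (d :* x)) refl ⟪ d ⟫ x ⟩
    - (⟪ d ⟫ * x)   ≈⟨ -‿cong p ⟩
    - ι i           ≈⟨ ι-neg i ⟨
    ι (ℤ.- i)       ∎)

  clears-∣ : ∀ {d e x} → Clears d x → d ∣ e → Clears e x
  clears-∣ {d} {x = x} (i , p) (divides k ≡.refl) = (+ k) ℤ.* i , (begin
    ⟪ k ℕ.* d ⟫ * x        ≈⟨ *-congʳ (⟪⟫-* k d) ⟩
    (⟪ k ⟫ * ⟪ d ⟫) * x    ≈⟨ *-assoc _ _ _ ⟩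
    ⟪ k ⟫ * (⟪ d ⟫ * x)    ≈⟨ *-congˡ p ⟩
    ι (+ k) * ι i          ≈⟨ ι-* (+ k) i ⟨
    ι ((+ k) ℤ.* i)        ∎)

  -- The numerator i becomes the denominator. As denominators are natural numbers, its sign moves to
  -- the new numerator.
  clears-inverse : ∀ {d i x y} → ⟪ d ⟫ * x ≈ ι i → x * y ≈ 1# → Clears ℤ.∣ i ∣ y
  clears-inverse {d} {i} {x} {y} p xy≈1 = go i (begin
    ι i * y            ≈⟨ *-congʳ p ⟨
    (⟪ d ⟫ * x) * y    ≈⟨ *-assoc _ _ _ ⟩
    ⟪ d ⟫ * (x * y)    ≈⟨ *-congˡ xy≈1 ⟩
    ⟪ d ⟫ * 1#         ≈⟨ *-identityʳ _ ⟩
    ⟪ d ⟫              ∎)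
    where
    go : ∀ i → ι i * y ≈ ⟪ d ⟫ → Clears ℤ.∣ i ∣ y
    go (+ n)    eq = + d , eq
    go -[1+ n ] eq = ℤ.- (+ d) , (begin
      ⟪ suc n ⟫ * y         ≈⟨ solve 2 (λ n y → n :* y := :- ((:- n) :* y)) refl ⟪ suc n ⟫ y ⟩
      - (- ⟪ suc n ⟫ * y)   ≈⟨ -‿cong eq ⟩
      - ⟪ d ⟫               ≈⟨ ι-neg (+ d) ⟨
      ι (ℤ.- (+ d))         ∎)

  rational-clears : ∀ {x} → x ∈ Member ℚ-field → ∃ λ d → Clears (suc d) x
  rational-clears (gen-resp x≈y x∈) with rational-clears x∈
  ... | d , cl = d , clears-resp {suc d} x≈y cl
  rational-clears gen-0 = 0 , clears-ι (+ 0)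
  rational-clears gen-1 = 0 , clears-ι (+ 1)
  rational-clears (gen-+ {x} {y} x∈ y∈) with rational-clears x∈ | rational-clears y∈
  ... | d , cl | e , cl′ = e ℕ.+ d ℕ.* suc e , clears-+ {suc d} {suc e} {x} {y} cl cl′
  rational-clears (gen-* {x} {y} x∈ y∈) with rational-clears x∈ | rational-clears y∈
  ... | d , cl | e , cl′ = e ℕ.+ d ℕ.* suc e , clears-* {suc d} {suc e} {x} {y} cl cl′
  rational-clears (gen-neg {x} x∈) with rational-clears x∈
  ... | d , cl = d , clears-neg {suc d} {x} cl
  -- The numerator of x must be nonzero in order to become a denominator: otherwise x = 0, against x
  -- y = 1.
  rational-clears (gen-inv {x} {y} x∈ xy≈1) with rational-clears x∈
  ... | d , i , p = nonzero i (clears-inverse {suc d} {i} {x} {y} p xy≈1) i≢0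
    where
    i≢0 : ¬ i ≡ + 0
    i≢0 ≡.refl = 1≉0 (begin
      1#       ≈⟨ xy≈1 ⟨
      x * y    ≈⟨ *-congʳ (x*y≈0⇒y≈0 (⟪suc⟫≉0 d) p) ⟩
      0# * y   ≈⟨ zeroˡ y ⟩
      0#       ∎)
    nonzero : ∀ i → Clears ℤ.∣ i ∣ y → ¬ i ≡ + 0 → ∃ λ d → Clears (suc d) y
    nonzero (+ zero)  cl i≢0 = contradiction ≡.refl i≢0
    nonzero (+ suc n) cl i≢0 = n , cl
    nonzero -[1+ n ]  cl i≢0 = n , cl

  common-denominator : ∀ {n} (f : Fin n → Carrier) → (∀ i → f i ∈ Member ℚ-field) →
    ∃ λ d → ∀ i → Clears (suc d) (f i)
  common-denominator {zero}  f f∈ = 0 , λ ()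
  common-denominator {suc n} f f∈
    with rational-clears (f∈ zero) | common-denominator (f ∘ suc) (f∈ ∘ suc)
  ... | d , cl | e , cls = e ℕ.+ d ℕ.* suc e , λ where
    zero    → clears-∣ {suc d} {x = f zero} cl (divides (suc e) (ℕₚ.*-comm (suc d) (suc e)))
    (suc i) → clears-∣ {suc e} {x = f (suc i)} (cls i) (divides (suc d) ≡.refl)

  common-denominator₂ : ∀ {m n} (f : Fin m → Fin n → Carrier) → (∀ i j → f i j ∈ Member ℚ-field) →
    ∃ λ d → ∀ i j → Clears (suc d) (f i j)
  common-denominator₂ {m} {n} f f∈ = proj₁ flat , λ i j →
    ≡.subst (λ ij → Clears (suc (proj₁ flat)) (f (proj₁ ij) (proj₂ ij)))
      (Finₚ.remQuot-combine {m} {n} i j) (proj₂ flat (combine i j))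
    where
    flat : ∃ λ d → ∀ k → Clears (suc d) (f (proj₁ (remQuot {m} n k)) (proj₂ (remQuot {m} n k)))
    flat = common-denominator _ (λ k → f∈ (proj₁ (remQuot {m} n k)) (proj₂ (remQuot {m} n k)))

  ι-closed : ∀ {s} (E : Subfield s) i → ι i ∈ Member E
  ι-closed E (+ n)    = ⟪⟫∈ n
    where
    ⟪⟫∈ : ∀ n → ⟪ n ⟫ ∈ Member E
    ⟪⟫∈ zero          = 0-closed E
    ⟪⟫∈ (suc zero)    = 1-closed E
    ⟪⟫∈ (suc (suc n)) = +-closed E (⟪⟫∈ (suc n)) (1-closed E)
  ι-closed E -[1+ n ] = neg-closed E (ι-closed E (+ suc n))

  module Localization (q : ℕ) (q-prime : Prime q) where

    q≢0 : ¬ q ≡ 0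
    q≢0 ≡.refl = ¬prime[0] q-prime

    Q : Carrier
    Q = ⟪ q ⟫

    Q≉0 : ¬ Q ≈ 0#
    Q≉0 eq = q≢0 (ℤₚ.+-injective (ι≈0⇒≡0 (+ q) eq))

    ∤-* : ∀ {d e} → q ∤ d → q ∤ e → q ∤ d ℕ.* e
    ∤-* q∤d q∤e q∣de = [ q∤d , q∤e ]′ (euclidsLemma _ _ q-prime q∣de)

    q∤1 : q ∤ 1
    q∤1 q∣1 = ¬prime[1] (≡.subst Prime (∣1⇒≡1 q∣1) q-prime)

    Local : Pred Carrier ℓ
    Local x = ∃ λ d → q ∤ d × Clears d x

    local-ι : ∀ i → ι i ∈ Local
    local-ι i = 1 , q∤1 , clears-ι i

    ℤ₍q₎ : Subring ℓ
    ℤ₍q₎ = record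
      { Elem       = Local
      ; resp′      = λ { x≈y (d , q∤d , cl) → d , q∤d , clears-resp {d} x≈y cl }
      ; 0-closed′  = local-ι (+ 0)
      ; 1-closed′  = local-ι (+ 1)
      ; +-closed′  = λ { {x} {y} (d , q∤d , cl) (e , q∤e , cl′) →
          _ , ∤-* q∤d q∤e , clears-+ {d} {e} {x} {y} cl cl′ }
      ; *-closed′  = λ { {x} {y} (d , q∤d , cl) (e , q∤e , cl′) →
          _ , ∤-* q∤d q∤e , clears-* {d} {e} {x} {y} cl cl′ }
      ; neg-closed′ = λ { {x} (d , q∤d , cl) → d , q∤d , clears-neg {d} {x} cl }
      }
    open Subring ℤ₍q₎ public

    local⇒rational : ∀ {x} → x ∈ Local → x ∈ Member ℚ-field
    local⇒rational {x} (d , q∤d , i , p) = from-inverse (inverse ⟪ d ⟫ d≉0)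
      where
      d≉0 : ¬ ⟪ d ⟫ ≈ 0#
      d≉0 eq = q∤d (≡.subst (q ∣_) (≡.sym (ℤₚ.+-injective (ι≈0⇒≡0 (+ d) eq))) (q ∣0))
      from-inverse : (∃ λ v → ⟪ d ⟫ * v ≈ 1#) → x ∈ Member ℚ-field
      from-inverse (v , dv≈1) = resp ℚ-field (begin
        ι i * v           ≈⟨ *-congʳ p ⟨
        (⟪ d ⟫ * x) * v   ≈⟨ solve 3 (λ d x v → (d :* x) :* v := (d :* v) :* x) refl ⟪ d ⟫ x v ⟩
        (⟪ d ⟫ * v) * x   ≈⟨ *-congʳ dv≈1 ⟩
        1# * x            ≈⟨ *-identityˡ x ⟩
        x                 ∎)
        (*-closed ℚ-field (ι-closed ℚ-field i) (inv-closed ℚ-field (ι-closed ℚ-field (+ d)) dv≈1))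

    local-Q : Q ∈ Local
    local-Q = local-ι (+ q)

    Unit : Pred Carrier (c ⊔ ℓ)
    Unit x = ∃ λ y → y ∈ Local × x * y ≈ 1#

    Multiple : Pred Carrier (c ⊔ ℓ)
    Multiple x = ∃ λ y → y ∈ Local × x ≈ Q * y

    unit-* : ∀ {x y} → Unit x → Unit y → Unit (x * y)
    unit-* {x} {y} (u , u∈ , xu) (v , v∈ , yv) = u * v , *-closed′ u∈ v∈ , (begin
      (x * y) * (u * v)  ≈⟨ solve 4 (λ x y u v → (x :* y) :* (u :* v) := (x :* u) :* (y :* v))
                              refl x y u v ⟩
      (x * u) * (y * v)  ≈⟨ *-cong xu yv ⟩
      1# * 1#            ≈⟨ *-identityˡ 1# ⟩
      1#                 ∎)

    unit-1 : Unit 1#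
    unit-1 = 1# , 1-closed′ , *-identityˡ 1#

    qℤ₍q₎ : Ideal ℤ₍q₎ (c ⊔ ℓ)
    qℤ₍q₎ = record
      { In      = Multiple
      ; In-resp = λ { x≈y (u , u∈ , eq) → u , u∈ , trans (sym x≈y) eq }
      ; In-0    = 0# , 0-closed′ , sym (zeroʳ Q)
      ; In-+    = λ { {x} {y} (u , u∈ , eq) (v , v∈ , eq′) →
          u + v , +-closed′ u∈ v∈ , trans (+-cong eq eq′) (sym (distribˡ Q u v)) }
      ; In-neg  = λ { {x} (u , u∈ , eq) → - u , neg-closed′ u∈ , trans (-‿cong eq)
          (solve 2 (λ q u → :- (q :* u) := q :* (:- u)) refl Q u) }
      ; In-*    = λ { {b} {x} b∈ (u , u∈ , eq) → b * u , *-closed′ b∈ u∈ , trans (*-congˡ eq)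
          (solve 3 (λ b q u → b :* (q :* u) := q :* (b :* u)) refl b Q u) }
      }
    open Ideal qℤ₍q₎ public

    multiple⇒¬unit : ∀ {x} → Multiple x → ¬ Unit x
    multiple⇒¬unit {x} (u , u∈ , x≈qu) (v , v∈ , xv≈1) = impossible (*-closed′ u∈ v∈) (begin
      Q * (u * v)   ≈⟨ *-assoc _ _ _ ⟨
      (Q * u) * v   ≈⟨ *-congʳ x≈qu ⟨
      x * v         ≈⟨ xv≈1 ⟩
      1#            ∎)
      where
      impossible : ∀ {w} → w ∈ Local → ¬ Q * w ≈ 1#
      impossible {w} (d , q∤d , i , p) qw≈1 = q∤d
        (ℤ∣.∣⇒∣ᵤ {+ q} {+ d} (ℤ∣.divides i (ι-injective (+ d) (i ℤ.* + q) (begin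
          ⟪ d ⟫              ≈⟨ *-identityʳ _ ⟨
          ⟪ d ⟫ * 1#         ≈⟨ *-congˡ qw≈1 ⟨
          ⟪ d ⟫ * (Q * w)    ≈⟨ solve 3 (λ d q w → d :* (q :* w) := (d :* w) :* q) refl ⟪ d ⟫ Q w ⟩
          (⟪ d ⟫ * w) * Q    ≈⟨ *-congʳ p ⟩
          ι i * ι (+ q)      ≈⟨ ι-* i (+ q) ⟨
          ι (i ℤ.* + q)      ∎))))

    -- ℤ₍q₎ is local with maximal ideal generated by q: either q divides the numerator, or the
    -- numerator is an admissible denominator for the inverse.
    multiple⊎unit : ∀ {x} → x ∈ Local → Multiple x ⊎ Unit x
    multiple⊎unit {x} (d , q∤d , i , p) with q ∣? ℤ.∣ i ∣
    ... | yes q∣i with inverse ⟪ d ⟫ (λ eq → q∤d (≡.subst (q ∣_) (≡.sym (ℤₚ.+-injective (ι≈0⇒≡0 (+ d) eq))) (q ∣0)))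
                     | ℤ∣.∣ᵤ⇒∣ {+ q} {i} q∣i
    ...   | v , dv≈1 | ℤ∣.divides k i≡kq = inj₁ (ι k * v , (d , q∤d , k , dkv≈k) , (begin
      x                        ≈⟨ *-identityˡ x ⟨
      1# * x                   ≈⟨ *-congʳ dv≈1 ⟨
      (⟪ d ⟫ * v) * x          ≈⟨ solve 3 (λ d v x → (d :* v) :* x := (d :* x) :* v) refl ⟪ d ⟫ v x ⟩
      (⟪ d ⟫ * x) * v          ≈⟨ *-congʳ p ⟩
      ι i * v                  ≡⟨ ≡.cong (λ i → ι i * v) i≡kq ⟩
      ι (k ℤ.* + q) * v        ≈⟨ *-congʳ (ι-* k (+ q)) ⟩
      (ι k * Q) * v            ≈⟨ solve 3 (λ k q v → (k :* q) :* v := q :* (k :* v)) refl (ι k) Q v ⟩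
      Q * (ι k * v)            ∎))
      where
      dkv≈k : ⟪ d ⟫ * (ι k * v) ≈ ι k
      dkv≈k = begin
        ⟪ d ⟫ * (ι k * v)   ≈⟨ solve 3 (λ d k v → d :* (k :* v) := k :* (d :* v)) refl ⟪ d ⟫ (ι k) v ⟩
        ι k * (⟪ d ⟫ * v)   ≈⟨ *-congˡ dv≈1 ⟩
        ι k * 1#            ≈⟨ *-identityʳ _ ⟩
        ι k                 ∎
    multiple⊎unit {x} (d , q∤d , i , p) | no q∤i with inverse x x≉0
      where
      x≉0 : ¬ x ≈ 0#
      x≉0 x≈0 = q∤i (≡.subst (λ i → q ∣ ℤ.∣ i ∣)
        (≡.sym (ι≈0⇒≡0 i (trans (sym p) (trans (*-congˡ x≈0) (zeroʳ _))))) (q ∣0))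
    ...   | y , xy≈1 = inj₂ (y , (_ , q∤i , clears-inverse {d} {i} {x} {y} p xy≈1) , xy≈1)

    q-part : ∀ d → ¬ d ≡ 0 → ∃₂ λ k e → q ∤ e × d ≡ q ℕ.^ k ℕ.* e
    q-part = <-rec _ λ d rec d≢0 → step d rec d≢0
      where
      step : ∀ d → (∀ {e} → e ℕ.< d → ¬ e ≡ 0 → ∃₂ λ k f → q ∤ f × e ≡ q ℕ.^ k ℕ.* f) →
             ¬ d ≡ 0 → ∃₂ λ k e → q ∤ e × d ≡ q ℕ.^ k ℕ.* e
      step d rec d≢0 with q ∣? d
      ... | no q∤d = 0 , d , q∤d , ≡.sym (ℕₚ.+-identityʳ d)
      ... | yes (divides e ≡.refl) with rec e<eq e≢0
        where
        e≢0 : ¬ e ≡ 0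
        e≢0 ≡.refl = d≢0 ≡.refl
        e<eq : e ℕ.< e ℕ.* q
        e<eq = ℕₚ.m<m*n e q {{ℕ.≢-nonZero e≢0}} (ℕₚ.≤∧≢⇒< (ℕ.>-nonZero⁻¹ q {{ℕ.≢-nonZero q≢0}})
                 (λ 1≡q → ¬prime[1] (≡.subst Prime (≡.sym 1≡q) q-prime)))
      ...   | k , f , q∤f , e≡ = suc k , f , q∤f , ≡.trans (ℕₚ.*-comm e q)
        (≡.trans (≡.cong (q ℕ.*_) e≡) (≡.sym (ℕₚ.*-assoc q (q ℕ.^ k) f)))

    ⟪q^⟫ : ∀ k → ⟪ q ℕ.^ k ⟫ ≈ Q ^ k
    ⟪q^⟫ zero    = refl
    ⟪q^⟫ (suc k) = trans (⟪⟫-* q (q ℕ.^ k)) (*-congˡ (⟪q^⟫ k))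

    -- The prime-to-q part of a common denominator is already admissible in ℤ₍q₎, so a power of q
    -- suffices. Applied to coordinates in θ, this makes any element of L integral at the place
    -- after multiplication by a power of q.
    common-q-power : ∀ {n} (f : Fin n → Carrier) → (∀ i → f i ∈ Member ℚ-field) →
      ∃ λ k → ∀ i → Q ^ k * f i ∈ Local
    common-q-power f f∈ with common-denominator f f∈
    ... | d , cl with q-part (suc d) (λ ())
    ...   | k , e , q∤e , d≡ = k , λ i → e , q∤e , proj₁ (cl i) , (begin
      ⟪ e ⟫ * (Q ^ k * f i)       ≈⟨ solve 3 (λ e q f → e :* (q :* f) := (q :* e) :* f)
                                       refl ⟪ e ⟫ (Q ^ k) (f i) ⟩
      (Q ^ k * ⟪ e ⟫) * f i       ≈⟨ *-congʳ (*-congʳ (⟪q^⟫ k)) ⟨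
      (⟪ q ℕ.^ k ⟫ * ⟪ e ⟫) * f i ≈⟨ *-congʳ (⟪⟫-* (q ℕ.^ k) e) ⟨
      ⟪ q ℕ.^ k ℕ.* e ⟫ * f i     ≡⟨ ≡.cong (λ d → ⟪ d ⟫ * f i) d≡ ⟨
      ⟪ suc d ⟫ * f i             ≈⟨ proj₂ (cl i) ⟩
      ι (proj₁ (cl i))            ∎)

-- Spans and primitive elements

module Spans {c ℓ} (R : CommutativeRing c ℓ) (isField : IsField R) where
  open CommutativeRing R hiding (zero)
  open IsField isField
  open Subfields R
  open IntegerImage R
  open FieldTools R isField
  open Exp semiring using (_^_)
  open BigOp +-commutativeMonoid using (sum-cong-≋; ∑-comm) renaming (sum to ∑)
  open BigOp *-commutativeMonoid using () renaming (sum to ∏)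
  open SemiringSum semiring using (*-distribˡ-sum; *-distribʳ-sum)
  open SetoidReasoning setoid

  InSpan : ∀ {s n} → Subfield s → (Fin n → Carrier) → Pred Carrier (c ⊔ ℓ ⊔ s)
  InSpan {n = n} k u y = Σ (Fin n → Carrier) λ a → (∀ i → a i ∈ Member k) × y ≈ ∑ (λ i → a i * u i)

  dependent-vectors : ∀ {s n} (k : Subfield s) (u : Fin n → Carrier) (v : Fin (suc n) → Carrier) →
    (∀ i → InSpan k u (v i)) →
    ∃ λ (x : Fin (suc n) → Carrier) → (∀ i → x i ∈ Member k) ×
      (∃ λ i → ¬ x i ≈ 0#) × ∑ (λ i → x i * v i) ≈ 0#
  dependent-vectors {n = n} k u v v∈
    with dependent k n (λ i → proj₁ (v∈ i)) (λ i → proj₁ (proj₂ (v∈ i)))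
  ... | x , x∈ , x≢0 , xA≈0 = x , x∈ , x≢0 , (begin
    ∑ (λ i → x i * v i)
      ≈⟨ sum-cong-≋ (λ i → trans (*-congˡ (proj₂ (proj₂ (v∈ i)))) (*-distribˡ-sum (x i) (λ j → A i j * u j))) ⟩
    ∑ (λ i → ∑ (λ j → x i * (A i j * u j)))
      ≈⟨ ∑-comm (λ i j → x i * (A i j * u j)) ⟩
    ∑ (λ j → ∑ (λ i → x i * (A i j * u j)))
      ≈⟨ ∑≈0 _ (λ j → begin
           ∑ (λ i → x i * (A i j * u j))   ≈⟨ sum-cong-≋ (λ i → *-assoc (x i) (A i j) (u j)) ⟨
           ∑ (λ i → (x i * A i j) * u j)   ≈⟨ *-distribʳ-sum (u j) (λ i → x i * A i j) ⟨
           ∑ (λ i → x i * A i j) * u j     ≈⟨ *-congʳ (xA≈0 j) ⟩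
           0# * u j                        ≈⟨ zeroˡ _ ⟩
           0#                              ∎) ⟩
    0# ∎)
    where
    A : Fin (suc n) → Fin n → Carrier
    A i = proj₁ (v∈ i)

  -- An element α with as many conjugates ρᵢ as the dimension generates the extension.
  module PrimitiveElement {s v N} (k : Subfield s) (V : Pred Carrier v)
    (u : Fin N → Carrier) (spanned : ∀ {y} → y ∈ V → InSpan k u y)
    (α : Carrier) (powers : ∀ n → α ^ n ∈ V)
    (ρ : Fin N → Carrier) (ρ-distinct : Distinct ρ)
    (conjugate : ∀ {n} (r : Fin n → Carrier) → (∀ i → r i ∈ Member k) →
                 ev r α ≈ 0# → ∀ j → ev r (ρ j) ≈ 0#)
    where

    -- A polynomial of degree less than N over k which vanishes at α vanishes at its N distinct
    -- conjugates.
    independent : (r : Fin N → Carrier) → (∀ i → r i ∈ Member k) → ev r α ≈ 0# → ∀ i → r i ≈ 0#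
    independent r r∈ eq = roots⇒≈0 r ρ ρ-distinct (conjugate r r∈ eq)

    abstract
      -- The N + 1 elements y, 1, α, ..., αᴺ⁻¹ lie in a span of N elements, hence are dependent. The
      -- coefficient of y is nonzero, since otherwise the powers of α would be dependent.
      express : ∀ {y} → y ∈ V →
        Σ (Fin N → Carrier) λ r → (∀ i → r i ∈ Member k) × y ≈ ev r α
      express {y} y∈ = solve-for-y (dependent-vectors k u w w∈)
        where
        w : Fin (suc N) → Carrier
        w zero    = y
        w (suc i) = α ^ toℕ i
        w∈ : ∀ i → InSpan k u (w i)
        w∈ zero    = spanned y∈
        w∈ (suc i) = spanned (powers (toℕ i))
        solve-for-y : (∃ λ (x : Fin (suc N) → Carrier) → (∀ i → x i ∈ Member k) ×
            (∃ λ i → ¬ x i ≈ 0#) × ∑ (λ i → x i * w i) ≈ 0#) →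
          Σ (Fin N → Carrier) λ r → (∀ i → r i ∈ Member k) × y ≈ ev r α
        solve-for-y (x , x∈ , (i₀ , xᵢ≉0) , eq) with x zero ≟ 0#
        ... | yes x₀≈0 = contradiction (all≈0 i₀) xᵢ≉0
          where
          all≈0 : ∀ i → x i ≈ 0#
          all≈0 zero    = x₀≈0
          all≈0 (suc i) = independent (x ∘ suc) (x∈ ∘ suc) (begin
            ev (x ∘ suc) α                              ≈⟨ ev≈∑ (x ∘ suc) α ⟩
            ∑ (λ i → x (suc i) * α ^ toℕ i)             ≈⟨ +-identityˡ _ ⟨
            0# + ∑ (λ i → x (suc i) * α ^ toℕ i)        ≈⟨ +-congʳ (trans (*-congʳ x₀≈0) (zeroˡ y)) ⟨
            x zero * y + ∑ (λ i → x (suc i) * α ^ toℕ i) ≈⟨ eq ⟩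
            0#                                          ∎) i
        ... | no x₀≉0 with inverse (x zero) x₀≉0
        ...   | z , xz≈1 = (λ i → - z * x (suc i)) ,
          (λ i → *-closed k (neg-closed k (inv-closed k (x∈ zero) xz≈1)) (x∈ (suc i))) ,
          (begin
            y                                     ≈⟨ *-identityˡ y ⟨
            1# * y                                ≈⟨ *-congʳ xz≈1 ⟨
            (x zero * z) * y
              ≈⟨ solve 4 (λ x z y e → (x :* z) :* y := z :* (x :* y :+ e) :+ (:- z) :* e)
                   refl (x zero) z y (ev (x ∘ suc) α) ⟩
            z * (x zero * y + ev (x ∘ suc) α) + - z * ev (x ∘ suc) α
              ≈⟨ +-congʳ (*-congˡ (trans (+-congˡ (ev≈∑ (x ∘ suc) α)) eq)) ⟩
            z * 0# + - z * ev (x ∘ suc) α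
              ≈⟨ trans (+-congʳ (zeroʳ z)) (+-identityˡ _) ⟩
            - z * ev (x ∘ suc) α                  ≈⟨ ev-*ˡ (- z) (x ∘ suc) α ⟨
            ev (λ i → - z * x (suc i)) α          ∎)

    -- The minimal polynomial of α is Xᴺ minus this one: the sign is that of a reduction rule for
    -- αᴺ, the form in which `Extension` takes it.
    coefficients : Fin N → Carrier
    coefficients = proj₁ (express (powers N))

    coefficients∈k : ∀ i → coefficients i ∈ Member k
    coefficients∈k = proj₁ (proj₂ (express (powers N)))

    α-root : α ^ N ≈ ev coefficients α
    α-root = proj₂ (proj₂ (express (powers N)))

    private
      h : Fin (suc N) → Carrier
      h = monic (λ i → - 1# * coefficients i)

      ev-h : ∀ x → ev h x ≈ x ^ N - ev coefficients x
      ev-h x = trans (ev-monic (λ i → - 1# * coefficients i) x) (+-congˡ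
        (trans (ev-*ˡ (- 1#) coefficients x) (solve 1 (λ e → :- con (+ 1) :* e := :- e) refl _)))

      h∈k : ∀ i → h i ∈ Member k
      h∈k = monic-closed (subring k) (λ i → - 1# * coefficients i)
        (λ i → *-closed k (neg-closed k (1-closed k)) (coefficients∈k i))

    -- α is a root of this monic polynomial over k, so its N distinct conjugates are roots as well,
    -- and they account for the whole degree.
    minimal-polynomial : ∀ x → x ^ N - ev coefficients x ≈ ∏ (λ i → x - ρ i)
    minimal-polynomial x = begin
      x ^ N - ev coefficients x                ≈⟨ ev-h x ⟨
      ev h x                                   ≈⟨ factorisation h ρ ρ-distinct
                                                    (conjugate h h∈k (trans (ev-h α) (x≈y⇒x-y≈0 α-root))) x ⟩
      h (fromℕ N) * ∏ (λ i → x - ρ i)          ≈⟨ *-congʳ (monic-last (λ i → - 1# * coefficients i)) ⟩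
      1# * ∏ (λ i → x - ρ i)                   ≈⟨ *-identityˡ _ ⟩
      ∏ (λ i → x - ρ i)                        ∎

    root-is-conjugate : ∀ {x} → x ^ N ≈ ev coefficients x → ∃ λ i → x ≈ ρ i
    root-is-conjugate {x} x-root = proj₁ hit , x-y≈0⇒x≈y (proj₂ hit)
      where
      hit : ∃ λ i → x - ρ i ≈ 0#
      hit = ∏≈0⇒∃≈0 (λ i → x - ρ i) (trans (sym (minimal-polynomial x)) (x≈y⇒x-y≈0 x-root))

-- The place θ ≡ t above q and its valuation

module Valuation {c ℓ} (Ω : AlgebraicClosureOfℚ c ℓ) where
  open AlgebraicClosureOfℚ Ω hiding (zero)
  open IntegerImage commutativeRing
  open FieldTools commutativeRing isField
  open Homs commutativeRing isField
  open Rationals Ω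
  open ExpProperties commutativeSemiring using (^-distrib-*; ^-homo-*; ^-assocʳ; ^-congˡ)
  open SetoidReasoning setoid

  module AtPrime (q : ℕ) (q-prime : Prime q) where
    open Localization q q-prime

    -- The place of ℚ(θ) above q at which θ ≡ t.  Here y ▷ z says that y is integral at the
    -- place with residue z.
    module Place (m : ℕ) (coeff : Fin (suc m) → ⟦⟧) (θ t : Carrier)
      (θ-root : θ ^ suc m ≈ ev (proj₁ ∘ coeff) θ)
      (t∈ : t ∈ Local) (t-root : t ^ suc m ∼ ev (proj₁ ∘ coeff) t)
      (independent : (r : Fin (suc m) → ⟦⟧) → ev (proj₁ ∘ r) θ ≈ 0# → ∀ i → proj₁ (r i) ≈ 0#)
      where

      inclusion : Hom ℤ₍q₎
      inclusion = record
        { map = proj₁ ; cong = λ eq → eq ; +-homo = λ _ _ → refl ; *-homo = λ _ _ → refl ; 1-homo = refl }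

      open Extension qℤ₍q₎ inclusion proj₂ m coeff θ t θ-root t∈ t-root public
      open Independent independent public

      Integral : Pred Carrier (c ⊔ ℓ)
      Integral y = ∃ λ z → y ▷ z

      -- Only the residue has to be a unit. The inverse of y need not be a polynomial in θ over
      -- ℤ₍q₎, because that ring may have further maximal ideals.
      Invertible : Pred Carrier (c ⊔ ℓ)
      Invertible y = ∃ λ z → y ▷ z × Unit z

      invertible-resp : ∀ {x y} → x ≈ y → Invertible x → Invertible y
      invertible-resp x≈y (z , d , uz) = z , ▷-resp x≈y refl d , uz

      invertible-1 : Invertible 1#
      invertible-1 = 1# , 1-▷ , unit-1

      invertible-* : ∀ {x y} → Invertible x → Invertible y → Invertible (x * y)
      invertible-* (z , d , uz) (z′ , d′ , uz′) = z * z′ , *-▷ d d′ , unit-* uz uz′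

      invertible-^ : ∀ {x} n → Invertible x → Invertible (x ^ n)
      invertible-^ zero    ix = invertible-1
      invertible-^ (suc n) ix = invertible-* ix (invertible-^ n ix)

      invertible-∏ : ∀ {n} (f : Fin n → Carrier) → (∀ i → Invertible (f i)) → Invertible (∏ f)
      invertible-∏ {zero}  f inv = invertible-1
      invertible-∏ {suc n} f inv = invertible-* (inv zero) (invertible-∏ (f ∘ suc) (inv ∘ suc))

      local : ∀ {y z} → y ▷ z → z ∈ Local
      local (_ , _ , _ , z∈) = z∈

      Q-▷ : Q ▷ Q
      Q-▷ = const-▷ (Q , local-Q)

      ¬invertible-multiple : ∀ {x y z} → Invertible x → y ▷ z → Multiple z → ¬ x ≈ y
      ¬invertible-multiple {z = z} (z′ , d′ , uz′) d mz x≈y = multiple⇒¬unit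
        (In-resp (solve 2 (λ a b → (a :- b) :+ b := a) refl z′ z) (In-+ (▷-functional d′ d x≈y) mz)) uz′

      invertible-+Q : ∀ {x y z} → Invertible x → y ▷ z → Invertible (x + Q * y)
      invertible-+Q {x} {y} {z} (z′ , d′ , uz′) d = z′ + Q * z , sum-▷ , is-unit
        where
        sum-▷ = +-▷ d′ (*-▷ Q-▷ d)
        is-unit : Unit (z′ + Q * z)
        is-unit = [ (λ mult → contradiction uz′ (multiple⇒¬unit
            (In-resp (solve 2 (λ a b → (a :+ b) :- b := a) refl z′ (Q * z))
              (In-+ mult (In-neg (z , local d , refl))))))
          , (λ u → u) ]′ (multiple⊎unit (local sum-▷))

      -- Residues multiply, so a residue z divisible by q would make the residue of x y divisible by
      -- q.
      unit-∣ : ∀ {x y z z′} → x ▷ z → y ▷ z′ → Invertible (x * y) → Unit z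
      unit-∣ {z = z} {z′} d d′ ixy =
        [ (λ mz → contradiction refl (¬invertible-multiple ixy (*-▷ d d′)
            (In-resp (*-comm z′ z) (In-* (local d′) mz))))
        , (λ uz → uz) ]′ (multiple⊎unit (local d))

      module Uniformizer (H : Carrier) (H-invertible : Invertible H)
        (a : Carrier) (a∈ : a ∈ Local) (H-root : (t - θ) * H ≈ Q * a) where

        -- Synthetic division at t writes y as r(t) + (θ - t) w. Here q divides r(t), and H turns t
        -- - θ into q a.
        divide : ∀ {y z} → y ▷ z → Multiple z → ∃ λ y′ → Integral y′ × H * y ≈ Q * y′
        divide {y} {z} (r , y≈ , z∼ , _) mz = quotient
          (In-resp (solve 2 (λ z e → z :- (z :- e) := e) refl z (ev (proj₁ ∘ r) t))
                   (In-+ mz (In-neg z∼)))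
          where
          r′ : Fin m → ⟦⟧
          r′ i = quot t (proj₁ ∘ r) i , quot-closed ℤ₍q₎ (proj₁ ∘ r) t∈ (proj₂ ∘ r) i
          w : Carrier
          w = ev (proj₁ ∘ r′) θ
          quotient : Multiple (ev (proj₁ ∘ r) t) → ∃ λ y′ → Integral y′ × H * y ≈ Q * y′
          quotient (b , b∈ , ev≈Qb) =
            H * b - a * w ,
            (_ , +-▷ (*-▷ (proj₁ (proj₂ H-invertible)) (const-▷ (b , b∈)))
                     (neg-▷ (*-▷ (const-▷ (a , a∈)) (ev-▷ r′)))) ,
            (begin
              H * y                             ≈⟨ *-congˡ (trans y≈ (ev-quot t (proj₁ ∘ r) θ)) ⟩
              H * (ev (proj₁ ∘ r) t + (θ - t) * w)
                ≈⟨ *-congˡ (+-congʳ ev≈Qb) ⟩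
              H * (Q * b + (θ - t) * w)
                ≈⟨ solve 6 (λ h q b θ t w → h :* (q :* b :+ (θ :- t) :* w)
                              := q :* (h :* b) :- ((t :- θ) :* h) :* w) refl H Q b θ t w ⟩
              Q * (H * b) - ((t - θ) * H) * w   ≈⟨ +-congˡ (-‿cong (*-congʳ H-root)) ⟩
              Q * (H * b) - (Q * a) * w
                ≈⟨ solve 5 (λ q h b a w → q :* (h :* b) :- (q :* a) :* w := q :* (h :* b :- a :* w))
                     refl Q H b a w ⟩
              Q * (H * b - a * w)               ∎)

        Q^-multiple : ∀ {y z} n → y ▷ z → Multiple (Q ^ suc n * z)
        Q^-multiple {z = z} n d =
          Q ^ n * z , *-closed′ (^-closed n local-Q) (local d) , *-assoc _ _ _

        -- Descent on M. A unit residue of r makes the left side invertible, which is impossible for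
        -- M > 0. Otherwise H r = q r₁ for an integral r₁; after multiplication by Hᴾ the factor qᴾ
        -- cancels, M drops by P, and Hᴾ joins U.
        power-valuation : ∀ P .{{_ : ℕ.NonZero P}} M {r S U} →
          Integral r → Invertible S → Invertible U → r ^ P * S ≈ Q ^ M * U → P ∣ M
        power-valuation P M =
          <-rec (λ M → ∀ {r S U} → Integral r → Invertible S → Invertible U →
                       r ^ P * S ≈ Q ^ M * U → P ∣ M) step M
          where
          step : ∀ M → (∀ {M′} → M′ ℕ.< M → ∀ {r S U} → Integral r → Invertible S → Invertible U →
                          r ^ P * S ≈ Q ^ M′ * U → P ∣ M′) →
                 ∀ {r S U} → Integral r → Invertible S → Invertible U → r ^ P * S ≈ Q ^ M * U → P ∣ M
          step zero    rec ir iS iU eq = P ∣0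
          step M@(suc M′) rec {r} {S} {U} (z , d) iS iU@(u , dU , _) eq =
            [ (λ mz → descend (divide d mz))
            , (λ uz → contradiction eq (¬invertible-multiple
                (invertible-* (invertible-^ P (z , d , uz)) iS)
                (*-▷ (^-▷ M Q-▷) dU) (Q^-multiple M′ dU)))
            ]′ (multiple⊎unit (local d))
            where
            descend : (∃ λ r₁ → Integral r₁ × H * r ≈ Q * r₁) → P ∣ M
            descend (r₁ , (z₁ , d₁) , Hr≈Qr₁) = finish (P ℕₚ.≤? M)
              where
              scaled : Q ^ P * (r₁ ^ P * S) ≈ Q ^ M * (U * H ^ P)
              scaled = begin
                Q ^ P * (r₁ ^ P * S)     ≈⟨ *-assoc _ _ _ ⟨
                (Q ^ P * r₁ ^ P) * S     ≈⟨ *-congʳ (^-distrib-* Q r₁ P) ⟨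
                (Q * r₁) ^ P * S         ≈⟨ *-congʳ (^-congˡ P Hr≈Qr₁) ⟨
                (H * r) ^ P * S          ≈⟨ *-congʳ (^-distrib-* H r P) ⟩
                (H ^ P * r ^ P) * S      ≈⟨ *-assoc _ _ _ ⟩
                H ^ P * (r ^ P * S)      ≈⟨ *-congˡ eq ⟩
                H ^ P * (Q ^ M * U)      ≈⟨ solve 3 (λ h q u → h :* (q :* u) := q :* (u :* h))
                                              refl (H ^ P) (Q ^ M) U ⟩
                Q ^ M * (U * H ^ P)      ∎
              iUH : Invertible (U * H ^ P)
              iUH = invertible-* iU (invertible-^ P H-invertible)
              finish : _ → P ∣ M
              finish (yes P≤M) = ∣m∸n∣n⇒∣m P P≤M (rec M∸P<M (z₁ , d₁) iS iUH
                (*-cancelˡ (x^n≉0 P Q≉0) (trans scaled (begin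
                  Q ^ M * (U * H ^ P)
                    ≡⟨ ≡.cong (λ n → Q ^ n * (U * H ^ P)) (≡.sym (ℕₚ.m+[n∸m]≡n P≤M)) ⟩
                  Q ^ (P ℕ.+ (M ℕ.∸ P)) * (U * H ^ P)
                    ≈⟨ *-congʳ (^-homo-* Q P (M ℕ.∸ P)) ⟩
                  (Q ^ P * Q ^ (M ℕ.∸ P)) * (U * H ^ P)
                    ≈⟨ *-assoc _ _ _ ⟩
                  Q ^ P * (Q ^ (M ℕ.∸ P) * (U * H ^ P)) ∎)))) ∣-refl
                where
                M∸P<M : M ℕ.∸ P ℕ.< M
                M∸P<M = ℕₚ.∸-monoʳ-< {M} {P} {0} (ℕ.>-nonZero⁻¹ P) P≤M
              -- With P > M only qᴹ is cancelled: the invertible U Hᴾ would equal a positive power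
              -- of q times an integral element.
              finish (no P≰M) = contradiction
                (*-cancelˡ (x^n≉0 M Q≉0) (trans (sym scaled) (begin
                  Q ^ P * (r₁ ^ P * S)
                    ≡⟨ ≡.cong (λ n → Q ^ n * (r₁ ^ P * S)) P≡ ⟩
                  Q ^ (M ℕ.+ suc e) * (r₁ ^ P * S)
                    ≈⟨ *-congʳ (^-homo-* Q M (suc e)) ⟩
                  (Q ^ M * Q ^ suc e) * (r₁ ^ P * S)
                    ≈⟨ *-assoc _ _ _ ⟩
                  Q ^ M * (Q ^ suc e * (r₁ ^ P * S)) ∎)))
                (¬invertible-multiple iUH (*-▷ (^-▷ (suc e) Q-▷) rS-▷) (Q^-multiple e rS-▷))
                where
                e = P ℕ.∸ suc M
                P≡ : P ≡ M ℕ.+ suc e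
                P≡ = ≡.trans (≡.sym (ℕₚ.m+[n∸m]≡n (ℕₚ.≰⇒> P≰M))) (≡.sym (ℕₚ.+-suc M e))
                rS-▷ = *-▷ (^-▷ P d₁) (proj₁ (proj₂ iS))

        -- The multiplier S replaces division by invertible elements, which may lead out of ℤ₍q₎[θ].
        record Valuation (y : Carrier) (n : ℕ) : Set (c ⊔ ℓ) where
          constructor valuation
          field
            {S U} : Carrier
            S-inv : Invertible S
            U-inv : Invertible U
            split : S * y ≈ Q ^ n * U

        invertible⇒valuation-0 : ∀ {y} → Invertible y → Valuation y 0
        invertible⇒valuation-0 iy = valuation invertible-1 iy refl

        valuation-resp : ∀ {x y n} → x ≈ y → Valuation x n → Valuation y n
        valuation-resp x≈y (valuation iS iU eq) = valuation iS iU (trans (*-congˡ (sym x≈y)) eq)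

        valuation-* : ∀ {x y k n} → Valuation x k → Valuation y n → Valuation (x * y) (k ℕ.+ n)
        valuation-* {x} {y} {k} {n} (valuation {S} {U} iS iU eq) (valuation {S′} {U′} iS′ iU′ eq′) =
          valuation (invertible-* iS iS′) (invertible-* iU iU′) (begin
            (S * S′) * (x * y)
              ≈⟨ solve 4 (λ s s′ x y → (s :* s′) :* (x :* y) := (s :* x) :* (s′ :* y)) refl S S′ x y ⟩
            (S * x) * (S′ * y)              ≈⟨ *-cong eq eq′ ⟩
            (Q ^ k * U) * (Q ^ n * U′)
              ≈⟨ solve 4 (λ a u b v → (a :* u) :* (b :* v) := (a :* b) :* (u :* v))
                   refl (Q ^ k) U (Q ^ n) U′ ⟩
            (Q ^ k * Q ^ n) * (U * U′)      ≈⟨ *-congʳ (^-homo-* Q k n) ⟨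
            Q ^ (k ℕ.+ n) * (U * U′)        ∎)

        valuation-^ : ∀ {x k} n → Valuation x k → Valuation (x ^ n) (n ℕ.* k)
        valuation-^ zero    vx = invertible⇒valuation-0 invertible-1
        valuation-^ (suc n) vx = valuation-* vx (valuation-^ n vx)

        valuation-∏-0 : ∀ {n} (f : Fin n → Carrier) → (∀ i → Valuation (f i) 0) → Valuation (∏ f) 0
        valuation-∏-0 {zero}  f vf = invertible⇒valuation-0 invertible-1
        valuation-∏-0 {suc n} f vf = valuation-* (vf zero) (valuation-∏-0 (f ∘ suc) (vf ∘ suc))

        valuation-∏-head : ∀ {n k} (f : Fin (suc n) → Carrier) → Valuation (f zero) k →
          (∀ i → Valuation (f (suc i)) 0) → Valuation (∏ f) k
        valuation-∏-head {k = k} f v₀ vf =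
          ≡.subst (Valuation (∏ f)) (ℕₚ.+-identityʳ k) (valuation-* v₀ (valuation-∏-0 (f ∘ suc) vf))

        -- w itself may have q in its denominator. Passing to qᵏ w shifts the valuation of the P-th
        -- power by k P, which does not affect divisibility by P.
        valuation-of-power : ∀ P .{{_ : ℕ.NonZero P}} {w y k n} → Integral (Q ^ k * w) →
          w ^ P ≈ y → Valuation y n → P ∣ n
        valuation-of-power P {w} {y} {k} {n} iw w^P≈y (valuation {S} {U} iS iU eq) =
          ∣m+n∣m⇒∣n (power-valuation P (k ℕ.* P ℕ.+ n) iw iS iU (begin
            (Q ^ k * w) ^ P * S           ≈⟨ *-congʳ (^-distrib-* (Q ^ k) w P) ⟩
            ((Q ^ k) ^ P * w ^ P) * S     ≈⟨ *-congʳ (*-cong (^-assocʳ Q k P) w^P≈y) ⟩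
            (Q ^ (k ℕ.* P) * y) * S
              ≈⟨ solve 3 (λ a y s → (a :* y) :* s := a :* (s :* y)) refl (Q ^ (k ℕ.* P)) y S ⟩
            Q ^ (k ℕ.* P) * (S * y)       ≈⟨ *-congˡ eq ⟩
            Q ^ (k ℕ.* P) * (Q ^ n * U)   ≈⟨ *-assoc _ _ _ ⟨
            (Q ^ (k ℕ.* P) * Q ^ n) * U   ≈⟨ *-congʳ (^-homo-* Q (k ℕ.* P) n) ⟨
            Q ^ (k ℕ.* P ℕ.+ n) * U       ∎))
            (n∣m*n k)

-- A prime q modulo which the minimal polynomial has a root

prime-divisor : ∀ n → ¬ n ≡ 1 → ∃ λ q → Prime q × q ∣ n
prime-divisor zero    n≢1 = 2 , prime[2] , 2 ∣0
prime-divisor (suc n) n≢1 with factorise (suc n)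
... | record { factors = [] ; isFactorisation = n≡1 } = contradiction n≡1 n≢1
... | record { factors = q ∷ qs ; isFactorisation = n≡ ; factorsPrime = q-prime ∷ _ } =
  q , q-prime , ≡.subst (q ∣_) (≡.sym n≡) (m∣m*n (product qs))

-- The value 1 would require 3 (d + 1) z = 2, which the factor 3 is there to exclude; the value -1
-- would require z = 0.
∣3dz-1∣≢1 : ∀ d z → ¬ z ≡ + 0 → ¬ ℤ.∣ (+ (3 ℕ.* suc d)) ℤ.* z ℤ.- + 1 ∣ ≡ 1
∣3dz-1∣≢1 d z z≢0 eq = cases ((+ (3 ℕ.* suc d)) ℤ.* z ℤ.- + 1) ≡.refl eq
  where
  D = + (3 ℕ.* suc d)
  3∣D : + 3 ℤ∣.∣ D
  3∣D = ℤ∣.∣ᵤ⇒∣ {+ 3} {D} (m∣m*n (suc d))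
  cancel : ∀ w → D ℤ.* z ℤ.- + 1 ≡ w → D ℤ.* z ≡ w ℤ.+ + 1
  cancel w e = ≡.trans (lemma (D ℤ.* z)) (≡.cong (ℤ._+ + 1) e)
    where
    lemma : ∀ x → x ≡ x ℤ.- + 1 ℤ.+ + 1
    lemma = ℤ-solve-∀
  cases : ∀ w → D ℤ.* z ℤ.- + 1 ≡ w → ¬ ℤ.∣ w ∣ ≡ 1
  cases (+ 1) e ≡.refl with ℤ∣.∣⇒∣ᵤ (≡.subst (+ 3 ℤ∣.∣_) (cancel (+ 1) e) (ℤ∣.∣m⇒∣m*n z 3∣D))
  ... | 3∣2 = 3∤2 3∣2
    where
    3∤2 : ¬ 3 ∣ 2
    3∤2 3∣2 with ∣⇒≤ 3∣2
    ... | s≤s (s≤s ())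
  cases -[1+ 0 ] e ≡.refl = z≢0 (ℤₚ.*-cancelˡ-≡ D z (+ 0)
    (≡.trans (cancel -[1+ 0 ] e) (≡.sym (ℤₚ.*-zeroʳ D))))

module SplitPrime {c ℓ} (Ω : AlgebraicClosureOfℚ c ℓ) where
  open AlgebraicClosureOfℚ Ω hiding (zero)
  open IntegerImage commutativeRing
  open FieldTools commutativeRing isField
  open Rationals Ω
  open SetoidReasoning setoid

  integers : Subring ℓ
  integers = record
    { Elem       = λ x → ∃ λ i → x ≈ ι i
    ; resp′      = λ { x≈y (i , eq) → i , trans (sym x≈y) eq }
    ; 0-closed′  = + 0 , refl
    ; 1-closed′  = + 1 , refl
    ; +-closed′  = λ { (i , p) (j , q) → i ℤ.+ j , trans (+-cong p q) (sym (ι-+ i j)) }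
    ; *-closed′  = λ { (i , p) (j , q) → i ℤ.* j , trans (*-cong p q) (sym (ι-* i j)) }
    ; neg-closed′ = λ { (i , p) → ℤ.- i , trans (-‿cong p) (sym (ι-neg i)) }
    }
  open Subring integers using (*-closed′; +-closed′; neg-closed′; ^-closed)

  -- A polynomial of degree m with m + 1 distinct roots has only zero coefficients, but the leading
  -- one is 1. The search among finitely many points is decidable.
  nonroot : ∀ {m} (a : Fin m → Carrier) (x : Fin (suc m) → Carrier) → Distinct x →
    ∃ λ k → ¬ x k ^ m - ev a (x k) ≈ 0#
  nonroot {m} a x x-distinct = Finₚ.¬∀⟶∃¬ (suc m) _ (λ k → (x k ^ m - ev a (x k)) ≟ 0#) λ roots →
    1≉0 (trans (sym (monic-last (λ i → - 1# * a i)))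
      (roots⇒≈0 (monic (λ i → - 1# * a i)) x x-distinct
        (λ k → trans (ev-monic (λ i → - 1# * a i) (x k))
                 (trans (+-congˡ (trans (ev-*ˡ (- 1#) a (x k))
                   (solve 1 (λ x → :- con (+ 1) :* x := :- x) refl (ev a (x k))))) (roots k)))
        (fromℕ m)))

  record RootModPrime {m} (D : ℕ) (coeff : Fin (suc m) → Carrier) : Set (c ⊔ ℓ) where
    field
      q       : ℕ
      q-prime : Prime q
      q∤D     : q ∤ D
      t       : Carrier
    open Localization q q-prime
    field
      t-local : t ∈ Local
      t-root  : t ^ suc m ∼ ev coeff t

  -- With C = D c₀ the value of D h at 3 D C s is C (3 D s v - 1) for some integer v,
  -- and a prime divisor of 3 D s v - 1 cannot divide D.
  root-mod-prime : ∀ {m} d (coeff : Fin (suc m) → Carrier) → ¬ coeff zero ≈ 0# →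
    (∀ i → Clears (suc d) (coeff i)) → RootModPrime (suc d) coeff
  root-mod-prime {m} d coeff c₀≉0 clears = found (nonroot (coeff ∘ suc) x x-distinct)
    where
    D = ⟪ suc d ⟫
    C : Fin (suc m) → ℤ
    C i = proj₁ (clears i)
    3D = + (3 ℕ.* suc d)
    X : Fin (suc m) → ℤ
    X k = C zero ℤ.* (3D ℤ.* (+ suc (toℕ k)))
    x : Fin (suc m) → Carrier
    x k = ι (X k)

    C₀≢0 : ¬ C zero ≡ + 0
    C₀≢0 C₀≡0 = x*y≉0 (⟪suc⟫≉0 d) c₀≉0 (trans (proj₂ (clears zero)) (reflexive (≡.cong ι C₀≡0)))

    x-distinct : Distinct x
    x-distinct i j eq = Finₚ.toℕ-injective (ℕₚ.suc-injective (ℤₚ.+-injective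
      (ℤₚ.*-cancelˡ-≡ 3D (+ suc (toℕ i)) (+ suc (toℕ j))
        (ℤₚ.*-cancelˡ-≡ (C zero) _ _ {{ℤ.≢-nonZero C₀≢0}} (ι-injective (X i) (X j) eq)))))

    found : (∃ λ k → ¬ x k ^ m - ev (coeff ∘ suc) (x k) ≈ 0#) → RootModPrime (suc d) coeff
    found (k , g≉0) = conclude integral
      where
      t = x k
      s = + suc (toℕ k)
      -- The polynomial h is X G - c₀, and g is the value G(t). Its being nonzero is what keeps 3 D
      -- s v - 1 different from -1.
      g = t ^ m - ev (coeff ∘ suc) t

      Dg≈ : D * g ≈ D * t ^ m - ev (ι ∘ C ∘ suc) t
      Dg≈ = begin
        D * (t ^ m - ev (coeff ∘ suc) t)
          ≈⟨ solve 3 (λ d p e → d :* (p :- e) := d :* p :- d :* e) refl D (t ^ m) (ev (coeff ∘ suc) t) ⟩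
        D * t ^ m - D * ev (coeff ∘ suc) t
          ≈⟨ +-congˡ (-‿cong (sym (ev-*ˡ D (coeff ∘ suc) t))) ⟩
        D * t ^ m - ev (λ i → D * coeff (suc i)) t
          ≈⟨ +-congˡ (-‿cong (ev-cong (λ i → proj₂ (clears (suc i))) refl)) ⟩
        D * t ^ m - ev (ι ∘ C ∘ suc) t ∎

      integral : ∃ λ v → D * g ≈ ι v
      integral = Subring.resp′ integers (sym Dg≈)
        (+-closed′ (*-closed′ (+ suc d , refl) (^-closed m (X k , refl)))
          (neg-closed′ (ev-closed integers (ι ∘ C ∘ suc) (λ i → C (suc i) , refl) (X k , refl))))

      conclude : (∃ λ v → D * g ≈ ι v) → RootModPrime (suc d) coeff
      conclude (v , Dg≈v) = divisor (prime-divisor ℤ.∣ w ∣ (∣3dz-1∣≢1 d (s ℤ.* v) sv≢0))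
        where
        w = 3D ℤ.* (s ℤ.* v) ℤ.- + 1

        v≢0 : ¬ v ≡ + 0
        v≢0 ≡.refl = x*y≉0 (⟪suc⟫≉0 d) g≉0 Dg≈v

        sv≢0 : ¬ s ℤ.* v ≡ + 0
        sv≢0 sv≡0 = v≢0 (ℤₚ.*-cancelˡ-≡ s v (+ 0) (≡.trans sv≡0 (≡.sym (ℤₚ.*-zeroʳ s))))

        Dh≈ : D * (t ^ suc m - ev coeff t) ≈ ι (C zero ℤ.* w)
        Dh≈ = begin
          D * (t * t ^ m - (coeff zero + t * ev (coeff ∘ suc) t))
            ≈⟨ solve 5 (λ d t p c e → d :* (t :* p :- (c :+ t :* e)) := t :* (d :* (p :- e)) :- d :* c)
                 refl D t (t ^ m) (coeff zero) (ev (coeff ∘ suc) t) ⟩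
          t * (D * g) - D * coeff zero
            ≈⟨ +-cong (*-congˡ Dg≈v) (-‿cong (proj₂ (clears zero))) ⟩
          ι (X k) * ι v - ι (C zero)
            ≈⟨ +-cong (ι-* (X k) v) (ι-neg (C zero)) ⟨
          ι (X k ℤ.* v) + ι (ℤ.- C zero)
            ≈⟨ ι-+ (X k ℤ.* v) (ℤ.- C zero) ⟨
          ι (X k ℤ.* v ℤ.+ ℤ.- C zero)
            ≡⟨ ≡.cong ι (lemma (C zero) 3D s v) ⟩
          ι (C zero ℤ.* w) ∎
          where
          lemma : ∀ c e s v → c ℤ.* (e ℤ.* s) ℤ.* v ℤ.+ ℤ.- c ≡ c ℤ.* (e ℤ.* (s ℤ.* v) ℤ.- + 1)
          lemma = ℤ-solve-∀

        divisor : (∃ λ q → Prime q × q ∣ ℤ.∣ w ∣) → RootModPrime (suc d) coeff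
        divisor (q , q-prime , q∣w) = record
          { q = q ; q-prime = q-prime ; q∤D = q∤D ; t = t ; t-local = local-ι (X k)
          ; t-root = multiple (ℤ∣.∣ᵤ⇒∣ {+ q} {w} q∣w) (inverse D (⟪suc⟫≉0 d)) }
          where
          open Localization q q-prime
          q∤D : q ∤ suc d
          q∤D q∣D = q∤1 (ℤ∣.∣⇒∣ᵤ (≡.subst (+ q ℤ∣.∣_) (lemma (3D ℤ.* (s ℤ.* v)))
            (ℤ∣.∣m∣n⇒∣m-n
              (ℤ∣.∣m⇒∣m*n (s ℤ.* v) (ℤ∣.∣ᵤ⇒∣ {+ q} {3D} (∣n⇒∣m*n 3 q∣D)))
              (ℤ∣.∣ᵤ⇒∣ {+ q} {w} q∣w))))
            where
            lemma : ∀ x → x ℤ.- (x ℤ.- + 1) ≡ + 1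
            lemma = ℤ-solve-∀
          multiple : + q ℤ∣.∣ w → (∃ λ y → D * y ≈ 1#) → Multiple (t ^ suc m - ev coeff t)
          multiple (ℤ∣.divides e w≡eq) (y , Dy≈1) =
            ι (C zero ℤ.* e) * y ,
            (suc d , q∤D , C zero ℤ.* e , (begin
              D * (ι (C zero ℤ.* e) * y)
                ≈⟨ solve 3 (λ d a y → d :* (a :* y) := a :* (d :* y)) refl D (ι (C zero ℤ.* e)) y ⟩
              ι (C zero ℤ.* e) * (D * y)     ≈⟨ *-congˡ Dy≈1 ⟩
              ι (C zero ℤ.* e) * 1#          ≈⟨ *-identityʳ _ ⟩
              ι (C zero ℤ.* e)               ∎)) ,
            (begin
              h                              ≈⟨ *-identityˡ h ⟨
              1# * h                         ≈⟨ *-congʳ Dy≈1 ⟨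
              (D * y) * h
                ≈⟨ solve 3 (λ d y h → (d :* y) :* h := (d :* h) :* y) refl D y h ⟩
              (D * h) * y                    ≈⟨ *-congʳ Dh≈ ⟩
              ι (C zero ℤ.* w) * y
                ≡⟨ ≡.cong (λ i → ι i * y) (≡.trans (≡.cong (C zero ℤ.*_) w≡eq) (lemma (C zero) e (+ q))) ⟩
              ι ((+ q) ℤ.* (C zero ℤ.* e)) * y ≈⟨ *-congʳ (ι-* (+ q) (C zero ℤ.* e)) ⟩
              (Q * ι (C zero ℤ.* e)) * y     ≈⟨ *-assoc _ _ _ ⟩
              Q * (ι (C zero ℤ.* e) * y)     ∎)
            where
            h = t ^ suc m - ev coeff t
            lemma : ∀ c e q → c ℤ.* (e ℤ.* q) ≡ q ℤ.* (c ℤ.* e)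
            lemma = ℤ-solve-∀

-- A set of exponents closed under addition and cancellation is the trace on ℕ of a subgroup of ℤ.
1∈exponents : ∀ {s} (S : Pred ℕ s) → (∀ {a b} → a ∈ S → b ∈ S → a ℕ.+ b ∈ S) →
  (∀ {a b} → a ℕ.+ b ∈ S → a ∈ S → b ∈ S) → ∀ {m n} → Coprime m n → m ∈ S → n ∈ S → 1 ∈ S
1∈exponents S add cancel {m} {n} coprime m∈ n∈ = go (coprime-Bézout coprime)
  where
  multiple : ∀ {m} → m ∈ S → ∀ k → k ℕ.* m ∈ S
  multiple {m} m∈ zero    = cancel {m} (≡.subst S (≡.sym (ℕₚ.+-identityʳ m)) m∈) m∈
  multiple     m∈ (suc k) = add m∈ (multiple m∈ k)
  go : Bézout.Identity 1 m n → 1 ∈ S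
  go (Bézout.+- x y eq) = cancel (≡.subst S (≡.trans (≡.sym eq) (ℕₚ.+-comm 1 (y ℕ.* n))) (multiple m∈ x))
                                 (multiple n∈ y)
  go (Bézout.-+ x y eq) = cancel (≡.subst S (≡.trans (≡.sym eq) (ℕₚ.+-comm 1 (x ℕ.* m))) (multiple n∈ y))
                                 (multiple m∈ x)

-- Any d strictly between 0 and p is coprime to p. This serves both for stabilizers in a cyclic
-- group of order p and for the order of a p-th root of unity.
1∈exponents-prime : ∀ {s} (S : Pred ℕ s) → (∀ {a b} → a ∈ S → b ∈ S → a ℕ.+ b ∈ S) →
  (∀ {a b} → a ℕ.+ b ∈ S → a ∈ S → b ∈ S) →
  ∀ {p d} → Prime p → 0 ℕ.< d → d ℕ.< p → p ∈ S → d ∈ S → 1 ∈ S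
1∈exponents-prime S add cancel p-prime 0<d d<p =
  1∈exponents S add cancel (prime⇒coprime p-prime {{ℕ.>-nonZero 0<d}} d<p)

-- Homomorphisms on generated subfields and orbits of cyclic groups

module Galois {c ℓ} (Ω : AlgebraicClosureOfℚ c ℓ) where
  open AlgebraicClosureOfℚ Ω hiding (zero)
  open FieldTheory Ω
  open FieldTools commutativeRing isField
  open Homs commutativeRing isField
  open SetoidReasoning setoid

  generated-⊆ : ∀ {s t} {S : Pred Carrier s} (E : Subfield t) → S ⊆ Member E → Generated S ⊆ Member E
  generated-⊆ E S⊆E (gen x∈)         = S⊆E x∈
  generated-⊆ E S⊆E (gen-resp x≈y x∈) = resp E x≈y (generated-⊆ E S⊆E x∈)
  generated-⊆ E S⊆E gen-0            = 0-closed E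
  generated-⊆ E S⊆E gen-1            = 1-closed E
  generated-⊆ E S⊆E (gen-+ x∈ y∈)    = +-closed E (generated-⊆ E S⊆E x∈) (generated-⊆ E S⊆E y∈)
  generated-⊆ E S⊆E (gen-* x∈ y∈)    = *-closed E (generated-⊆ E S⊆E x∈) (generated-⊆ E S⊆E y∈)
  generated-⊆ E S⊆E (gen-neg x∈)     = neg-closed E (generated-⊆ E S⊆E x∈)
  generated-⊆ E S⊆E (gen-inv x∈ eq)  = inv-closed E (generated-⊆ E S⊆E x∈) eq

  ℚ⊆ : ∀ {t} (E : Subfield t) → Member ℚ-field ⊆ Member E
  ℚ⊆ E = generated-⊆ E λ ()

  module _ {s t} {S : Pred Carrier s} (E : Subfield t) (g h : Hom (subring E))
    (S⊆E : S ⊆ Member E) where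
    open Hom

    agree-on-generated :
      (∀ {x} → x ∈ S → (x∈ : x ∈ Member E) → map g (x , x∈) ≈ map h (x , x∈)) →
      ∀ {x} → Generated S x → (x∈ : x ∈ Member E) → map g (x , x∈) ≈ map h (x , x∈)
    agree-on-generated agree = go
      where
      ⊆E = generated-⊆ {S = S} E S⊆E
      go : ∀ {x} → Generated S x → (x∈ : x ∈ Member E) → map g (x , x∈) ≈ map h (x , x∈)
      go (gen x∈S) x∈ = agree x∈S x∈
      go (gen-resp x≈y x∈S) x∈ =
        trans (cong g (sym x≈y)) (trans (go x∈S (⊆E x∈S)) (cong h x≈y))
      go gen-0 x∈ = trans (map-0 g refl) (sym (map-0 h refl))
      go gen-1 x∈ = trans (map-1 g refl) (sym (map-1 h refl))
      go (gen-+ {x} {y} x∈S y∈S) _ =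
        trans (map-+ g {x , ⊆E x∈S} {y , ⊆E y∈S} refl)
          (trans (+-cong (go x∈S _) (go y∈S _)) (sym (map-+ h refl)))
      go (gen-* {x} {y} x∈S y∈S) _ =
        trans (map-* g {x , ⊆E x∈S} {y , ⊆E y∈S} refl)
          (trans (*-cong (go x∈S _) (go y∈S _)) (sym (map-* h refl)))
      go (gen-neg {x} x∈S) _ =
        trans (map-neg g {x , ⊆E x∈S} refl) (trans (-‿cong (go x∈S _)) (sym (map-neg h refl)))
      -- Both images of y are inverse to the common image of x, which is nonzero and can be
      -- cancelled.
      go (gen-inv {x} {y} x∈S xy≈1) y∈ = *-cancelˡ (map-≉0 E g x≉0) (begin
        map g (x , x∈) * map g (y , y∈)   ≈⟨ map-* g {x , x∈} {y , y∈} refl ⟨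
        map g (x * y , xy∈)               ≈⟨ map-1 g xy≈1 ⟩
        1#                                ≈⟨ map-1 h {x * y , xy∈} xy≈1 ⟨
        map h (x * y , xy∈)               ≈⟨ map-* h {x , x∈} {y , y∈} refl ⟩
        map h (x , x∈) * map h (y , y∈)   ≈⟨ *-congʳ (go x∈S x∈) ⟨
        map g (x , x∈) * map h (y , y∈)   ∎)
        where
        x∈ = ⊆E x∈S
        xy∈ = *-closed E x∈ y∈
        x≉0 : ¬ x ≈ 0#
        x≉0 x≈0 = 1≉0 (trans (sym xy≈1) (trans (*-congʳ x≈0) (zeroˡ y)))

  inclusion-hom : ∀ {t} (E : Subfield t) → Hom (subring E)
  inclusion-hom E = record
    { map = proj₁ ; cong = λ eq → eq ; +-homo = λ _ _ → refl ; *-homo = λ _ _ → refl ; 1-homo = refl }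

  -- The prime field has no generators, so there is nothing to check for agreement with the
  -- inclusion.
  map-rational : ∀ {t} (E : Subfield t) (g : Hom (subring E)) {x} → x ∈ Member ℚ-field →
    (x∈ : x ∈ Member E) → Hom.map g (x , x∈) ≈ x
  map-rational E g = agree-on-generated {S = ∅} E g (inclusion-hom E) (λ ()) λ ()

  conjugate-root : ∀ {t} (E : Subfield t) (g : Hom (subring E)) {n} (r : Fin n → Carrier) →
    (∀ i → r i ∈ Member ℚ-field) → ∀ x → ev r (proj₁ x) ≈ 0# → ev r (Hom.map g x) ≈ 0#
  conjugate-root E g r r∈ x eq = begin
    ev r (map x)                                  ≈⟨ ev-cong (λ i → map-rational E g (r∈ i) _) refl ⟨
    ev (λ i → map (r i , ℚ⊆ E (r∈ i))) (map x)    ≈⟨ map-ev (λ i → r i , ℚ⊆ E (r∈ i)) {x} {_ , 0-closed E} (sym eq) ⟨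
    map (0# , 0-closed E)                         ≈⟨ map-0 refl ⟩
    0#                                            ∎
    where open Hom g

  module _ {t} (E : Subfield t) {f : ⟨ E ⟩ → Carrier} where

    monomorphism⇒hom : IsRingMonomorphism (rawRing-of E) rawRing f → Hom (subring E)
    monomorphism⇒hom mono = record
      { map = f ; cong = ⟦⟧-cong ; +-homo = +-homo ; *-homo = *-homo ; 1-homo = 1#-homo }
      where open IsRingMonomorphism mono

  hom⇒monomorphism : ∀ {t} (E : Subfield t) (g : Hom (subring E)) →
    IsRingMonomorphism (rawRing-of E) rawRing (Hom.map g)
  hom⇒monomorphism E g = record
    { isRingHomomorphism = record
      { isSemiringHomomorphism = record
        { isNearSemiringHomomorphism = record
          { +-isMonoidHomomorphism = record
            { isMagmaHomomorphism = record
              { isRelHomomorphism = record { cong = cong } ; homo = +-homo }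
            ; ε-homo = map-0 refl
            }
          ; *-homo = *-homo
          }
        ; 1#-homo = 1-homo
        }
      ; -‿homo = λ x → map-neg {x} refl
      }
    ; injective = map-injective E g
    }
    where open Hom g

  module Iteration {s t} {k : Subfield s} {E : Subfield t} (σ : Automorphism k E) where
    open Automorphism σ

    iterated-isRingIsomorphism : ∀ j → IsRingIsomorphism (rawRing-of E) (rawRing-of E) (iterated j)
    iterated-isRingIsomorphism zero    = Identity.isRingIsomorphism (rawRing-of E) refl
    iterated-isRingIsomorphism (suc j) =
      Composition.isRingIsomorphism trans (iterated-isRingIsomorphism j) isRingIsomorphism

    iterated-fixes : ∀ j x → proj₁ x ∈ Member k → proj₁ (iterated j x) ≈ proj₁ x
    iterated-fixes zero    x x∈k = refl
    iterated-fixes (suc j) x x∈k = trans (fixes _ (resp k (sym eq) x∈k)) eq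
      where eq = iterated-fixes j x x∈k

    iterated-automorphism : ℕ → Automorphism k E
    iterated-automorphism j = record
      { map = iterated j ; isRingIsomorphism = iterated-isRingIsomorphism j ; fixes = iterated-fixes j }

    power : ℕ → Hom (subring E)
    power j = record
      { map = λ x → proj₁ (iterated j x) ; cong = ⟦⟧-cong ; +-homo = +-homo
      ; *-homo = *-homo ; 1-homo = 1#-homo }
      where open IsRingIsomorphism (iterated-isRingIsomorphism j)

    iterated-+ : ∀ a b x → iterated (a ℕ.+ b) x ≡ iterated a (iterated b x)
    iterated-+ zero    b x = ≡.refl
    iterated-+ (suc a) b x = ≡.cong map (iterated-+ a b x)

    iterated-injective : ∀ j {x y} → proj₁ (iterated j x) ≈ proj₁ (iterated j y) → proj₁ x ≈ proj₁ y
    iterated-injective j {x} {y} = map-injective E (power j) {x} {y}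

    module _ {n} (cyclic : CyclicGenerator k E (suc n) σ) where
      open CyclicGenerator cyclic

      -- σⁿ⁺¹ is one of the listed powers. If it were σⁱ⁺¹ with i < n, cancellation would give σⁿ⁻ⁱ
      -- = 1 with 0 < n - i ≤ n, against distinctness.
      iterated-order : ∀ x → proj₁ (iterated (suc n) x) ≈ proj₁ x
      iterated-order = go (generates (iterated-automorphism (suc n)))
        where
        go : (∃ λ (i : Fin (suc n)) → ∀ x →
                proj₁ (iterated (suc n) x) ≈ proj₁ (iterated (toℕ i) x)) →
             ∀ x → proj₁ (iterated (suc n) x) ≈ proj₁ x
        go (zero  , eq) = eq
        go (suc i , eq) = contradiction (distinct (fromℕ< r<) zero same) (λ e → r≢0
          (≡.trans (≡.sym (Finₚ.toℕ-fromℕ< r<)) (≡.cong toℕ e)))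
          where
          r = n ℕ.∸ toℕ i
          i<n : toℕ i ℕ.< n
          i<n = Finₚ.toℕ<n i
          r< : r ℕ.< suc n
          r< = ℕ.s≤s (ℕₚ.m∸n≤m n (toℕ i))
          r≢0 : ¬ r ≡ 0
          r≢0 = ℕₚ.m>n⇒m∸n≢0 i<n
          same : ∀ x → proj₁ (iterated (toℕ (fromℕ< r<)) x) ≈ proj₁ x
          same x = begin
            proj₁ (iterated (toℕ (fromℕ< r<)) x)
              ≡⟨ ≡.cong (λ j → proj₁ (iterated j x)) (Finₚ.toℕ-fromℕ< r<) ⟩
            proj₁ (iterated r x)
              ≈⟨ iterated-injective (suc (toℕ i)) (begin
                   proj₁ (iterated (suc (toℕ i)) (iterated r x))
                     ≡⟨ ≡.cong proj₁ (iterated-+ (suc (toℕ i)) r x) ⟨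
                   proj₁ (iterated (suc (toℕ i) ℕ.+ r) x)
                     ≡⟨ ≡.cong (λ j → proj₁ (iterated (suc j) x)) (ℕₚ.m+[n∸m]≡n (ℕₚ.<⇒≤ i<n)) ⟩
                   proj₁ (iterated (suc n) x)
                     ≈⟨ eq x ⟩
                   proj₁ (iterated (suc (toℕ i)) x) ∎) ⟩
            proj₁ x ∎

      private
        module Orbit (n-prime : Prime (suc n)) (x : ⟨ E ⟩) (moved : ¬ proj₁ (map x) ≈ proj₁ x) where
          Fixes : Pred ℕ ℓ
          Fixes a = proj₁ (iterated a x) ≈ proj₁ x

          add : ∀ a b → Fixes a → Fixes b → Fixes (a ℕ.+ b)
          add a b fa fb = trans (reflexive (≡.cong proj₁ (iterated-+ a b x)))
                                (trans (Hom.cong (power a) fb) fa)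

          cancel : ∀ a b → Fixes (a ℕ.+ b) → Fixes a → Fixes b
          cancel a b fab fa = iterated-injective a
            (trans (reflexive (≡.cong proj₁ (≡.sym (iterated-+ a b x)))) (trans fab (sym fa)))

          separated : ∀ {i j : Fin (suc n)} → i Fin.< j →
            ¬ proj₁ (iterated (toℕ i) x) ≈ proj₁ (iterated (toℕ j) x)
          separated {i} {j} i<j eq = moved
            (1∈exponents-prime Fixes (λ {a} {b} → add a b) (λ {a} {b} → cancel a b) n-prime
              (ℕₚ.m<n⇒0<n∸m i<j) (ℕₚ.≤-<-trans (ℕₚ.m∸n≤m (toℕ j) (toℕ i)) (Finₚ.toℕ<n j))
              (iterated-order x)
              (iterated-injective (toℕ i) (begin
                proj₁ (iterated (toℕ i) (iterated (toℕ j ℕ.∸ toℕ i) x))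
                  ≡⟨ ≡.cong proj₁ (iterated-+ (toℕ i) (toℕ j ℕ.∸ toℕ i) x) ⟨
                proj₁ (iterated (toℕ i ℕ.+ (toℕ j ℕ.∸ toℕ i)) x)
                  ≡⟨ ≡.cong (λ a → proj₁ (iterated a x)) (ℕₚ.m+[n∸m]≡n (ℕₚ.<⇒≤ i<j)) ⟩
                proj₁ (iterated (toℕ j) x)
                  ≈⟨ eq ⟨
                proj₁ (iterated (toℕ i) x) ∎)))

      -- Two equal members of the orbit give an exponent strictly between 0 and the prime order
      -- which fixes x. Then the exponent 1 fixes x as well.
      orbit-distinct : Prime (suc n) → ∀ x → ¬ proj₁ (map x) ≈ proj₁ x →
        Distinct {suc n} (λ i → proj₁ (iterated (toℕ i) x))
      orbit-distinct n-prime x moved i j eq with Finₚ.<-cmp i j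
      ... | tri< i<j _ _ = contradiction eq (separated i<j)
        where
        open Orbit n-prime x moved
      ... | tri≈ _ i≡j _ = i≡j
      ... | tri> _ _ j<i = contradiction (sym eq) (separated j<i)
        where
        open Orbit n-prime x moved

-- Double sums, and roots of unity of prime order

module DoubleSum {c ℓ} (R : CommutativeRing c ℓ) where
  open CommutativeRing R hiding (zero)
  open BigOp +-commutativeMonoid using () renaming (sum to ∑)

  ∑-++ : ∀ m {n} (g : Fin (m ℕ.+ n) → Carrier) → ∑ g ≈ ∑ (λ i → g (i ↑ˡ n)) + ∑ (λ k → g (m ↑ʳ k))
  ∑-++ zero    g = sym (+-identityˡ _)
  ∑-++ (suc m) g = trans (+-congˡ (∑-++ m (g ∘ suc))) (sym (+-assoc _ _ _))

  ∑-combine : ∀ m {n} (g : Fin (m ℕ.* n) → Carrier) → ∑ g ≈ ∑ (λ j → ∑ (λ i → g (combine {m} {n} j i)))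
  ∑-combine zero        g = refl
  ∑-combine (suc m) {n} g = trans (∑-++ n g) (+-congˡ (∑-combine m (λ k → g (n ↑ʳ k))))

module RootsOfUnity {c ℓ} (R : CommutativeRing c ℓ) (isField : IsField R) where
  open CommutativeRing R hiding (zero)
  open IsField isField
  open IntegerImage R
  open FieldTools R isField
  open Exp semiring using (_^_; ^-homo-*; ^-congˡ)
  open ExpProperties commutativeSemiring using (^-assocʳ)
  open SetoidReasoning setoid

  1^n≈1 : ∀ n → 1# ^ n ≈ 1#
  1^n≈1 zero    = refl
  1^n≈1 (suc n) = trans (*-identityˡ _) (1^n≈1 n)

  geometric : ∀ n x → (x - 1#) * ev {n} (λ _ → 1#) x ≈ x ^ n - 1#
  geometric zero    x = solve 1 (λ x → (x :- con (+ 1)) :* con (+ 0) := con (+ 1) :- con (+ 1)) refl x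
  geometric (suc n) x = begin
    (x - 1#) * (1# + x * ev {n} (λ _ → 1#) x)
      ≈⟨ solve 2 (λ x e → (x :- con (+ 1)) :* (con (+ 1) :+ x :* e)
                    := (x :- con (+ 1)) :+ x :* ((x :- con (+ 1)) :* e)) refl x _ ⟩
    (x - 1#) + x * ((x - 1#) * ev {n} (λ _ → 1#) x)
      ≈⟨ +-congˡ (*-congˡ (geometric n x)) ⟩
    (x - 1#) + x * (x ^ n - 1#)
      ≈⟨ solve 2 (λ x p → (x :- con (+ 1)) :+ x :* (p :- con (+ 1)) := x :* p :- con (+ 1))
           refl x (x ^ n) ⟩
    x ^ suc n - 1# ∎

  -- The relation 1 + x + ... + xⁿ = 0, solved for xⁿ. It provides a monic equation of degree p - 1
  -- for ζ.
  cyclotomic-root : ∀ n {x} → x ^ suc n ≈ 1# → ¬ x ≈ 1# → x ^ n ≈ ev {n} (λ _ → - 1#) x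
  cyclotomic-root n {x} x^≈1 x≉1 = *-cancelˡ (λ eq → x≉1 (x-y≈0⇒x≈y eq)) (begin
    (x - 1#) * x ^ n
      ≈⟨ solve 2 (λ x p → (x :- con (+ 1)) :* p := x :* p :- p) refl x (x ^ n) ⟩
    x ^ suc n - x ^ n
      ≈⟨ +-congʳ x^≈1 ⟩
    1# - x ^ n
      ≈⟨ solve 1 (λ p → con (+ 1) :- p := :- con (+ 1) :* (p :- con (+ 1))) refl (x ^ n) ⟩
    - 1# * (x ^ n - 1#)
      ≈⟨ *-congˡ (geometric n x) ⟨
    - 1# * ((x - 1#) * ev {n} (λ _ → 1#) x)
      ≈⟨ solve 2 (λ y e → :- con (+ 1) :* (y :* e) := y :* (:- con (+ 1) :* e)) refl (x - 1#) _ ⟩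
    (x - 1#) * (- 1# * ev {n} (λ _ → 1#) x)
      ≈⟨ *-congˡ (ev-*ˡ {n} (- 1#) (λ _ → 1#) x) ⟨
    (x - 1#) * ev {n} (λ _ → - 1# * 1#) x
      ≈⟨ *-congˡ (ev-cong {n} (λ _ → *-identityʳ (- 1#)) refl) ⟩
    (x - 1#) * ev {n} (λ _ → - 1#) x ∎)

  x^n≈1⇒x≉0 : ∀ n {x} → x ^ suc n ≈ 1# → ¬ x ≈ 0#
  x^n≈1⇒x≉0 n {x} eq x≈0 = 1≉0 (trans (sym eq) (trans (*-congʳ x≈0) (zeroˡ _)))

  -- The powers of u are n + 1 distinct roots of Xⁿ⁺¹ - 1, hence all of them. Applied to a
  -- nontrivial root of unity in F, this puts ζ into F.
  powers-exhaust : ∀ n → Prime (suc n) → ∀ {u x} → u ^ suc n ≈ 1# → ¬ u ≈ 1# →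
    x ^ suc n ≈ 1# → ∃ λ k → x ≈ u ^ k
  powers-exhaust n p-prime {u} {x} u^≈1 u≉1 x^≈1 =
    toℕ (proj₁ hit) , x-y≈0⇒x≈y (proj₂ hit)
    where
    a : Fin (suc n) → Carrier
    a zero    = - 1#
    a (suc i) = 0#
    ev-a : ∀ y → ev (monic a) y ≈ y ^ suc n - 1#
    ev-a y = trans (ev-monic a y) (+-congˡ (trans
      (+-congˡ (trans (*-congˡ (ev≈0 (a ∘ suc) y (λ _ → refl))) (zeroʳ y))) (+-identityʳ _)))
    Fixes : Pred ℕ ℓ
    Fixes k = u ^ k ≈ 1#
    separated : ∀ {i j : Fin (suc n)} → i Fin.< j → ¬ u ^ toℕ i ≈ u ^ toℕ j
    separated {i} {j} i<j eq = u≉1 (trans (sym (*-identityʳ u))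
      (1∈exponents-prime Fixes
        (λ {a} {b} fa fb → trans (^-homo-* u a b) (trans (*-cong fa fb) (*-identityˡ 1#)))
        (λ {a} {b} fab fa → trans (sym (*-identityˡ _)) (trans (*-congʳ (sym fa))
                              (trans (sym (^-homo-* u a b)) fab)))
        p-prime (ℕₚ.m<n⇒0<n∸m i<j) (ℕₚ.≤-<-trans (ℕₚ.m∸n≤m (toℕ j) (toℕ i)) (Finₚ.toℕ<n j))
        u^≈1
        (*-cancelˡ (x^n≉0 (toℕ i) (x^n≈1⇒x≉0 n u^≈1)) (begin
          u ^ toℕ i * u ^ (toℕ j ℕ.∸ toℕ i)   ≈⟨ ^-homo-* u (toℕ i) _ ⟨
          u ^ (toℕ i ℕ.+ (toℕ j ℕ.∸ toℕ i))   ≡⟨ ≡.cong (u ^_) (ℕₚ.m+[n∸m]≡n (ℕₚ.<⇒≤ i<j)) ⟩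
          u ^ toℕ j                           ≈⟨ eq ⟨
          u ^ toℕ i                           ≈⟨ *-identityʳ _ ⟨
          u ^ toℕ i * 1#                      ∎))))
    distinct : Distinct {suc n} (λ k → u ^ toℕ k)
    distinct i j eq with Finₚ.<-cmp i j
    ... | tri< i<j _ _ = contradiction eq (separated i<j)
    ... | tri≈ _ i≡j _ = i≡j
    ... | tri> _ _ j<i = contradiction (sym eq) (separated j<i)
    roots : ∀ i → ev (monic a) (u ^ toℕ i) ≈ 0#
    roots i = trans (ev-a (u ^ toℕ i)) (x≈y⇒x-y≈0 (begin
      (u ^ toℕ i) ^ suc n        ≈⟨ ^-assocʳ u (toℕ i) (suc n) ⟩
      u ^ (toℕ i ℕ.* suc n)      ≡⟨ ≡.cong (u ^_) (ℕₚ.*-comm (toℕ i) (suc n)) ⟩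
      u ^ (suc n ℕ.* toℕ i)      ≈⟨ ^-assocʳ u (suc n) (toℕ i) ⟨
      (u ^ suc n) ^ toℕ i        ≈⟨ ^-congˡ (toℕ i) u^≈1 ⟩
      1# ^ toℕ i                 ≈⟨ 1^n≈1 (toℕ i) ⟩
      1#                         ∎))
    hit : ∃ λ (k : Fin (suc n)) → x - u ^ toℕ k ≈ 0#
    hit = ∏≈0⇒∃≈0 (λ k → x - u ^ toℕ k) (x*y≈0⇒y≈0
      (λ eq → 1≉0 (trans (sym (monic-last a)) eq))
      (trans (sym (factorisation (monic a) (λ k → u ^ toℕ k) distinct roots x))
        (trans (ev-a x) (x≈y⇒x-y≈0 x^≈1))))

-- Extending homomorphisms from F to L = F(ζ)

module CyclotomicExtension {c ℓ f} (Ω : AlgebraicClosureOfℚ c ℓ)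
  (F : Subfields.Subfield (AlgebraicClosureOfℚ.commutativeRing Ω) f)
  (ζ : AlgebraicClosureOfℚ.Carrier Ω) where
  open AlgebraicClosureOfℚ Ω hiding (zero)
  open FieldTheory Ω
  open IntegerImage commutativeRing
  open FieldTools commutativeRing isField
  open Homs commutativeRing isField
  open Spans commutativeRing isField
  open Galois Ω
  open SetoidReasoning setoid

  L : Subfield (c ⊔ ℓ ⊔ f)
  L = compositum F ℚ⟨ ζ ⟩

  F⊆L : Member F ⊆ Member L
  F⊆L x∈ = gen (inj₁ x∈)

  K⊆L : Member ℚ⟨ ζ ⟩ ⊆ Member L
  K⊆L x∈ = gen (inj₂ x∈)

  ζL : ⟨ L ⟩
  ζL = ζ-in-compositum F ζ

  agree-on-L : (g h : Hom (subring L)) →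
    (∀ {x} → x ∈ Member F → (x∈ : x ∈ Member L) → Hom.map g (x , x∈) ≈ Hom.map h (x , x∈)) →
    Hom.map g ζL ≈ Hom.map h ζL → ∀ x → Hom.map g x ≈ Hom.map h x
  agree-on-L g h onF onζ (x , x∈) =
    agree-on-generated L g h [ F⊆L , K⊆L ]′
      (λ { (inj₁ y∈F) y∈ → onF y∈F y∈
         ; (inj₂ y∈K) y∈ → agree-on-generated L g h (λ ζ≈z → resp L ζ≈z (proj₂ ζL))
             (λ ζ≈z z∈ → trans (Hom.cong g (sym ζ≈z)) (trans onζ (Hom.cong h ζ≈z))) y∈K y∈ })
      x∈ x∈

  everything : Subring ℓ
  everything = record
    { Elem = λ _ → ⊤ ; resp′ = λ _ _ → tt ; 0-closed′ = tt ; 1-closed′ = tt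
    ; +-closed′ = λ _ _ → tt ; *-closed′ = λ _ _ → tt ; neg-closed′ = λ _ → tt }

  -- For this ideal congruence is equality, and the graph built in `Extension` becomes that of a
  -- homomorphism into the ambient field.
  zeroIdeal : Ideal everything ℓ
  zeroIdeal = record
    { In      = _≈ 0#
    ; In-resp = λ x≈y x≈0 → trans (sym x≈y) x≈0
    ; In-0    = refl
    ; In-+    = λ x≈0 y≈0 → trans (+-cong x≈0 y≈0) (+-identityˡ 0#)
    ; In-neg  = λ x≈0 → trans (-‿cong x≈0) (solve 0 (:- con (+ 0) := con (+ 0)) refl)
    ; In-*    = λ {b} _ x≈0 → trans (*-congˡ x≈0) (zeroʳ b)
    }

  module Degree (m : ℕ) (ζ-root : ζ ^ suc m ≈ ev {suc m} (λ _ → - 1#) ζ)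
    (embedding : Fin (suc m) → Hom (subring L))
    (embedding-F : ∀ j {x} → x ∈ Member F → (x∈ : x ∈ Member L) → Hom.map (embedding j) (x , x∈) ≈ x)
    (embedding-distinct : Distinct (λ j → Hom.map (embedding j) ζL))
    where

    -- The m + 1 embeddings fix F, so a polynomial over F which kills ζ also kills its m + 1
    -- distinct images, while its degree is at most m.
    independent-ζ : (r : Fin (suc m) → ⟨ F ⟩) → ev (proj₁ ∘ r) ζ ≈ 0# → ∀ i → proj₁ (r i) ≈ 0#
    independent-ζ r eq = roots⇒≈0 (proj₁ ∘ r) (λ j → Hom.map (embedding j) ζL) embedding-distinct λ j →
      begin
        ev (proj₁ ∘ r) (Hom.map (embedding j) ζL)
          ≈⟨ ev-cong (λ i → embedding-F j (proj₂ (r i)) (F⊆L (proj₂ (r i)))) refl ⟨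
        ev (λ i → Hom.map (embedding j) (proj₁ (r i) , F⊆L (proj₂ (r i)))) (Hom.map (embedding j) ζL)
          ≈⟨ Hom.map-ev (embedding j) (λ i → proj₁ (r i) , F⊆L (proj₂ (r i))) {ζL} {0# , 0-closed L} (sym eq) ⟨
        Hom.map (embedding j) (0# , 0-closed L)
          ≈⟨ Hom.map-0 (embedding j) refl ⟩
        0# ∎

    minus-one : Fin (suc m) → ⟨ F ⟩
    minus-one _ = - 1# , neg-closed F (1-closed F)

    -- Extends φ to L by ζ ↦ ζ. This is consistent because φ fixes the coefficients -1 in the
    -- equation of ζ.
    module Lift (φ : Hom (subring F)) where
      open Hom φ using () renaming (map to φ-map)

      open Extension zeroIdeal φ (λ _ → tt) m minus-one ζ ζ ζ-root tt
        (x≈y⇒x-y≈0 (trans ζ-root (ev-cong {suc m}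
          (λ _ → sym (trans (Hom.map-neg φ {1# , 1-closed F} {y = minus-one zero} refl) (-‿cong (Hom.map-1 φ refl)))) refl)))
        public
      open Independent independent-ζ public

      -- The domain of the relation is F[ζ]. That it contains all of L comes down to closure under
      -- inverses, which `Generated` adjoins.
      InImage : Pred Carrier (c ⊔ ℓ ⊔ f)
      InImage y = ∃ λ z → y ▷ z

      ev-image : ∀ {n} (x : Fin n → ⟨ F ⟩) {y} → InImage y → InImage (ev (proj₁ ∘ x) y)
      ev-image {zero}  x y∈ = _ , const-▷ (0# , 0-closed F)
      ev-image {suc n} x y∈ = _ , +-▷ (const-▷ (x zero)) (*-▷ (proj₂ y∈) (proj₂ (ev-image (x ∘ suc) y∈)))

      -- From x₀ + y e = 0 with x₀ ≠ 0 the inverse of y is -e / x₀. If x₀ = 0, the relation is first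
      -- divided by y.
      inverse-image : ∀ {n} (x : Fin n → ⟨ F ⟩) {y y′} → InImage y → ev (proj₁ ∘ x) y ≈ 0# →
        (∃ λ i → ¬ proj₁ (x i) ≈ 0#) → y * y′ ≈ 1# → InImage y′
      inverse-image {suc n} x {y} {y′} y∈ eq (i , xᵢ≉0) yy′≈1 = by (proj₁ (x zero) ≟ 0#)
        where
        e = ev (proj₁ ∘ x ∘ suc) y
        y≉0 : ¬ y ≈ 0#
        y≉0 y≈0 = 1≉0 (trans (sym yy′≈1) (trans (*-congʳ y≈0) (zeroˡ y′)))
        by : Dec (proj₁ (x zero) ≈ 0#) → InImage y′
        by (yes x₀≈0) = inverse-image (x ∘ suc) y∈
          (x*y≈0⇒y≈0 y≉0 (trans (sym (trans (+-congʳ x₀≈0) (+-identityˡ _))) eq)) (nonzero i xᵢ≉0) yy′≈1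
          where
          nonzero : ∀ i → ¬ proj₁ (x i) ≈ 0# → ∃ λ i → ¬ proj₁ (x (suc i)) ≈ 0#
          nonzero zero    x₀≉0 = contradiction x₀≈0 x₀≉0
          nonzero (suc i) xᵢ≉0 = i , xᵢ≉0
        by (no x₀≉0) = from-inverse (inverse (proj₁ (x zero)) x₀≉0)
          where
          from-inverse : (∃ λ v → proj₁ (x zero) * v ≈ 1#) → InImage y′
          from-inverse (v , xv≈1) = _ , ▷-resp (sym y′≈) refl
            (scale-▷ (- v , neg-closed F (inv-closed F (proj₂ (x zero)) xv≈1)) (proj₂ (ev-image (x ∘ suc) y∈)))
            where
            x₀ = proj₁ (x zero)
            y′≈ : y′ ≈ - v * e
            y′≈ = begin
              y′                  ≈⟨ *-identityˡ y′ ⟨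
              1# * y′             ≈⟨ *-congʳ xv≈1 ⟨
              (x₀ * v) * y′
                ≈⟨ solve 5 (λ x v y′ y e → (x :* v) :* y′ := v :* (y′ :* (x :+ y :* e)) :- v :* ((y :* y′) :* e))
                     refl x₀ v y′ y e ⟩
              v * (y′ * (x₀ + y * e)) - v * ((y * y′) * e)
                ≈⟨ +-cong (*-congˡ (*-congˡ eq)) (-‿cong (*-congˡ (*-congʳ yy′≈1))) ⟩
              v * (y′ * 0#) - v * (1# * e)
                ≈⟨ solve 3 (λ v y′ e → v :* (y′ :* con (+ 0)) :- v :* (con (+ 1) :* e) := (:- v) :* e)
                     refl v y′ e ⟩
              - v * e             ∎

      -- The m + 2 powers 1, y, ..., yᵐ⁺¹ lie in the span of m + 1 powers of ζ, so y satisfies a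
      -- nontrivial equation over F.
      invert : ∀ {y y′} → InImage y → y * y′ ≈ 1# → InImage y′
      invert {y} {y′} y∈ yy′≈1 = from-relation
        (dependent-vectors F (λ (i : Fin (suc m)) → ζ ^ toℕ i) (λ i → y ^ toℕ i)
          (λ i → coordinates (^-▷ (toℕ i) (proj₂ y∈))))
        where
        coordinates : ∀ {x z} → x ▷ z → InSpan F (λ (i : Fin (suc m)) → ζ ^ toℕ i) x
        coordinates (r , x≈ , _) = proj₁ ∘ r , proj₂ ∘ r , trans x≈ (ev≈∑ (proj₁ ∘ r) ζ)
        from-relation : (∃ λ (x : Fin (suc (suc m)) → Carrier) → (∀ i → x i ∈ Member F) ×
            (∃ λ i → ¬ x i ≈ 0#) × ∑ (λ i → x i * y ^ toℕ i) ≈ 0#) → InImage y′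
        from-relation (x , x∈ , x≢0 , eq) =
          inverse-image (λ i → x i , x∈ i) y∈ (trans (ev≈∑ x y) eq) x≢0 yy′≈1

      generated-image : ∀ {s} {S : Pred Carrier s} → S ⊆ InImage → Generated S ⊆ InImage
      generated-image S⊆ (gen x∈)          = S⊆ x∈
      generated-image S⊆ (gen-resp x≈y x∈) = _ , ▷-resp x≈y refl (proj₂ (generated-image S⊆ x∈))
      generated-image S⊆ gen-0             = _ , const-▷ (0# , 0-closed F)
      generated-image S⊆ gen-1             = _ , 1-▷
      generated-image S⊆ (gen-+ x∈ y∈)     = _ , +-▷ (proj₂ (generated-image S⊆ x∈)) (proj₂ (generated-image S⊆ y∈))
      generated-image S⊆ (gen-* x∈ y∈)     = _ , *-▷ (proj₂ (generated-image S⊆ x∈)) (proj₂ (generated-image S⊆ y∈))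
      generated-image S⊆ (gen-neg x∈)      = _ , neg-▷ (proj₂ (generated-image S⊆ x∈))
      generated-image S⊆ (gen-inv x∈ eq)   = invert (generated-image S⊆ x∈) eq

      total : Member L ⊆ InImage
      total = generated-image λ
        { (inj₁ x∈F) → _ , const-▷ (_ , x∈F)
        ; (inj₂ x∈K) → generated-image (λ ζ≈x → _ , ▷-resp ζ≈x refl θ-▷) x∈K }

      abstract
        value : ⟨ L ⟩ → Carrier
        value x = proj₁ (total (proj₂ x))

        value-▷ : ∀ x → proj₁ x ▷ value x
        value-▷ x = proj₂ (total (proj₂ x))

      value-unique : ∀ x {y z} → y ▷ z → proj₁ x ≈ y → value x ≈ z
      value-unique x d eq = x-y≈0⇒x≈y (▷-functional (value-▷ x) d eq)

      lift : Hom (subring L)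
      lift = record
        { map    = value
        ; cong   = λ {x} {y} eq → value-unique x (value-▷ y) eq
        ; +-homo = λ x y → value-unique _ (+-▷ (value-▷ x) (value-▷ y)) refl
        ; *-homo = λ x y → value-unique _ (*-▷ (value-▷ x) (value-▷ y)) refl
        ; 1-homo = value-unique _ 1-▷ refl
        }

      lift-F : ∀ x {x∈} → value (proj₁ x , x∈) ≈ φ-map x
      lift-F x = value-unique _ (const-▷ x) refl

      lift-ζ : value ζL ≈ ζ
      lift-ζ = value-unique ζL θ-▷ refl

      abstract
        value∈L : (∀ x → φ-map x ∈ Member F) → ∀ x → value x ∈ Member L
        value∈L φ∈F x with value-▷ x
        ... | r , _ , z∼ , _ = resp L (sym (x-y≈0⇒x≈y z∼))
          (ev-closed (subring L) (φ-map ∘ r) (λ i → F⊆L (φ∈F (r i))) (proj₂ ζL))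

∤-^ : ∀ {p e} → Prime p → p ∤ e → ∀ k → p ∤ e ℕ.^ k
∤-^ p-prime p∤e zero    p∣1 = ¬prime[1] (≡.subst Prime (∣1⇒≡1 p∣1) p-prime)
∤-^ p-prime p∤e (suc k) p∣  = [ p∤e , ∤-^ p-prime p∤e k ]′ (euclidsLemma _ _ p-prime p∣)

-- The compositum: conjugations, the primitive element θ and the norm to K

module Compositum {c ℓ f} (Ω : AlgebraicClosureOfℚ c ℓ) (n : ℕ) (p-prime : Prime (suc (suc (suc n))))
  (ζ : AlgebraicClosureOfℚ.Carrier Ω)
  (ζ-primitive : FieldTheory.PrimitiveRootOfUnity Ω (suc (suc (suc n))) ζ)
  (F : Subfields.Subfield (AlgebraicClosureOfℚ.commutativeRing Ω) f)
  (F-cyclic : FieldTheory.IsCyclicExtension Ω (AlgebraicClosureOfℚ.ℚ-field Ω) F (suc (suc (suc n))))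
  (τ : FieldTheory.Automorphism Ω F (CyclotomicExtension.L Ω F ζ))
  (τ-cyclic : FieldTheory.CyclicGenerator Ω F (CyclotomicExtension.L Ω F ζ) (suc (suc n)) τ)
  where
  open AlgebraicClosureOfℚ Ω hiding (zero)
  open FieldTheory Ω
  open IntegerImage commutativeRing
  open FieldTools commutativeRing isField
  open Homs commutativeRing isField
  open Spans commutativeRing isField
  open DoubleSum commutativeRing
  open RootsOfUnity commutativeRing isField
  open Galois Ω
  open CyclotomicExtension Ω F ζ public
  open BigOp +-commutativeMonoid using (sum-cong-≋)
  open BigOp *-commutativeMonoid using ()
    renaming (sum-cong-≋ to ∏-cong; ∑-distrib-+ to ∏-distrib-*)
  open SemiringSum semiring using (*-distribʳ-sum)
  open ExpProperties commutativeSemiring using (^-distrib-*; ^-congˡ; ^-assocʳ)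
  open SetoidReasoning setoid
  open IsCyclicExtension F-cyclic using (cyclic) renaming (generator to σ)
  open HasDegree (IsCyclicExtension.degree F-cyclic) using (basis; spanning)

  m p : ℕ
  m = suc n
  p = suc (suc m)

  module T = Iteration τ
  module S = Iteration σ

  ζ^p≈1 : ζ ^ p ≈ 1#
  ζ^p≈1 = proj₁ ζ-primitive

  ζ≉1 : ¬ ζ ≈ 1#
  ζ≉1 eq = proj₂ ζ-primitive 1 (s≤s z≤n) (s≤s (s≤s z≤n)) (trans (*-identityʳ ζ) eq)

  Z : Fin (suc m) → Carrier
  Z j = Hom.map (T.power (toℕ j)) ζL

  -- The powers of τ fix F, so each is determined by its value at ζ.
  Z-distinct : Distinct Z
  Z-distinct i j eq = CyclicGenerator.distinct τ-cyclic i j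
    (agree-on-L (T.power (toℕ i)) (T.power (toℕ j))
      (λ {x} x∈F x∈ → trans (T.iterated-fixes (toℕ i) (x , x∈) x∈F)
                            (sym (T.iterated-fixes (toℕ j) (x , x∈) x∈F)))
      eq)

  Z^p≈1 : ∀ j → Z j ^ p ≈ 1#
  Z^p≈1 j = trans (sym (Hom.map-^ (T.power (toℕ j)) p {ζL} {1# , 1-closed L} (sym ζ^p≈1)))
                  (Hom.map-1 (T.power (toℕ j)) refl)

  open Degree m (cyclotomic-root (suc m) ζ^p≈1 ζ≉1) (λ j → T.power (toℕ j))
    (λ j {x} x∈F x∈ → T.iterated-fixes (toℕ j) (x , x∈) x∈F) Z-distinct public

  -- An automorphism which fixes a basis over ℚ is the identity, unlike σ. Searching the finite
  -- basis yields an explicit element.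
  moved-basis-element : ∃ λ i → ¬ Hom.map (S.power 1) (basis i) ≈ proj₁ (basis i)
  moved-basis-element = Finₚ.¬∀⟶∃¬ p _ (λ i → Hom.map (S.power 1) (basis i) ≟ proj₁ (basis i)) not-all-fixed
    where
    not-all-fixed : ¬ (∀ i → Hom.map (S.power 1) (basis i) ≈ proj₁ (basis i))
    not-all-fixed fixed = contradiction (CyclicGenerator.distinct cyclic (suc zero) zero σ≈id) λ ()
      where
      open Hom (S.power 1)
      σ≈id : ∀ x → map x ≈ proj₁ x
      σ≈id x = from-coordinates (spanning x)
        where
        from-coordinates : (Σ (Fin p → ⟨ ℚ-field ⟩) λ a →
          proj₁ x ≈ ∑ (λ i → proj₁ (a i) * proj₁ (basis i))) → map x ≈ proj₁ x
        from-coordinates (a , x≈) = begin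
          map x                                      ≈⟨ map-∑ term x≈ ⟩
          ∑ (λ i → map (term i))                     ≈⟨ sum-cong-≋ (λ i → trans
                                                          (map-* {_ , a∈F i} {basis i} {term i} refl)
                                                          (*-cong (S.iterated-fixes 1 (_ , a∈F i) (proj₂ (a i))) (fixed i))) ⟩
          ∑ (λ i → proj₁ (a i) * proj₁ (basis i))    ≈⟨ x≈ ⟨
          proj₁ x                                    ∎
          where
          a∈F : ∀ i → proj₁ (a i) ∈ Member F
          a∈F i = ℚ⊆ F (proj₂ (a i))
          term : Fin p → ⟨ F ⟩
          term i = proj₁ (a i) * proj₁ (basis i) , *-closed F (a∈F i) (proj₂ (basis i))

  b : ⟨ F ⟩
  b = basis (proj₁ moved-basis-element)

  β : Fin p → Carrier
  β i = Hom.map (S.power (toℕ i)) b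

  β∈F : ∀ i → β i ∈ Member F
  β∈F i = proj₂ (Automorphism.iterated σ (toℕ i) b)

  β-distinct : Distinct β
  β-distinct = S.orbit-distinct cyclic p-prime b (proj₂ moved-basis-element)

  b≉0 : ¬ proj₁ b ≈ 0#
  b≉0 b≈0 = proj₂ moved-basis-element (trans (Hom.map-0 (S.power 1) {b} b≈0) (sym b≈0))

  β≉0 : ∀ i → ¬ β i ≈ 0#
  β≉0 i = map-≉0 F (S.power (toℕ i)) {b} b≉0

  module PrimitiveElementOfF = PrimitiveElement ℚ-field (Member F) (proj₁ ∘ basis)
    (λ {y} y∈ → proj₁ ∘ proj₁ (spanning (y , y∈)) , proj₂ ∘ proj₁ (spanning (y , y∈)) , proj₂ (spanning (y , y∈)))
    (proj₁ b) (λ k → Subring.^-closed (subring F) k (proj₂ b)) β β-distinct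
    (λ r r∈ eq j → conjugate-root F (S.power (toℕ j)) r r∈ b eq)

  -- τ would fix ζ, but τ⁰ and τ¹ differ at ζ; both occur in the list of powers because p - 1 ≥ 2.
  ζ∉F : ¬ ζ ∈ Member F
  ζ∉F ζ∈F = contradiction (Z-distinct zero (suc zero) (sym (T.iterated-fixes 1 ζL ζ∈F))) λ ()

  module Σ̃ (i : Fin p) = Lift (S.power (toℕ i))

  σ̃ : Fin p → ⟨ L ⟩ → ⟨ L ⟩
  σ̃ i x = Σ̃.value i x , Σ̃.value∈L i (λ y → proj₂ (Automorphism.iterated σ (toℕ i) y)) x

  -- The lift of σⁱ comes first, so that τʲ applied to a norm is a product of these maps. The
  -- composite acts on F as σⁱ and on ζ as τʲ.
  conjugation : Fin (suc m) → Fin p → Hom (subring L)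
  conjugation j i = record
    { map    = λ x → map (σ̃ i x)
    ; cong   = λ eq → cong (lift.cong eq)
    ; +-homo = λ x y → map-+ {σ̃ i x} {σ̃ i y} (lift.+-homo x y)
    ; *-homo = λ x y → map-* {σ̃ i x} {σ̃ i y} (lift.*-homo x y)
    ; 1-homo = map-1 lift.1-homo
    }
    where
    open Hom (T.power (toℕ j))
    module lift = Hom (Σ̃.lift i)

  conjugation-F : ∀ j i x → Hom.map (conjugation j i) (proj₁ x , F⊆L (proj₂ x)) ≈ Hom.map (S.power (toℕ i)) x
  conjugation-F j i x = trans
    (Hom.cong (T.power (toℕ j)) {y = y , F⊆L y∈F} (Σ̃.lift-F i x))
    (T.iterated-fixes (toℕ j) (y , F⊆L y∈F) y∈F)
    where
    y = Hom.map (S.power (toℕ i)) x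
    y∈F : y ∈ Member F
    y∈F = proj₂ (Automorphism.iterated σ (toℕ i) x)

  conjugation-ζ : ∀ j i → Hom.map (conjugation j i) ζL ≈ Z j
  conjugation-ζ j i = Hom.cong (T.power (toℕ j)) {y = ζL} (Σ̃.lift-ζ i)

  bL θL : ⟨ L ⟩
  bL = proj₁ b , F⊆L (proj₂ b)
  θL = proj₁ b * ζ , *-closed L (proj₂ bL) (proj₂ ζL)

  θ : Carrier
  θ = proj₁ θL

  conjugation-θ : ∀ j i → Hom.map (conjugation j i) θL ≈ β i * Z j
  conjugation-θ j i = trans (Hom.map-* (conjugation j i) {bL} {ζL} {θL} refl)
    (*-cong (conjugation-F j i b) (conjugation-ζ j i))

  -- The quotient u of the two members of F is also a quotient of p-th roots of unity, hence itself
  -- one. If u ≠ 1, then ζ is a power of u and lies in F.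
  conjugates-distinct : ∀ j i j′ i′ → β i * Z j ≈ β i′ * Z j′ → j ≡ j′ × i ≡ i′
  conjugates-distinct j i j′ i′ eq = go (inverse (β i) (β≉0 i))
    where
    go : (∃ λ v → β i * v ≈ 1#) → j ≡ j′ × i ≡ i′
    go (v , βv≈1) = by (u ≟ 1#)
      where
      u = v * β i′
      u∈F : u ∈ Member F
      u∈F = *-closed F (inv-closed F (β∈F i) βv≈1) (β∈F i′)
      Z≈uZ : Z j ≈ u * Z j′
      Z≈uZ = begin
        Z j                     ≈⟨ *-identityˡ _ ⟨
        1# * Z j                ≈⟨ *-congʳ βv≈1 ⟨
        (β i * v) * Z j         ≈⟨ solve 3 (λ x v z → (x :* v) :* z := v :* (x :* z)) refl (β i) v (Z j) ⟩
        v * (β i * Z j)         ≈⟨ *-congˡ eq ⟩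
        v * (β i′ * Z j′)       ≈⟨ *-assoc _ _ _ ⟨
        u * Z j′                ∎
      u^p≈1 : u ^ p ≈ 1#
      u^p≈1 = begin
        u ^ p                   ≈⟨ *-identityʳ _ ⟨
        u ^ p * 1#              ≈⟨ *-congˡ (Z^p≈1 j′) ⟨
        u ^ p * Z j′ ^ p        ≈⟨ ^-distrib-* u (Z j′) p ⟨
        (u * Z j′) ^ p          ≈⟨ ^-congˡ p Z≈uZ ⟨
        Z j ^ p                 ≈⟨ Z^p≈1 j ⟩
        1#                      ∎
      by : Dec (u ≈ 1#) → j ≡ j′ × i ≡ i′
      by (yes u≈1) = Z-distinct j j′ (trans Z≈uZ (trans (*-congʳ u≈1) (*-identityˡ _))) ,
        β-distinct i i′ (begin
          β i                   ≈⟨ *-identityʳ _ ⟨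
          β i * 1#              ≈⟨ *-congˡ u≈1 ⟨
          β i * (v * β i′)      ≈⟨ *-assoc _ _ _ ⟨
          (β i * v) * β i′      ≈⟨ *-congʳ βv≈1 ⟩
          1# * β i′             ≈⟨ *-identityˡ _ ⟩
          β i′                  ∎)
      by (no u≉1) = contradiction
        (ζ-power (powers-exhaust (suc m) p-prime u^p≈1 u≉1 ζ^p≈1)) ζ∉F
        where
        ζ-power : (∃ λ k → ζ ≈ u ^ k) → ζ ∈ Member F
        ζ-power (k , ζ≈) = resp F (sym ζ≈) (Subring.^-closed (subring F) k u∈F)

  -- `suc M` computes to (p - 1) p, the degree of L over ℚ. The index `zero` decodes to the pair (0,
  -- 0), so that `ρ zero` is θ itself.
  M : ℕ
  M = suc m ℕ.+ m ℕ.* p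

  τ-index : Fin (suc M) → Fin (suc m)
  τ-index k = proj₁ (remQuot {suc m} p k)

  σ-index : Fin (suc M) → Fin p
  σ-index k = proj₂ (remQuot {suc m} p k)

  ρ : Fin (suc M) → Carrier
  ρ k = β (σ-index k) * Z (τ-index k)

  ρ-distinct : Distinct ρ
  ρ-distinct k l eq = ≡.trans (≡.sym (Finₚ.combine-remQuot {suc m} p k))
    (≡.trans (≡.cong₂ combine (proj₁ same) (proj₂ same)) (Finₚ.combine-remQuot {suc m} p l))
    where
    same = conjugates-distinct (τ-index k) (σ-index k) (τ-index l) (σ-index l) eq

  ρ-combine : ∀ j i → ρ (combine j i) ≡ β i * Z j
  ρ-combine j i = ≡.cong (λ ji → β (proj₂ ji) * Z (proj₁ ji)) (Finₚ.remQuot-combine {suc m} {p} j i)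

  spanning-L : ∀ {y} → y ∈ Member L →
    InSpan ℚ-field (λ k → proj₁ (basis (σ-index k)) * ζ ^ toℕ (τ-index k)) y
  -- The lift of σ⁰ serves here for the expression of y as a polynomial in ζ over F which it
  -- carries.
  spanning-L {y} y∈ = from-coordinates (Σ̃.value-▷ zero (y , y∈))
    where
    w : Fin (suc M) → Carrier
    w k = proj₁ (basis (σ-index k)) * ζ ^ toℕ (τ-index k)
    from-coordinates : ∀ {z} → Σ̃._▷_ zero y z → InSpan ℚ-field w y
    from-coordinates (r , y≈ , _) = (λ k → a (remQuot {suc m} p k)) , (λ k → a∈ (remQuot {suc m} p k)) , (begin
      y                                          ≈⟨ y≈ ⟩
      ev (proj₁ ∘ r) ζ                           ≈⟨ ev≈∑ (proj₁ ∘ r) ζ ⟩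
      ∑ (λ j → proj₁ (r j) * ζ ^ toℕ j)
        ≈⟨ sum-cong-≋ (λ j → begin
             proj₁ (r j) * ζ ^ toℕ j             ≈⟨ *-congʳ (proj₂ (spanning (r j))) ⟩
             ∑ (λ i → a (j , i) * proj₁ (basis i)) * ζ ^ toℕ j
               ≈⟨ *-distribʳ-sum (ζ ^ toℕ j) (λ i → a (j , i) * proj₁ (basis i)) ⟩
             ∑ (λ i → (a (j , i) * proj₁ (basis i)) * ζ ^ toℕ j)
               ≈⟨ sum-cong-≋ (λ i → trans (*-assoc (a (j , i)) (proj₁ (basis i)) (ζ ^ toℕ j))
                                          (reflexive (≡.sym (term≡ j i)))) ⟩
             ∑ (λ i → term (combine {suc m} {p} j i))        ∎) ⟩
      ∑ (λ j → ∑ (λ i → term (combine {suc m} {p} j i)))       ≈⟨ ∑-combine (suc m) {p} term ⟨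
      ∑ term                                     ∎)
      where
      a : Fin (suc m) × Fin p → Carrier
      a (j , i) = proj₁ (proj₁ (spanning (r j)) i)
      a∈ : ∀ ji → a ji ∈ Member ℚ-field
      a∈ (j , i) = proj₂ (proj₁ (spanning (r j)) i)
      term : Fin (suc M) → Carrier
      term k = a (remQuot {suc m} p k) * w k
      term≡ : ∀ j i → term (combine {suc m} {p} j i) ≡ a (j , i) * (proj₁ (basis i) * ζ ^ toℕ j)
      term≡ j i = ≡.cong (λ ji → a ji * (proj₁ (basis (proj₂ ji)) * ζ ^ toℕ (proj₁ ji)))
                         (Finₚ.remQuot-combine {suc m} {p} j i)

  module PrimitiveElementOfL = PrimitiveElement ℚ-field (Member L)
    (λ k → proj₁ (basis (σ-index k)) * ζ ^ toℕ (τ-index k)) spanning-L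
    θ (λ k → Subring.^-closed (subring L) k (proj₂ θL)) ρ ρ-distinct
    (λ r r∈ eq k → trans (ev-cong {a = r} {r} (λ _ → refl) (sym (conjugation-θ (τ-index k) (σ-index k))))
      (conjugate-root L (conjugation (τ-index k) (σ-index k)) r r∈ θL eq))

  K : Subfield _
  K = ℚ⟨ ζ ⟩

  lifted-embedding : Fin p → Embedding K L
  lifted-embedding i = record
    { map = Σ̃.value i
    ; isRingMonomorphism = hom⇒monomorphism L (Σ̃.lift i)
    ; fixes = λ { (x , x∈) x∈K → agree-on-generated L (Σ̃.lift i) (inclusion-hom L)
        (λ ζ≈y → resp L ζ≈y (proj₂ ζL))
        (λ {y} ζ≈y y∈ → trans (Hom.cong (Σ̃.lift i) {y , y∈} {ζL} (sym ζ≈y)) (trans (Σ̃.lift-ζ i) ζ≈y))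
        x∈K x∈ }
    }

  lifted-distinct : ∀ i j → (∀ y → Σ̃.value i y ≈ Σ̃.value j y) → i ≡ j
  lifted-distinct i j eq = β-distinct i j
    (trans (sym (Σ̃.lift-F i b {proj₂ bL})) (trans (eq bL) (Σ̃.lift-F j b {proj₂ bL})))

  -- g sends b to a root of the minimal polynomial of b over ℚ, that is to some σⁱ(b). As b
  -- generates F, this determines g on F, and g fixes ζ because it is an embedding over K.
  lifted-complete : (g : Embedding K L) → ∃ λ i → ∀ y → Embedding.map g y ≈ Σ̃.value i y
  lifted-complete g = proj₁ hit , agree-on-L G (Σ̃.lift i)
    (λ {x} x∈F x∈ → trans (Hom.cong G refl) (trans (agree-F (x , x∈F)) (sym (Σ̃.lift-F i (x , x∈F)))))
    (trans (Embedding.fixes g ζL (gen refl)) (sym (Σ̃.lift-ζ i)))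
    where
    open PrimitiveElementOfF
    G : Hom (subring L)
    G = monomorphism⇒hom L (Embedding.isRingMonomorphism g)
    G′ : Hom (subring F)
    G′ = record
      { map = λ x → Hom.map G (proj₁ x , F⊆L (proj₂ x)) ; cong = Hom.cong G
      ; +-homo = λ x y → Hom.map-+ G {proj₁ x , F⊆L (proj₂ x)} {proj₁ y , F⊆L (proj₂ y)} refl
      ; *-homo = λ x y → Hom.map-* G {proj₁ x , F⊆L (proj₂ x)} {proj₁ y , F⊆L (proj₂ y)} refl
      ; 1-homo = Hom.map-1 G refl }
    map-polynomial : (h : Hom (subring F)) → ∀ {k} (r : Fin k → Carrier) → (∀ i → r i ∈ Member ℚ-field) →
      ∀ y → proj₁ y ≈ ev r (proj₁ b) → Hom.map h y ≈ ev r (Hom.map h b)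
    map-polynomial h r r∈ y y≈ = trans (Hom.map-ev h (λ i → r i , ℚ⊆ F (r∈ i)) {b} {y} y≈)
      (ev-cong (λ i → map-rational F h (r∈ i) (ℚ⊆ F (r∈ i))) refl)
    b^p : ⟨ F ⟩
    b^p = proj₁ b ^ p , Subring.^-closed (subring F) p (proj₂ b)
    hit : ∃ λ i → Hom.map G′ b ≈ β i
    hit = root-is-conjugate (trans (sym (Hom.map-^ G′ p {b} {b^p} refl))
      (map-polynomial G′ coefficients coefficients∈k b^p α-root))
    i = proj₁ hit
    agree-F : ∀ y → Hom.map G′ y ≈ Hom.map (S.power (toℕ i)) y
    agree-F y = from-expression (express (proj₂ y))
      where
      from-expression : (Σ (Fin p → Carrier) λ r → (∀ i → r i ∈ Member ℚ-field) × proj₁ y ≈ ev r (proj₁ b)) →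
        Hom.map G′ y ≈ Hom.map (S.power (toℕ i)) y
      from-expression (r , r∈ , y≈) = begin
        Hom.map G′ y                         ≈⟨ map-polynomial G′ r r∈ y y≈ ⟩
        ev r (Hom.map G′ b)                  ≈⟨ ev-cong {a = r} {r} (λ _ → refl) (proj₂ hit) ⟩
        ev r (Hom.map (S.power (toℕ i)) b)   ≈⟨ map-polynomial (S.power (toℕ i)) r r∈ y y≈ ⟨
        Hom.map (S.power (toℕ i)) y          ∎

  norm : ⟨ L ⟩ → ⟨ L ⟩
  norm x = ∏ (λ i → proj₁ (σ̃ i x)) , Subring.∏-closed (subring L) (λ i → proj₁ (σ̃ i x)) (λ i → proj₂ (σ̃ i x))

  norm-isNorm : ∀ x → IsNorm K L x (proj₁ (norm x))
  norm-isNorm x = record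
    { size = p ; embedding = lifted-embedding ; distinct = lifted-distinct
    ; complete = lifted-complete ; product = refl }

  -- The valuation of the resolvent, and the infinitely many elements

  module Resolvent (e : ℕ) (p∤e : p ∤ e) where
    open Rationals Ω
    open SplitPrime Ω
    open Valuation Ω
    open PrimitiveElementOfL

    exponent : Fin (suc m) → ℕ
    exponent j = e ℕ.^ (p ∸ 2 ∸ toℕ j)

    -- `Φ` evaluated in the ambient field, where no membership proofs accompany the factors.
    Ψ : ⟨ L ⟩ → Carrier
    Ψ y = ∏ (λ j → Hom.map (T.power (toℕ j)) y ^ exponent j)

    ρ∈L : ∀ k → ρ k ∈ Member L
    ρ∈L k = *-closed L (F⊆L (β∈F (σ-index k))) (proj₂ (Automorphism.iterated τ (toℕ (τ-index k)) ζL))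

    ρ≉0 : ∀ k → ¬ ρ k ≈ 0#
    ρ≉0 k = x*y≉0 (β≉0 (σ-index k)) (x^n≈1⇒x≉0 (suc m) (Z^p≈1 (τ-index k)))

    -- Up to sign this is the product of the conjugates of θ. `root-mod-prime` evaluates at
    -- multiples of it, which must be distinct.
    constant-term≉0 : ¬ coefficients zero ≈ 0#
    constant-term≉0 c₀≈0 = ∏≉0 (λ k → 0# - ρ k)
      (λ k eq → ρ≉0 k (sym (x-y≈0⇒x≈y eq)))
      (begin
        ∏ (λ k → 0# - ρ k)                      ≈⟨ minimal-polynomial 0# ⟨
        0# * 0# ^ M - (coefficients zero + 0# * ev (coefficients ∘ suc) 0#)
          ≈⟨ +-congˡ (-‿cong (+-congʳ c₀≈0)) ⟩
        0# * 0# ^ M - (0# + 0# * ev (coefficients ∘ suc) 0#)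
          ≈⟨ solve 2 (λ u v → con (+ 0) :* u :- (con (+ 0) :+ con (+ 0) :* v) := con (+ 0)) refl _ _ ⟩
        0#                                      ∎)

    abstract
      -- Once these inverses are integral, θ - ρ has a unit residue: at the place no other conjugate
      -- falls together with θ.
      gap-inverse : ∀ k → ∃ λ y → (θ - ρ (suc k)) * y ≈ 1#
      gap-inverse k = inverse (θ - ρ (suc k))
        (λ eq → contradiction (ρ-distinct zero (suc k) (x-y≈0⇒x≈y eq)) λ ())

    gap-inverse∈L : ∀ k → proj₁ (gap-inverse k) ∈ Member L
    gap-inverse∈L k = inv-closed L (+-closed L (proj₂ θL) (neg-closed L (ρ∈L (suc k)))) (proj₂ (gap-inverse k))

    Denominator : ℕ → Set ℓ
    Denominator d = (∀ i → Clears (suc d) (coefficients i))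
      × (∀ k i → Clears (suc d) (proj₁ (express (ρ∈L k)) i))
      × (∀ k i → Clears (suc d) (proj₁ (express (gap-inverse∈L k)) i))

    abstract
      denominator : ∃ Denominator
      denominator = combine-denominators
        (common-denominator coefficients coefficients∈k)
        (common-denominator₂ (λ k → proj₁ (express (ρ∈L k))) (λ k → proj₁ (proj₂ (express (ρ∈L k)))))
        (common-denominator₂ (λ k → proj₁ (express (gap-inverse∈L k)))
                             (λ k → proj₁ (proj₂ (express (gap-inverse∈L k)))))
        where
        combine-denominators :
          (∃ λ d → ∀ i → Clears (suc d) (coefficients i)) →
          (∃ λ d → ∀ k i → Clears (suc d) (proj₁ (express (ρ∈L k)) i)) →
          (∃ λ d → ∀ k i → Clears (suc d) (proj₁ (express (gap-inverse∈L k)) i)) → ∃ Denominator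
        combine-denominators (d₁ , cl₁) (d₂ , cl₂) (d₃ , cl₃) = d ,
          (λ i → clears-∣ {suc d₁} {suc d} {coefficients i} (cl₁ i) (m∣m*n (suc d₂ ℕ.* suc d₃))) ,
          (λ k i → clears-∣ {suc d₂} {suc d} {proj₁ (express (ρ∈L k)) i} (cl₂ k i)
            (∣-trans (m∣m*n (suc d₃)) (n∣m*n (suc d₁)))) ,
          (λ k i → clears-∣ {suc d₃} {suc d} {proj₁ (express (gap-inverse∈L k)) i} (cl₃ k i)
            (∣-trans (n∣m*n (suc d₂)) (n∣m*n (suc d₁))))
          where
          -- The predecessor of (d₁ + 1) (d₂ + 1) (d₃ + 1).
          d : ℕ
          d = (d₃ ℕ.+ d₂ ℕ.* suc d₃) ℕ.+ d₁ ℕ.* suc (d₃ ℕ.+ d₂ ℕ.* suc d₃)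

    module AtRoot (d : ℕ) (den : Denominator d) (root : RootModPrime (suc d) coefficients) where
      open RootModPrime root
      open Localization q q-prime
      open AtPrime q q-prime

      cleared⇒local : ∀ {x} → Clears (suc d) x → x ∈ Local
      cleared⇒local cl = suc d , q∤D , cl

      open Place M (λ i → coefficients i , cleared⇒local (proj₁ den i)) θ t α-root t-local t-root
        (λ r eq → independent (proj₁ ∘ r) (λ i → local⇒rational (proj₂ (r i))) eq)

      expressible⇒integral : ∀ {y} (r : Fin (suc M) → Carrier) → (∀ i → r i ∈ Local) → y ≈ ev r θ → Integral y
      expressible⇒integral r r∈ y≈ = _ , ▷-resp (sym y≈) refl (ev-▷ (λ i → r i , r∈ i))

      ρ-integral : ∀ k → Integral (ρ k)
      ρ-integral k = expressible⇒integral (proj₁ (express (ρ∈L k))) (λ i → cleared⇒local (proj₁ (proj₂ den) k i))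
        (proj₂ (proj₂ (express (ρ∈L k))))

      t-▷ : t ▷ t
      t-▷ = const-▷ (t , t-local)

      -- θ and t have the same residue, so t - ρ has the residue of θ - ρ, which is a unit because θ
      -- - ρ has an integral inverse.
      t-ρ-invertible : ∀ k → Invertible (t - ρ (suc k))
      t-ρ-invertible k = _ , +-▷ t-▷ -ρ-▷ , unit-∣ (+-▷ θ-▷ -ρ-▷) (proj₂ y-integral)
        (invertible-resp (sym (proj₂ (gap-inverse k))) invertible-1)
        where
        -ρ-▷ = neg-▷ (proj₂ (ρ-integral (suc k)))
        y-integral : Integral (proj₁ (gap-inverse k))
        y-integral = expressible⇒integral (proj₁ (express (gap-inverse∈L k)))
          (λ i → cleared⇒local (proj₂ (proj₂ den) k i)) (proj₂ (proj₂ (express (gap-inverse∈L k))))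

      H : Carrier
      H = ∏ (λ k → t - ρ (suc k))

      H-invertible : Invertible H
      H-invertible = invertible-∏ (λ k → t - ρ (suc k)) t-ρ-invertible

      H-root : (t - θ) * H ≈ Q * proj₁ t-root
      H-root = trans (sym (minimal-polynomial t)) (proj₂ (proj₂ t-root))

      open Uniformizer H H-invertible (proj₁ t-root) (proj₁ (proj₂ t-root)) H-root

      -- Where t - ρ vanishes its square has valuation at least 2, so that q determines the
      -- valuation of X; elsewhere X remains invertible.
      X : Fin (suc M) → Carrier
      X k = (t - ρ k) * (t - ρ k) + Q

      -- Multiplication by H² turns the square into q² a² and the whole into q (H² + q a²), whose
      -- second factor has the residue of H² modulo q.
      X-zero-valuation : Valuation (X zero) 1
      X-zero-valuation = valuation (invertible-* H-invertible H-invertible)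
        (invertible-+Q (invertible-* H-invertible H-invertible) (const-▷ (a * a , *-closed′ a∈ a∈)))
        (begin
          (H * H) * ((t - θ) * (t - θ) + Q)
            ≈⟨ solve 3 (λ h x q → (h :* h) :* (x :* x :+ q) := (x :* h) :* (x :* h) :+ q :* (h :* h))
                 refl H (t - θ) Q ⟩
          ((t - θ) * H) * ((t - θ) * H) + Q * (H * H)
            ≈⟨ +-congʳ (*-cong H-root H-root) ⟩
          (Q * a) * (Q * a) + Q * (H * H)
            ≈⟨ solve 3 (λ q a h → (q :* a) :* (q :* a) :+ q :* (h :* h)
                          := (q :* con (+ 1)) :* (h :* h :+ q :* (a :* a))) refl Q a H ⟩
          Q ^ 1 * (H * H + Q * (a * a)) ∎)
        where
        a = proj₁ t-root
        a∈ = proj₁ (proj₂ t-root)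

      X-other-valuation : ∀ k → ¬ k ≡ zero → Valuation (X k) 0
      X-other-valuation zero    k≢0 = contradiction ≡.refl k≢0
      X-other-valuation (suc k) k≢0 = invertible⇒valuation-0 (invertible-resp (+-congˡ (*-identityʳ Q))
        (invertible-+Q (invertible-* (t-ρ-invertible k) (t-ρ-invertible k)) 1-▷))

      tL QL x₀ : ⟨ L ⟩
      tL = t , ℚ⊆ L (local⇒rational t-local)
      QL = Q , ι-closed L (+ q)
      x₀ = (t - θ) * (t - θ) + Q , +-closed L (*-closed L gap∈L gap∈L) (proj₂ QL)
        where
        gap∈L = +-closed L (proj₂ tL) (neg-closed L (proj₂ θL))

      conjugation-x₀ : ∀ j i → Hom.map (conjugation j i) x₀ ≈ X (combine {suc m} {p} j i)
      conjugation-x₀ j i = begin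
        map x₀                             ≈⟨ map-+ {square} {QL} {x₀} refl ⟩
        map square + map QL                ≈⟨ +-cong (map-* {gap} {gap} {square} refl)
                                                (map-rational L (conjugation j i) (ι-closed ℚ-field (+ q)) (proj₂ QL)) ⟩
        map gap * map gap + Q              ≈⟨ +-congʳ (*-cong map-gap map-gap) ⟩
        X (combine j i)                    ∎
        where
        open Hom (conjugation j i)
        gap square : ⟨ L ⟩
        gap = t - θ , +-closed L (proj₂ tL) (neg-closed L (proj₂ θL))
        square = (t - θ) * (t - θ) , *-closed L (proj₂ gap) (proj₂ gap)
        map-gap : map gap ≈ t - ρ (combine j i)
        map-gap = trans (map-- {tL} {θL} {gap} refl)
          (+-cong (map-rational L (conjugation j i) (local⇒rational t-local) (proj₂ tL))
            (-‿cong (trans (conjugation-θ j i) (reflexive (≡.sym (ρ-combine j i))))))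

      N : Fin (suc m) → Carrier
      N j = Hom.map (T.power (toℕ j)) (norm x₀)

      -- τʲ carries the norm to the product over row j of the grid of conjugates. Only row 0
      -- contains the index `zero` of θ.
      τ-norm : ∀ j → N j ≈ ∏ {p} (λ i → X (combine {suc m} {p} j i))
      τ-norm j = trans (Hom.map-∏ (T.power (toℕ j)) (λ i → σ̃ i x₀) {norm x₀} refl)
        (∏-cong {p} {λ i → Hom.map (conjugation j i) x₀} {λ i → X (combine {suc m} {p} j i)} (conjugation-x₀ j))

      τ-norm-zero-valuation : Valuation (N zero) 1
      τ-norm-zero-valuation = valuation-resp {∏ {p} (λ i → X (combine {suc m} {p} zero i))} {N zero} {1} (sym (τ-norm zero))
        (valuation-∏-head {suc m} {1} (λ i → X (combine {suc m} {p} zero i)) X-zero-valuation (λ i → X-other-valuation (combine {suc m} {p} zero (suc i)) (λ ())))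

      τ-norm-suc-valuation : ∀ j → Valuation (N (suc j)) 0
      τ-norm-suc-valuation j = valuation-resp {∏ {p} (λ i → X (combine {suc m} {p} (suc j) i))} {N (suc j)} {0} (sym (τ-norm (suc j)))
        (valuation-∏-0 {p} (λ i → X (combine {suc m} {p} (suc j) i)) (λ i → X-other-valuation (combine {suc m} {p} (suc j) i) (λ ())))

      Ψ-valuation : Valuation (Ψ (norm x₀)) (exponent zero ℕ.* 1)
      Ψ-valuation = valuation-∏-head {m} {exponent zero ℕ.* 1} (λ j → N j ^ exponent j)
        (valuation-^ (exponent zero) τ-norm-zero-valuation)
        (λ j → ≡.subst (Valuation (N (suc j) ^ exponent (suc j))) (ℕₚ.*-zeroʳ (exponent (suc j)))
          (valuation-^ (exponent (suc j)) (τ-norm-suc-valuation j)))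

      L-clears : ∀ (w : ⟨ L ⟩) → ∃ λ k → Integral (Q ^ k * proj₁ w)
      L-clears (w , w∈) = clear (express w∈)
        where
        clear : (Σ (Fin (suc M) → Carrier) λ r → (∀ i → r i ∈ Member ℚ-field) × w ≈ ev r θ) →
          ∃ λ k → Integral (Q ^ k * w)
        clear (r , r∈ , w≈) = with-power (common-q-power r r∈)
          where
          with-power : (∃ λ k → ∀ i → Q ^ k * r i ∈ Local) → ∃ λ k → Integral (Q ^ k * w)
          with-power (k , local-r) = k , expressible⇒integral (λ i → Q ^ k * r i) local-r
            (trans (*-congˡ w≈) (sym (ev-*ˡ (Q ^ k) r θ)))

      -- A p²-th root would give p² ∣ p e^(p-2). Cancelling p leaves p ∣ e^(p-2), against p ∤ e.
      not-power : ∀ (w : ⟨ L ⟩) → ¬ (proj₁ w ^ p) ^ p ≈ Ψ (norm x₀) ^ p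
      not-power w eq = ∤-^ p-prime p∤e (p ∸ 2) (≡.subst (p ∣_) (ℕₚ.*-identityʳ _)
        (*-cancelˡ-∣ p (valuation-of-power (p ℕ.* p) {proj₁ w} {k = proj₁ (L-clears w)} (proj₂ (L-clears w))
          (trans (sym (^-assocʳ (proj₁ w) p p)) eq) (valuation-^ p Ψ-valuation))))

      -- The conjugate of x₀ with index 1 is invertible at the place, so it cannot be 0.
      x₀≉0 : ¬ proj₁ x₀ ≈ 0#
      x₀≉0 x₀≈0 = ¬invertible-multiple {z = 0#}
        (invertible-resp (+-congˡ (*-identityʳ Q))
          (invertible-+Q (invertible-* (t-ρ-invertible k) (t-ρ-invertible k)) 1-▷))
        (const-▷ (0# , 0-closed′)) In-0
        (trans (sym (conjugation-x₀ zero (suc zero))) (Hom.map-0 (conjugation zero (suc zero)) {x₀} x₀≈0))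
        where
        k : Fin M
        k = zero

    abstract
      witness : ∃ λ x₀ → ¬ proj₁ x₀ ≈ 0# × (∀ (w : ⟨ L ⟩) → ¬ (proj₁ w ^ p) ^ p ≈ Ψ (norm x₀) ^ p)
      witness = x₀ , x₀≉0 , not-power
        where
        open AtRoot (proj₁ denominator) (proj₂ denominator)
          (root-mod-prime (proj₁ denominator) coefficients constant-term≉0
            (proj₁ (proj₂ denominator)))

    private module Lᴿ = CommutativeRing (ring-of L)
    open Exp Lᴿ.semiring using () renaming (_^_ to _^ᴸ_)
    open BigOp Lᴿ.*-commutativeMonoid using () renaming (sum to ∏ᴸ)

    proj₁-^ : ∀ x k → proj₁ (x ^ᴸ k) ≈ proj₁ x ^ k
    proj₁-^ x zero    = refl
    proj₁-^ x (suc k) = *-congˡ (proj₁-^ x k)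

    proj₁-∏ : ∀ {k} (g : Fin k → ⟨ L ⟩) → proj₁ (∏ᴸ g) ≈ ∏ (proj₁ ∘ g)
    proj₁-∏ {zero}  g = refl
    proj₁-∏ {suc k} g = *-congˡ (proj₁-∏ (g ∘ suc))

    Φ≈Ψ : ∀ y → proj₁ (Φ L p e τ y) ≈ Ψ y
    Φ≈Ψ y = trans (proj₁-∏ {suc m} (λ j → Automorphism.iterated τ (toℕ j) y ^ᴸ exponent j))
      (∏-cong {suc m} {λ j → proj₁ (Automorphism.iterated τ (toℕ j) y ^ᴸ exponent j)}
        (λ j → proj₁-^ (Automorphism.iterated τ (toℕ j) y) (exponent j)))

    Ψ-term : ⟨ L ⟩ → Fin (suc m) → Carrier
    Ψ-term y j = Hom.map (T.power (toℕ j)) y ^ exponent j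

    Ψ-* : ∀ {x y z} → proj₁ z ≈ proj₁ x * proj₁ y → Ψ z ≈ Ψ x * Ψ y
    Ψ-* {x} {y} {z} eq = begin
      ∏ (Ψ-term z)                           ≈⟨ ∏-cong {suc m} {Ψ-term z} (λ j → trans
                                                  (^-congˡ (exponent j) (Hom.map-* (T.power (toℕ j)) {x} {y} {z} eq))
                                                  (^-distrib-* (Hom.map (T.power (toℕ j)) x) (Hom.map (T.power (toℕ j)) y) (exponent j))) ⟩
      ∏ (λ j → Ψ-term x j * Ψ-term y j)      ≈⟨ ∏-distrib-* {suc m} (Ψ-term x) (Ψ-term y) ⟩
      Ψ x * Ψ y                              ∎

    Ψ-1 : ∀ {x} → proj₁ x ≈ 1# → Ψ x ≈ 1#
    Ψ-1 {x} x≈1 = trans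
      (∏-cong {suc m} {Ψ-term x} {λ _ → 1#} (λ j → trans
        (^-congˡ (exponent j) (Hom.map-1 (T.power (toℕ j)) {x} x≈1)) (1^n≈1 (exponent j))))
      (∏1≈1 (suc m))
      where
      ∏1≈1 : ∀ k → ∏ {k} (λ _ → 1#) ≈ 1#
      ∏1≈1 zero    = refl
      ∏1≈1 (suc k) = trans (*-identityˡ _) (∏1≈1 k)

    Ψ-^ : ∀ k {x y} → proj₁ y ≈ proj₁ x ^ k → Ψ y ≈ Ψ x ^ k
    Ψ-^ zero        y≈ = Ψ-1 y≈
    Ψ-^ (suc k) {x} {y} y≈ = trans (Ψ-* {x} {xᵏ} {y} y≈) (*-congˡ (Ψ-^ k {x} {xᵏ} refl))
      where
      xᵏ : ⟨ L ⟩
      xᵏ = proj₁ x ^ k , Subring.^-closed (subring L) k (proj₂ x)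

    Ψ∈L : ∀ y → Ψ y ∈ Member L
    Ψ∈L y = Subring.∏-closed (subring L) (Ψ-term y)
      (λ j → Subring.^-closed (subring L) (exponent j) (proj₂ (Automorphism.iterated τ (toℕ j) y)))

    x₀ : ⟨ L ⟩
    x₀ = proj₁ witness

    module Scaled (k : ℕ) where
      s : Carrier
      s = ⟪ suc k ⟫

      sL x : ⟨ L ⟩
      sL = s , ι-closed L (+ suc k)
      x = s * proj₁ x₀ , *-closed L (proj₂ sL) (proj₂ x₀)

      norm-x : proj₁ (norm x) ≈ s ^ p * proj₁ (norm x₀)
      norm-x = trans
        (∏-cong {p} {λ i → proj₁ (σ̃ i x)} {λ i → s * proj₁ (σ̃ i x₀)} (λ i → trans
          (Hom.map-* (Σ̃.lift i) {sL} {x₀} {x} refl)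
          (*-congʳ (map-rational L (Σ̃.lift i) (ι-closed ℚ-field (+ suc k)) (proj₂ sL)))))
        (scale p (λ i → proj₁ (σ̃ i x₀)))
        where
        scale : ∀ k (g : Fin k → Carrier) → ∏ (λ i → s * g i) ≈ s ^ k * ∏ g
        scale zero    g = sym (*-identityˡ 1#)
        scale (suc k) g = trans (*-congˡ (scale k (g ∘ suc)))
          (solve 4 (λ s g u v → (s :* g) :* (u :* v) := (s :* u) :* (g :* v)) refl
            s (g zero) (s ^ k) (∏ (g ∘ suc)))

      Ψ-norm-x : Ψ (norm x) ≈ Ψ sL ^ p * Ψ (norm x₀)
      Ψ-norm-x = trans (Ψ-* {sᵖ} {norm x₀} {norm x} norm-x) (*-congʳ (Ψ-^ p {sL} {sᵖ} refl))
        where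
        sᵖ : ⟨ L ⟩
        sᵖ = s ^ p , Subring.^-closed (subring L) p (proj₂ sL)

      -- The p-th power of the equation eliminates ω.
      no-root : ∀ (w : ⟨ L ⟩) {ω} → ω ^ p ≈ 1# → ¬ proj₁ w ^ p ≈ ω * Ψ (norm x)
      no-root w {ω} ω^p≈1 eq = from-inverse (inverse s (⟪suc⟫≉0 k))
        where
        from-inverse : ¬ ∃ λ v → s * v ≈ 1#
        from-inverse (v , sv≈1) = proj₂ (proj₂ witness) w′ (begin
          ((W * V) ^ p) ^ p
            ≈⟨ ^-congˡ p (begin
                 (W * V) ^ p                               ≈⟨ ^-distrib-* W V p ⟩
                 W ^ p * V ^ p                             ≈⟨ *-congʳ (trans eq (*-congˡ Ψ-norm-x)) ⟩
                 (ω * (U ^ p * Ψ (norm x₀))) * V ^ p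
                   ≈⟨ solve 4 (λ o u y v → (o :* (u :* y)) :* v := (u :* v) :* (o :* y)) refl
                        ω (U ^ p) (Ψ (norm x₀)) (V ^ p) ⟩
                 (U ^ p * V ^ p) * (ω * Ψ (norm x₀))       ≈⟨ *-congʳ (begin
                   U ^ p * V ^ p                           ≈⟨ ^-distrib-* U V p ⟨
                   (U * V) ^ p                             ≈⟨ ^-congˡ p UV≈1 ⟩
                   1# ^ p                                  ≈⟨ 1^n≈1 p ⟩
                   1#                                      ∎) ⟩
                 1# * (ω * Ψ (norm x₀))                    ≈⟨ *-identityˡ _ ⟩
                 ω * Ψ (norm x₀)                           ∎) ⟩
          (ω * Ψ (norm x₀)) ^ p                            ≈⟨ ^-distrib-* ω (Ψ (norm x₀)) p ⟩
          ω ^ p * Ψ (norm x₀) ^ p                          ≈⟨ *-congʳ ω^p≈1 ⟩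
          1# * Ψ (norm x₀) ^ p                             ≈⟨ *-identityˡ _ ⟩
          Ψ (norm x₀) ^ p                                  ∎)
          where
          vL w′ : ⟨ L ⟩
          vL = v , inv-closed L (proj₂ sL) sv≈1
          W U V : Carrier
          W = proj₁ w
          U = Ψ sL
          V = Ψ vL
          -- `Ψ vL` is the inverse of `Ψ sL`, so the p-th power of this product is ω times
          -- `Ψ (norm x₀)`.
          w′ = W * V , *-closed L (proj₂ w) (Ψ∈L vL)
          UV≈1 : U * V ≈ 1#
          UV≈1 = trans (sym (Ψ-* {sL} {vL} {1# , 1-closed L} (sym sv≈1))) (Ψ-1 {1# , 1-closed L} refl)

      not-power₁ : ¬ IsPower L p (Φ L p e τ (norm x))
      not-power₁ (w , _ , w^p≈) = no-root w {1#} (1^n≈1 p)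
        (trans (sym (proj₁-^ w p)) (trans w^p≈ (trans (Φ≈Ψ (norm x)) (sym (*-identityˡ _)))))

      not-power₂ : ¬ IsPower L p (Φ L p e τ (ζL Lᴿ.* norm x))
      not-power₂ (w , _ , w^p≈) = no-root w {Ψ ζL}
        (trans (sym (Ψ-^ p {ζL} {1# , 1-closed L} (sym ζ^p≈1))) (Ψ-1 {1# , 1-closed L} refl))
        (trans (sym (proj₁-^ w p)) (trans w^p≈ (trans (Φ≈Ψ (ζL Lᴿ.* norm x))
          (Ψ-* {ζL} {norm x} {ζL Lᴿ.* norm x} refl))))

      x≉0 : Nonzero L x
      x≉0 = x*y≉0 (⟪suc⟫≉0 k) (proj₁ (proj₂ witness))

    scaled-injective : ∀ {j k} → proj₁ (Scaled.x j) ≈ proj₁ (Scaled.x k) → j ≡ k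
    scaled-injective {j} {k} eq = ℕₚ.suc-injective (ℤₚ.+-injective (ι-injective (+ suc j) (+ suc k)
      (*-cancelˡ (proj₁ (proj₂ witness)) (trans (*-comm _ _) (trans eq (*-comm _ _))))))

    -- There is one more candidate than the list has entries. If all were taken, two distinct
    -- candidates would share a position; decidable equality yields a free one explicitly.
    avoid : (xs : List ⟨ L ⟩) → ∃ λ k → All (λ y → ¬ proj₁ (Scaled.x k) ≈ proj₁ y) xs
    avoid xs = toℕ (proj₁ free) , ¬Any⇒All¬ xs (proj₂ free)
      where
      Taken : Fin (suc (length xs)) → Set _
      Taken k = Any (λ y → proj₁ (Scaled.x (toℕ k)) ≈ proj₁ y) xs
      not-all-taken : ¬ (∀ k → Taken k)
      not-all-taken taken = collide (Finₚ.pigeonhole (ℕₚ.n<1+n (length xs)) (Any.index ∘ taken))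
        where
        collide : ¬ ∃₂ λ i j → i Fin.< j × Any.index (taken i) ≡ Any.index (taken j)
        collide (i , j , i<j , same) = ℕₚ.<⇒≢ i<j (scaled-injective (begin
          proj₁ (Scaled.x (toℕ i))                  ≈⟨ lookup-index (taken i) ⟩
          proj₁ (lookup xs (Any.index (taken i)))   ≡⟨ ≡.cong (proj₁ ∘ lookup xs) same ⟩
          proj₁ (lookup xs (Any.index (taken j)))   ≈⟨ lookup-index (taken j) ⟨
          proj₁ (Scaled.x (toℕ j))                  ∎))
      free : ∃ λ k → ¬ Taken k
      free = Finₚ.¬∀⟶∃¬ _ Taken (λ k → Any.any? (λ y → proj₁ (Scaled.x (toℕ k)) ≟ proj₁ y) xs) not-all-taken

    infinitely-many : InfinitelyManyNonzero L λ x → ∃ λ (z : ⟨ L ⟩) → IsNorm K L x (proj₁ z) ×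
      ¬ IsPower L p (Φ L p e τ z) × ¬ IsPower L p (Φ L p e τ (ζL Lᴿ.* z))
    infinitely-many xs = x , proj₂ (avoid xs) , x≉0 , norm x , norm-isNorm x , not-power₁ , not-power₂
      where open Scaled (proj₁ (avoid xs))

corollary3p4 : ∀ {c ℓ f} (Ω : AlgebraicClosureOfℚ c ℓ) →
    let open AlgebraicClosureOfℚ Ω
        open FieldTheory Ω
    in
    (p : ℕ) → Prime p → ¬ (2 ∣ p) →
    (ζ : Carrier) → PrimitiveRootOfUnity p ζ →
    (F : Subfield f) → IsCyclicExtension ℚ-field F p →
    let K = ℚ⟨ ζ ⟩
        L = compositum F K
        ζ-in-L = ζ-in-compositum F ζ
        open CommutativeRing (ring-of L) using () renaming (_*_ to _*L_)
    in
    (τ : Automorphism F L) → CyclicGenerator F L (p ∸ 1) τ →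
    (e : ℕ) → PrimitiveRootMod p e →
    InfinitelyManyNonzero L λ x →
      ∃ λ (n : ⟨ L ⟩) →
        IsNorm K L x (proj₁ n) ×
        ¬ IsPower L p (Φ L p e τ n) ×
        ¬ IsPower L p (Φ L p e τ (ζ-in-L *L n))
corollary3p4 Ω 0 p-prime = contradiction p-prime ¬prime[0]
corollary3p4 Ω 1 p-prime = contradiction p-prime ¬prime[1]
corollary3p4 Ω 2 p-prime 2∤p = contradiction ∣-refl 2∤p
corollary3p4 Ω (suc (suc (suc n))) p-prime 2∤p ζ ζ-primitive F F-cyclic τ τ-cyclic e (e-coprime , _) =
  Compositum.Resolvent.infinitely-many Ω n p-prime ζ ζ-primitive F F-cyclic τ τ-cyclic e
    -- A common divisor of e and p is 1, so p ∣ e would give p = 1.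
    (λ p∣e → contradiction (e-coprime (p∣e , ∣-refl)) λ ())
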